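{- Let $P$ and $Q$ be a well fed program and a well fed query, and let $P'$ and $Q'$ be a robustly typed program and a robustly typed query corresponding to $P$ and $Q$. If every LD-derivation of $P'\cup\{Q'\}$ is finite, then every left-based derivation of $P\cup\{Q\}$ is finite.
   Context: Basics. A query is a finite sequence of atoms; a clause is $h\leftarrow B$ with $h$ an atom and $B$ a query. Every predicate has a fixed mode, i.e. each argument position is either input or output; $p(\mathbf s,\mathbf t)$ denotes an atom with $\mathbf s$ (resp. $\mathbf t$) the vector of terms filling the input (resp. output) positions. In clause heads $p(\mathbf t_0,\mathbf s_{n+1})$, $\mathbf t_0$ is the input and $\mathbf s_{n+1}$ the output. A syntactic object is linear if each variable occurs in it at most once. A clause is input-linear if the vector of input terms of its head is linear; a program is input-linear if all its clauses are and it does not use the equality predicate $=$ with both arguments input. A flat term is a variable or a term $f(x_1,\dots,x_n)$, $n\ge 0$, with distinct variables $x_i$. A permutation $\pi$ on $\{1,\dots,n\}$ is extended by $\pi(i)=i$ outside $\{1,\dots,n\}$, and $\pi(o_1,\dots,o_n)=o_{\pi^{ -1}(1)},\dots,o_{\pi^{ -1}(n)}$. Types. A type is a set of terms closed under instantiation. The variable type is the type that contains variables and hence all terms; any other type is a non-variable type. Each argument position of each predicate has an associated type. $t:T$ means $t\in T$ (componentwise for vectors); $\models \varphi\Rightarrow \mathbf t:\mathbf T$ means that the implication holds after applying any substitution to all terms. A term is type-consistent (in a position of type $T$) if some instance of it is in $T$. Nicely moded. $Q=p_1(\mathbf s_1,\mathbf t_1),\dots,p_n(\mathbf s_n,\mathbf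 t_n)$ is $\pi$-nicely moded if $\mathbf t_1,\dots,\mathbf t_n$ is linear and for all $i$, $vars(\mathbf s_i)\cap\bigcup_{\pi(i)\le\pi(j)\le n}vars(\mathbf t_j)=\emptyset$. A clause $p(\mathbf t_0,\mathbf s_{n+1})\leftarrow Q$ is $\pi$-nicely moded if $Q$ is and $vars(\mathbf t_0)\cap\bigcup_{j=1}^n vars(\mathbf t_j)=\emptyset$. Well typed. With $p_i(\mathbf S_i,\mathbf T_i)$ the type of $p_i$, $Q$ is $\pi$-well typed if for all $i\in\{1,\dots,n\}$, $\models(\bigwedge_{1\le\pi(j)<\pi(i)}\mathbf t_j:\mathbf T_j)\Rightarrow\mathbf s_i:\mathbf S_i$. A clause $p(\mathbf t_0,\mathbf s_{n+1})\leftarrow Q$, with $p(\mathbf T_0,\mathbf S_{n+1})$ the type of $p$, is $\pi$-well typed if for all $i\in\{1,\dots,n+1\}$, $\models(\bigwedge_{0\le\pi(j)<\pi(i)}\mathbf t_j:\mathbf T_j)\Rightarrow\mathbf s_i:\mathbf S_i$. A program is permutation well typed if each clause is $\pi$-well typed for some $\pi$. Bound/free (relative to a permutation well typed program $P$). An input position of $p$ is bound if some clause head $p(\dots)$ in $P$ has a non-variable term there; an output position of $p$ is bound if some body atom $p(\dots)$ in $P$ has a non-variable term there; otherwise the position is free. $\mathbf r^{\sf f},\mathbf r^{\sf b}$ are the projections of $\mathbf r$ onto its free/bound positions. Robustly typed (relative to a permutation well typed program $P$ whose bound positions are of non-variable type). $Q$ is $\pi$-robustly typed if it is $\pi$-nicely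 moded and $\pi$-well typed, $\mathbf t_1^{\sf f},\dots,\mathbf t_n^{\sf f}$ is a vector of variables and $\mathbf t_1^{\sf b},\dots,\mathbf t_n^{\sf b}$ a vector of flat type-consistent terms. A clause $p(\mathbf t_0,\mathbf s_{n+1})\leftarrow Q$ is $\pi$-robustly typed if it is $\pi$-nicely moded and $\pi$-well typed; $\mathbf t_0^{\sf f},\dots,\mathbf t_n^{\sf f}$ is a vector of variables and $\mathbf t_0^{\sf b},\dots,\mathbf t_n^{\sf b}$ a vector of flat type-consistent terms; and if a position of type $\tau$ in $\mathbf s_{n+1}^{\sf b}$ is filled with a variable $x$, then $x$ also fills a position of type $\tau$ in $\mathbf t_0^{\sf b},\dots,\mathbf t_n^{\sf b}$. "Permutation robustly typed" means $\pi$-robustly typed for some $\pi$ (for each clause, for programs); "robustly typed" means this with $\pi$ the identity. If $Q$ is $\pi$-robustly typed, then $\pi(Q)$ is a robustly typed query corresponding to $Q$; if a clause $h\leftarrow B$ is $\pi$-robustly typed, then $h\leftarrow\pi(B)$ is a robustly typed clause corresponding to it; a robustly typed program corresponding to $P$ is obtained from $P$ by replacing every clause with a robustly typed clause corresponding to it. Derivations. A program consists of clauses and, for each predicate $p/n$, a block declaration: a (possibly empty) set of atoms $p(b_1,\dots,b_n)$ with $b_i\in\{?,-\}$. An atom $p(t_1,\dots,t_n)$ is blocked if for some $p(b_1,\dots,b_n)$ in the declaration, $t_i$ is a variable for all $i$ with $b_i=-$; otherwise it is selectable. In a derivation step a query $Q_1,a,Q_2$ is replaced by $(Q_1,B,Q_2)\theta$,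 where $h\leftarrow B$ is a variant, renamed apart, of a program clause and $\theta$ is the most general unifier of the selected atom $a$ and $h$. A derivation of $P\cup\{Q\}$ is a (finite or infinite) sequence of such steps starting at $Q$. An LD-derivation is a derivation in which the selected atom is always the leftmost atom. A delay-respecting derivation is one in which the selected atom is always selectable. In a step, the atoms of $B\theta$ are direct descendants of $a$, and $b\theta$ is a direct descendant of $b$ for $b$ in $Q_1,Q_2$; "descendant" is the reflexive transitive closure. In a delay-respecting derivation, if $Q_i=R_1,R_2$ where $R_1$ contains no selectable atom, then every descendant of every atom in $R_1$ is waiting. A delay-respecting derivation is left-based if in each step $Q_i;Q_{i+1}$ the selected atom is waiting in $Q_i$ or is the leftmost selectable atom in $Q_i$. Input selectability. A permutation robustly typed program $P$ has input selectability if every atom (using a predicate of $P$) that has variables in all free output positions is selectable in $P$ (1) only if it is non-variable in all bound input positions, and (2) if it is non-variable in all input positions of non-variable type. Robust. For a permutation robustly typed, input-linear program $P$ with input selectability, a predicate $p$ is robust if for each robustly typed query $p(\mathbf s,\mathbf t)$ consisting of one atom, every delay-respecting derivation of $P\cup\{p(\mathbf s,\mathbf t)\}$ is finite. Depends on. $p$ refers to $q$ if some clause of $P$ has $p$ in its head and $q$ in its body; $p\sqsupseteq q$ is the reflexive transitive closure of this relation. Well fed. $i$ is a safe position for $\pi$ if for all $j$, $\pi(j)<\pi(i)$ implies $j<i$. A $\pi$-robustly typed query is well fed if for each of its atoms $p(\mathbf s,\mathbf t)$, either this atom is in a safe position for $\pi$, or all predicates $q$ with $p\sqsupseteq q$ are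 robust. A clause is well fed if its body is. A program is well fed if all its clauses are well fed and input-linear, and it has input selectability.
   Formalization: Types are required to be nonempty (with an empty type a predicate can be vacuously robust and the claim fails), and the permutations used to form P' and Q' are the same ones for which P and Q are well fed (with unrelated ones the claim fails). -}

module Defs where

open import Data.Nat using (ℕ; zero; suc; _+_; _<_; _≤_)
open import Data.Fin as Fin using (Fin)
open import Data.Fin.Permutation using (Permutation′; _⟨$⟩ʳ_; _⟨$⟩ˡ_; id)
open import Data.Vec using (Vec; []; _∷_)
import Data.Vec as Vec
import Data.Vec.Relation.Unary.Unique.Propositional as VecUnique
open import Data.List using (List; []; _∷_; _++_; length; lookup; tabulate; map; concatMap; filter; allFin)
open import Data.List.Membership.Propositional using (_∈_)
open import Data.List.Relation.Unary.All using (All)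
open import Data.List.Relation.Unary.Unique.Propositional using (Unique)
open import Data.List.Relation.Binary.Disjoint.Propositional using (Disjoint)
open import Data.Product using (Σ; ∃; ∃-syntax; _×_; _,_)
open import Data.Sum using (_⊎_)
open import Function using (_∘_; Injective; _⇔_)
open import Relation.Nullary using (¬_; Dec; yes; no)
open import Relation.Binary.PropositionalEquality using (_≡_; refl)
open import Relation.Binary.Construct.Closure.ReflexiveTransitive using (Star)

Var : Set
Var = ℕ

record FunctionSymbols : Set₁ where
  field
    Fun      : Set
    funArity : Fun → ℕ

module Terms (F : FunctionSymbols) where
  open FunctionSymbols F

  data Term : Set where
    var : Var → Term
    con : (f : Fun) → Vec Term (funArity f) → Term

  -- Substitutions are not required to have finite support: only their values
  -- on the finitely many variables of the objects they are applied to matter.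
  Subst : Set
  Subst = Var → Term

  mutual
    _[_]ₜ : Term → Subst → Term
    var x    [ σ ]ₜ = σ x
    con f ts [ σ ]ₜ = con f (ts [ σ ]ₜₛ)

    _[_]ₜₛ : ∀ {n} → Vec Term n → Subst → Vec Term n
    []       [ σ ]ₜₛ = []
    (t ∷ ts) [ σ ]ₜₛ = (t [ σ ]ₜ) ∷ (ts [ σ ]ₜₛ)

  -- Variable occurrences, with multiplicity; linearity of an object is
  -- uniqueness of this list.
  mutual
    varsₜ : Term → List Var
    varsₜ (var x)    = x ∷ []
    varsₜ (con f ts) = varsₜₛ ts

    varsₜₛ : ∀ {n} → Vec Term n → List Var
    varsₜₛ []       = []
    varsₜₛ (t ∷ ts) = varsₜ t ++ varsₜₛ ts

  IsVar : Term → Set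
  IsVar t = ∃[ x ] t ≡ var x

  data Flat : Term → Set where
    flat-var : ∀ x → Flat (var x)
    flat-con : ∀ f (xs : Vec Var (funArity f)) → VecUnique.Unique xs →
               Flat (con f (Vec.map var xs))

  -- Types are nonempty.  An empty type could be given to a free output position
  -- of an unsuccessful producer, making every consumer of it vacuously robust.
  record Type : Set₁ where
    field
      Has       : Term → Set
      closed    : ∀ {t} σ → Has t → Has (t [ σ ]ₜ)
      inhabited : ∃[ t ] Has t
  open Type public

  -- Types are sets of terms, so they are identified extensionally.
  _≈ᵀ_ : Type → Type → Set
  T ≈ᵀ U = ∀ t → Has T t ⇔ Has U t

  IsVariableType : Type → Set
  IsVariableType T = ∀ x → Has T (var x)

  TypeConsistent : Type → Term → Set
  TypeConsistent T t = ∃[ σ ] Has T (t [ σ ]ₜ)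

data Mode : Set where
  input output : Mode

_≟ᵐ_ : (m m′ : Mode) → Dec (m ≡ m′)
input  ≟ᵐ input  = yes refl
input  ≟ᵐ output = no λ ()
output ≟ᵐ input  = no λ ()
output ≟ᵐ output = yes refl

-- IsEquality singles out the equality predicate.  It is a property rather than
-- one symbol so that the language may lack equality, or have one copy of it
-- for each mode in which it is used.  It has no built-in clauses: atoms are
-- resolved with program clauses only.
record Language : Set₁ where
  field
    functions : FunctionSymbols
  open Terms functions
  field
    Pred            : Set
    arity           : Pred → ℕ
    mode            : (p : Pred) → Fin (arity p) → Mode
    type            : (p : Pred) → Fin (arity p) → Type
    IsEquality      : Pred → Set
    equality-binary : ∀ {p} → IsEquality p → arity p ≡ 2

module LogicPrograms (L : Language) where
  open Language L
  open Terms functions public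

  record Atom : Set where
    constructor atom
    field
      pred : Pred
      args : Vec Term (arity pred)

    arg : Fin (arity pred) → Term
    arg = Vec.lookup args
  open Atom public

  Query : Set
  Query = List Atom

  infix 4 _⟵_
  record Clause : Set where
    constructor _⟵_
    field
      head : Atom
      body : Query
  open Clause public

  data Mark : Set where
    ⁇ ▬ : Mark

  -- A block declaration is given for every predicate of the language, so the
  -- predicates of the language are exactly the predicates of the program.
  record Program : Set where
    field
      clauses : List Clause
      block   : (p : Pred) → List (Vec Mark (arity p))
  open Program public

  _[_]ₐ : Atom → Subst → Atom
  atom p ts [ σ ]ₐ = atom p (ts [ σ ]ₜₛ)

  _[_]q : Query → Subst → Query
  Q [ σ ]q = map (_[ σ ]ₐ) Q

  _[_]c : Clause → Subst → Clause
  (h ⟵ B) [ σ ]c = (h [ σ ]ₐ) ⟵ (B [ σ ]q)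

  varsₐ : Atom → List Var
  varsₐ a = varsₜₛ (args a)

  varsQ : Query → List Var
  varsQ = concatMap varsₐ

  varsC : Clause → List Var
  varsC (h ⟵ B) = varsₐ h ++ varsQ B

  positions : Mode → (p : Pred) → List (Fin (arity p))
  positions m p = filter (λ i → mode p i ≟ᵐ m) (allFin (arity p))

  inVars outVars : Atom → List Var
  inVars  a = concatMap (varsₜ ∘ arg a) (positions input  (pred a))
  outVars a = concatMap (varsₜ ∘ arg a) (positions output (pred a))

  InputLinearClause : Clause → Set
  InputLinearClause c = Unique (inVars (head c))

  Uses : Program → Pred → Set
  Uses P p = ∃[ c ] c ∈ clauses P × (pred (head c) ≡ p ⊎ (∃[ b ] b ∈ body c × pred b ≡ p))

  InputLinear : Program → Set
  InputLinear P = All InputLinearClause (clauses P)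
                × (∀ p → IsEquality p → Uses P p → ¬ (∀ i → mode p i ≡ input))

  permute : (Q : Query) → Permutation′ (length Q) → Query
  permute Q π = tabulate λ k → lookup Q (π ⟨$⟩ˡ k)

  NicelyModedQuery : (Q : Query) → Permutation′ (length Q) → Set
  NicelyModedQuery Q π =
      Unique (concatMap outVars Q)
    × (∀ i j → (π ⟨$⟩ʳ i) Fin.≤ (π ⟨$⟩ʳ j) →
         Disjoint (inVars (lookup Q i)) (outVars (lookup Q j)))

  NicelyModedClause : (c : Clause) → Permutation′ (length (body c)) → Set
  NicelyModedClause c π =
      NicelyModedQuery (body c) π
    × (∀ j → Disjoint (inVars (head c)) (outVars (lookup (body c) j)))

  Typed : Mode → Atom → Set
  Typed m a = ∀ i → mode (pred a) i ≡ m → Has (type (pred a) i) (arg a i)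

  WellTypedQuery : (Q : Query) → Permutation′ (length Q) → Set
  WellTypedQuery Q π = ∀ i (σ : Subst) →
    (∀ j → (π ⟨$⟩ʳ j) Fin.< (π ⟨$⟩ʳ i) → Typed output (lookup Q j [ σ ]ₐ)) →
    Typed input (lookup Q i [ σ ]ₐ)

  -- The first component is the condition on the inputs of the body atoms; the
  -- second is the one on the outputs of the head, i.e. the case i = n+1.
  WellTypedClause : (c : Clause) → Permutation′ (length (body c)) → Set
  WellTypedClause (h ⟵ B) π =
      (∀ i (σ : Subst) →
         Typed input (h [ σ ]ₐ) →
         (∀ j → (π ⟨$⟩ʳ j) Fin.< (π ⟨$⟩ʳ i) → Typed output (lookup B j [ σ ]ₐ)) →
         Typed input (lookup B i [ σ ]ₐ))
    × (∀ (σ : Subst) →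
         Typed input (h [ σ ]ₐ) →
         (∀ j → Typed output (lookup B j [ σ ]ₐ)) →
         Typed output (h [ σ ]ₐ))

  BodyPermutations : Program → Set
  BodyPermutations P =
    (k : Fin (length (clauses P))) → Permutation′ (length (body (lookup (clauses P) k)))

  WellTypedProgram : (P : Program) → BodyPermutations P → Set
  WellTypedProgram P πs = ∀ k → WellTypedClause (lookup (clauses P) k) (πs k)

  Bound : Program → (p : Pred) → Fin (arity p) → Set
  Bound P p i =
      (mode p i ≡ input ×
         (∃[ c ] c ∈ clauses P × Σ (Vec Term (arity p)) λ ts →
            head c ≡ atom p ts × ¬ IsVar (Vec.lookup ts i)))
    ⊎ (mode p i ≡ output ×
         (∃[ c ] c ∈ clauses P × Σ (Vec Term (arity p)) λ ts →
            atom p ts ∈ body c × ¬ IsVar (Vec.lookup ts i)))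

  -- Free positions of mode m hold variables, bound ones hold flat
  -- type-consistent terms.
  Shaped : Program → Mode → Atom → Set
  Shaped P m a = ∀ i → mode (pred a) i ≡ m →
      (¬ Bound P (pred a) i → IsVar (arg a i))
    × (Bound P (pred a) i → Flat (arg a i) × TypeConsistent (type (pred a) i) (arg a i))

  -- x fills a bound position of type τ and mode m of the atom.
  FillsBound : Program → Mode → Type → Var → Atom → Set
  FillsBound P m τ x a =
    ∃[ i ] mode (pred a) i ≡ m × Bound P (pred a) i × type (pred a) i ≈ᵀ τ × arg a i ≡ var x

  RobustlyTypedQuery : Program → (Q : Query) → Permutation′ (length Q) → Set
  RobustlyTypedQuery P Q π =
      NicelyModedQuery Q π
    × WellTypedQuery Q π
    × (∀ j → Shaped P output (lookup Q j))

  RobustlyTypedClause : Program → (c : Clause) → Permutation′ (length (body c)) → Set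
  RobustlyTypedClause P c π =
      NicelyModedClause c π
    × WellTypedClause c π
    × Shaped P input (head c)
    × (∀ j → Shaped P output (lookup (body c) j))
    × (∀ i x → mode (pred (head c)) i ≡ output → Bound P (pred (head c)) i →
         arg (head c) i ≡ var x →
         FillsBound P input (type (pred (head c)) i) x (head c)
         ⊎ (∃[ j ] FillsBound P output (type (pred (head c)) i) x (lookup (body c) j)))

  RobustlyTypedProgram : (P : Program) → BodyPermutations P → Set
  RobustlyTypedProgram P πs =
      WellTypedProgram P πs
    × (∀ p i → Bound P p i → ¬ IsVariableType (type p i))
    × (∀ k → RobustlyTypedClause P (lookup (clauses P) k) (πs k))

  permuteProgram : (P : Program) → BodyPermutations P → Program
  permuteProgram P πs = record
    { clauses = tabulate λ k →
        head (lookup (clauses P) k) ⟵ permute (body (lookup (clauses P) k)) (πs k)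
    ; block   = block P
    }

  Blocked : Program → Atom → Set
  Blocked P a = ∃[ bs ] bs ∈ block P (pred a) × (∀ i → Vec.lookup bs i ≡ ▬ → IsVar (arg a i))

  Selectable : Program → Atom → Set
  Selectable P a = ¬ Blocked P a

  record IsMGU (θ : Subst) (a b : Atom) : Set where
    field
      unifies      : a [ θ ]ₐ ≡ b [ θ ]ₐ
      most-general : ∀ σ → a [ σ ]ₐ ≡ b [ σ ]ₐ → ∃[ δ ] (∀ x → σ x ≡ θ x [ δ ]ₜ)

  -- The variant is renamed apart from the current query; together with the mgu
  -- this determines Q′ up to renaming from the selected atom and the clause.
  record Step (P : Program) (Q Q′ : Query) : Set where
    field
      left     : Query
      selected : Atom
      right    : Query
      split    : Q ≡ left ++ selected ∷ right
      clause   : Clause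
      clause∈  : clause ∈ clauses P
      rename   : Var → Var
      rename-injective : Injective _≡_ _≡_ rename

    variant : Clause
    variant = clause [ var ∘ rename ]c

    field
      apart  : Disjoint (varsC variant) (varsQ Q)
      mgu    : Subst
      is-mgu : IsMGU mgu selected (head variant)
      result : Q′ ≡ (left ++ body variant ++ right) [ mgu ]q

    position : ℕ
    position = length left
  open Step public

  record InfiniteDerivation (P : Program) (Q : Query) : Set where
    field
      query : ℕ → Query
      start : query 0 ≡ Q
      step  : ∀ n → Step P (query n) (query (suc n))
  open InfiniteDerivation public

  IsLD : ∀ {P Q} → InfiniteDerivation P Q → Set
  IsLD ξ = ∀ n → left (step ξ n) ≡ []

  DelayRespecting : ∀ {P Q} → InfiniteDerivation P Q → Set
  DelayRespecting {P} ξ = ∀ n → Selectable P (selected (step ξ n))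

  -- Atom occurrences are identified by their index in the query:
  -- DirectDescendant s k l says that the atom at index l of Q′ is a direct
  -- descendant of the atom at index k of Q.
  data DirectDescendant {P Q Q′} (s : Step P Q Q′) : ℕ → ℕ → Set where
    in-left  : ∀ {k} → k < position s → DirectDescendant s k k
    in-body  : ∀ {j} → j < length (body (clause s)) →
               DirectDescendant s (position s) (position s + j)
    in-right : ∀ {k} → position s ≤ k → suc k < length Q →
               DirectDescendant s (suc k) (k + length (body (clause s)))

  -- Descendant ξ m k n l: the atom at index l of query n is a descendant of
  -- the atom at index k of query m.
  data Descendant {P Q} (ξ : InfiniteDerivation P Q) (m k : ℕ) : ℕ → ℕ → Set where
    here  : Descendant ξ m k m k
    there : ∀ {n l l′} → Descendant ξ m k n l → DirectDescendant (step ξ n) l l′ →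
            Descendant ξ m k (suc n) l′

  -- The atom at index l of query n is waiting.
  Waiting : ∀ {P Q} → InfiniteDerivation P Q → ℕ → ℕ → Set
  Waiting {P} ξ n l =
    ∃[ m ] ∃[ R₁ ] ∃[ R₂ ] ∃[ k ]
      query ξ m ≡ R₁ ++ R₂
      × All (λ a → ¬ Selectable P a) R₁
      × k < length R₁
      × Descendant ξ m k n l

  IsLeftBased : ∀ {P Q} → InfiniteDerivation P Q → Set
  IsLeftBased {P} ξ = DelayRespecting ξ
    × (∀ n → Waiting ξ n (position (step ξ n))
           ⊎ All (λ a → ¬ Selectable P a) (left (step ξ n)))

  -- A derivation is a finite or infinite sequence of steps, so all derivations
  -- of a kind are finite iff none of that kind is infinite.
  LDDerivationsFinite DelayRespectingDerivationsFinite LeftBasedDerivationsFinite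
    : Program → Query → Set
  LDDerivationsFinite              P Q = ¬ Σ (InfiniteDerivation P Q) IsLD
  DelayRespectingDerivationsFinite P Q = ¬ Σ (InfiniteDerivation P Q) DelayRespecting
  LeftBasedDerivationsFinite       P Q = ¬ Σ (InfiniteDerivation P Q) IsLeftBased

  InputSelectability : Program → Set
  InputSelectability P = ∀ a →
    (∀ i → mode (pred a) i ≡ output → ¬ Bound P (pred a) i → IsVar (arg a i)) →
      (Selectable P a →
         ∀ i → mode (pred a) i ≡ input → Bound P (pred a) i → ¬ IsVar (arg a i))
    × ((∀ i → mode (pred a) i ≡ input → ¬ IsVariableType (type (pred a) i) → ¬ IsVar (arg a i)) →
         Selectable P a)

  Robust : Program → Pred → Set
  Robust P p =
      (∃[ πs ] RobustlyTypedProgram P πs)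
    × InputLinear P
    × InputSelectability P
    × (∀ ts → RobustlyTypedQuery P (atom p ts ∷ []) id →
         DelayRespectingDerivationsFinite P (atom p ts ∷ []))

  RefersTo : Program → Pred → Pred → Set
  RefersTo P p q = ∃[ c ] c ∈ clauses P × pred (head c) ≡ p × (∃[ b ] b ∈ body c × pred b ≡ q)

  DependsOn : Program → Pred → Pred → Set
  DependsOn P = Star (RefersTo P)

  Safe : ∀ {n} → Permutation′ n → Fin n → Set
  Safe π i = ∀ j → (π ⟨$⟩ʳ j) Fin.< (π ⟨$⟩ʳ i) → j Fin.< i

  SafeOrRobust : Program → (Q : Query) → Permutation′ (length Q) → Set
  SafeOrRobust P Q π = ∀ i →
    Safe π i ⊎ (∀ q → DependsOn P (pred (lookup Q i)) q → Robust P q)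

  WellFedQuery : Program → (Q : Query) → Permutation′ (length Q) → Set
  WellFedQuery P Q π = RobustlyTypedQuery P Q π × SafeOrRobust P Q π

  -- The body of a clause is robustly typed only in the context of its head.
  WellFedClause : Program → (c : Clause) → Permutation′ (length (body c)) → Set
  WellFedClause P c π = RobustlyTypedClause P c π × SafeOrRobust P (body c) π

  WellFedProgram : (P : Program) → BodyPermutations P → Set
  WellFedProgram P πs =
      RobustlyTypedProgram P πs
    × (∀ k → WellFedClause P (lookup (clauses P) k) (πs k))
    × All InputLinearClause (clauses P)
    × InputSelectability P

{-# OPTIONS --safe #-}
module Submission where

-- A query is identified with the set of its instances.  Resolution then is the operator
-- Post on sets, for which steps at different positions commute, and "nicely moded with
-- flat outputs" becomes Ext: once the atoms before an atom and its inputs are fixed, its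
-- outputs can be chosen freely.  Hence a step instantiates no atom that comes earlier in
-- the order of the permutation.
--
-- In a left-based derivation every selected atom is the first one in that order, or
-- depends on robust predicates only.  For consider an atom of neither kind: all atoms
-- ordered before it stand to its left, and the very first of them has correctly typed
-- inputs and so is selectable; hence the atom is neither waiting nor the leftmost
-- selectable one.
--
-- The first selection of the first atom can be pulled to the beginning of the derivation.
-- Repeating this yields an LD-derivation, so eventually only robust atoms other than the
-- first one are selected.  This is impossible too: steps on the descendants of the first
-- atom can be pulled forward only finitely often, by robustness; once they are exhausted,
-- what is left of them is discarded by instantiating its outputs with terms of the right
-- types, and an infinite derivation of a shorter query remains.

open import Level using (0ℓ)
open import Axiom.ExcludedMiddle using (ExcludedMiddle)
open import Data.Empty using (⊥; ⊥-elim)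
open import Data.Fin as Fin using (Fin; toℕ)
open import Data.Fin.Permutation using (Permutation′; _⟨$⟩ʳ_; _⟨$⟩ˡ_; inverseˡ; inverseʳ; id)
import Data.Fin.Properties as FinP
open import Data.List using (List; []; _∷_; _++_; map; length; concatMap; allFin; drop; lookup; tabulate)
open import Data.List.Membership.Propositional using (_∈_; _∉_; find; lose)
open import Data.List.Membership.Propositional.Properties
  using (∈-map⁺; ∈-map⁻; ∈-++⁺ˡ; ∈-++⁺ʳ; ∈-++⁻; ∈-concatMap⁺; ∈-concatMap⁻; ∈-filter⁺; ∈-filter⁻;
         ∈-allFin; ∈-tabulate⁺; ∈-tabulate⁻; ∈-lookup; ∈-∃++; ∈-insert)
open import Data.List.Membership.Propositional.Properties.WithK using (unique∧set⇒bag)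
open import Data.List.Properties
  using (map-++; map-tabulate; tabulate-lookup; ∷-injective; length-map; length-++; ++-assoc; ++-identityʳ)
open import Data.List.Relation.Binary.BagAndSetEquality using (∼bag⇒↭)
open import Data.List.Relation.Binary.Disjoint.Propositional using (Disjoint)
open import Data.List.Relation.Binary.Permutation.Propositional using (_↭_; ↭-sym; ↭-refl; ↭-trans)
import Data.List.Relation.Binary.Permutation.Propositional.Properties as Perm
open import Data.List.Relation.Binary.Pointwise as PW using (Pointwise; []; _∷_)
open import Data.List.Relation.Unary.All as All using (All; []; _∷_)
import Data.List.Relation.Unary.All.Properties as AllP
open import Data.List.Relation.Unary.AllPairs using (AllPairs; []; _∷_)
import Data.List.Relation.Unary.AllPairs.Properties as AllPairsP
open import Data.List.Relation.Unary.Any as Any using (here; there)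
open import Data.List.Relation.Unary.Any.Properties using (lookup-index)
open import Data.List.Relation.Unary.Unique.Propositional using (Unique)
import Data.List.Relation.Unary.Unique.Propositional.Properties as Uniq
open import Data.Maybe using (Maybe; just; nothing)
open import Data.Nat hiding (pred)
open import Data.Nat.Properties
open import Data.List.Membership.DecPropositional _≟_ using (_∈?_)
open import Data.Product using (Σ; ∃-syntax; _×_; _,_; proj₁; proj₂)
open import Data.Sum using (_⊎_; inj₁; inj₂)
open import Data.Unit using (⊤; tt)
open import Data.Vec as Vec using (Vec; []; _∷_)
open import Data.Vec.Properties using (lookup∘tabulate) renaming (∷-injective to ∷ᵛ-injective)
open import Data.Vec.Relation.Unary.All as VecAll using () renaming ([] to []ᵛ; _∷_ to _∷ᵛ_)
open import Data.Vec.Relation.Unary.AllPairs using () renaming ([] to []ᵖ; _∷_ to _∷ᵖ_)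
import Data.Vec.Relation.Unary.Unique.Propositional as VecUnique
open import Function using (_∘_; Equivalence; mk⇔)
open import Induction.WellFounded using (Acc; acc)
open import Relation.Binary.Construct.Closure.ReflexiveTransitive using (ε; _◅_)
open import Relation.Binary.Definitions using (tri<; tri≈; tri>)
open import Relation.Binary.PropositionalEquality
open import Relation.Nullary using (¬_; Dec; yes; no)
open import Relation.Unary using (_⊆_; _≐_)
open import Relation.Unary.Properties using (≐-sym; ≐-trans)
open import Defs

-- A derivation fixes its queries only up to renamings and the choice of mgus, so exchanging two
-- steps would yield mere variants. Sets of instances are compared by `≐` instead, and exchange
-- becomes literal; syntactic steps are read by `step-semantics` and rebuilt by `real-step` at the
-- two ends only.
--
-- The free choice of outputs has a limit: a flat output `f(x1,...,xn)` keeps its top symbol. Slots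
-- record such symbols as demands. Resolution hands a demand on a variable in a head output down to
-- the body; the condition on variables in bound head outputs ensures that a body output receiving
-- it is bound and of the same type. Hence each demand can be met by a term of the right type
-- (`SlotOK`), which is what allows discarded atoms to get typed outputs.
--
-- Robustness concerns robustly typed one-atom queries. Only the first atom in the order has
-- correctly typed inputs without assumptions on the outputs of others. So robust atoms are used up
-- from the front, and discarded ones need typed outputs to pass well-typedness on to the next.

module Substitution (F : FunctionSymbols) where
  open FunctionSymbols F
  open Terms F

  -- Composition of substitutions and variable occurrences.

  infixl 7 _⊙_
  _⊙_ : Subst → Subst → Subst
  (σ ⊙ δ) x = σ x [ δ ]ₜ

  mutual
    ⊙-term : ∀ σ δ t → t [ σ ]ₜ [ δ ]ₜ ≡ t [ σ ⊙ δ ]ₜ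
    ⊙-term σ δ (var x)    = refl
    ⊙-term σ δ (con f ts) = cong (con f) (⊙-terms σ δ ts)

    ⊙-terms : ∀ {n} σ δ (ts : Vec Term n) → ts [ σ ]ₜₛ [ δ ]ₜₛ ≡ ts [ σ ⊙ δ ]ₜₛ
    ⊙-terms σ δ []       = refl
    ⊙-terms σ δ (t ∷ ts) = cong₂ _∷_ (⊙-term σ δ t) (⊙-terms σ δ ts)

  mutual
    agree-term : ∀ {σ τ} t → (∀ {x} → x ∈ varsₜ t → σ x ≡ τ x) → t [ σ ]ₜ ≡ t [ τ ]ₜ
    agree-term (var x)    eq = eq (here refl)
    agree-term (con f ts) eq = cong (con f) (agree-terms ts eq)

    agree-terms : ∀ {n σ τ} (ts : Vec Term n) →
                  (∀ {x} → x ∈ varsₜₛ ts → σ x ≡ τ x) → ts [ σ ]ₜₛ ≡ ts [ τ ]ₜₛ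
    agree-terms []       eq = refl
    agree-terms (t ∷ ts) eq = cong₂ _∷_ (agree-term t (eq ∘ ∈-++⁺ˡ))
                                        (agree-terms ts (eq ∘ ∈-++⁺ʳ (varsₜ t)))

  mutual
    var-term : ∀ t → t [ var ]ₜ ≡ t
    var-term (var x)    = refl
    var-term (con f ts) = cong (con f) (var-terms ts)

    var-terms : ∀ {n} (ts : Vec Term n) → ts [ var ]ₜₛ ≡ ts
    var-terms []       = refl
    var-terms (t ∷ ts) = cong₂ _∷_ (var-term t) (var-terms ts)

  mutual
    ∈-vars-subst : ∀ {σ x y} t → y ∈ varsₜ t → x ∈ varsₜ (σ y) → x ∈ varsₜ (t [ σ ]ₜ)
    ∈-vars-subst (var _)    (here refl) x∈ = x∈
    ∈-vars-subst (con f ts) y∈          x∈ = ∈-varss-subst ts y∈ x∈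

    ∈-varss-subst : ∀ {n σ x y} (ts : Vec Term n) →
                    y ∈ varsₜₛ ts → x ∈ varsₜ (σ y) → x ∈ varsₜₛ (ts [ σ ]ₜₛ)
    ∈-varss-subst (t ∷ ts) y∈ x∈ with ∈-++⁻ (varsₜ t) y∈
    ... | inj₁ y∈t  = ∈-++⁺ˡ (∈-vars-subst t y∈t x∈)
    ... | inj₂ y∈ts = ∈-++⁺ʳ _ (∈-varss-subst ts y∈ts x∈)

  mutual
    ∈-vars-subst⁻ : ∀ {σ x} t → x ∈ varsₜ (t [ σ ]ₜ) → ∃[ y ] y ∈ varsₜ t × x ∈ varsₜ (σ y)
    ∈-vars-subst⁻ (var y)    x∈ = y , here refl , x∈
    ∈-vars-subst⁻ (con f ts) x∈ = ∈-varss-subst⁻ ts x∈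

    ∈-varss-subst⁻ : ∀ {n σ x} (ts : Vec Term n) → x ∈ varsₜₛ (ts [ σ ]ₜₛ) →
                     ∃[ y ] y ∈ varsₜₛ ts × x ∈ varsₜ (σ y)
    ∈-varss-subst⁻ {σ = σ} (t ∷ ts) x∈ with ∈-++⁻ (varsₜ (t [ σ ]ₜ)) x∈
    ... | inj₁ x∈t  = let y , y∈ , x∈′ = ∈-vars-subst⁻ t x∈t in y , ∈-++⁺ˡ y∈ , x∈′
    ... | inj₂ x∈ts = let y , y∈ , x∈′ = ∈-varss-subst⁻ ts x∈ts in y , ∈-++⁺ʳ (varsₜ t) y∈ , x∈′

  con-injective : ∀ {f g ts us} (eq : con f ts ≡ con g us) →
                  Σ (f ≡ g) λ where refl → ts ≡ us
  con-injective refl = refl , refl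

  -- Unification

  Equations : Set
  Equations = List (Term × Term)

  Solves : Subst → Equations → Set
  Solves σ = All (λ e → proj₁ e [ σ ]ₜ ≡ proj₂ e [ σ ]ₜ)

  -- Stronger than generality: each unifier factors through `θ` with itself as the second factor, as
  -- for idempotent mgus. Variable elimination relies on this form.
  HasMGU : Equations → Set
  HasMGU E = ∃[ θ ] Solves θ E × (∀ σ → Solves σ E → ∀ x → σ x ≡ θ x [ σ ]ₜ)

  mutual
    size : Term → ℕ
    size (var x)    = 1
    size (con f ts) = suc (sizes ts)

    sizes : ∀ {n} → Vec Term n → ℕ
    sizes []       = 0
    sizes (t ∷ ts) = size t + sizes ts

  size>0 : ∀ t → 0 < size t
  size>0 (var x)    = s≤s z≤n
  size>0 (con f ts) = s≤s z≤n

  mutual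
    size-occurs : ∀ {ω x} t → x ∈ varsₜ t → size (ω x) ≤ size (t [ ω ]ₜ)
    size-occurs (var x)    (here refl) = ≤-refl
    size-occurs (con f ts) x∈          = m≤n⇒m≤1+n (sizes-occurs ts x∈)

    sizes-occurs : ∀ {n ω x} (ts : Vec Term n) → x ∈ varsₜₛ ts → size (ω x) ≤ sizes (ts [ ω ]ₜₛ)
    sizes-occurs {ω = ω} (t ∷ ts) x∈ with ∈-++⁻ (varsₜ t) x∈
    ... | inj₁ x∈t  = ≤-trans (size-occurs t x∈t) (m≤m+n _ _)
    ... | inj₂ x∈ts = ≤-trans (sizes-occurs ts x∈ts) (m≤n+m _ (size (t [ ω ]ₜ)))

  occurs-check : ∀ {ω x f ts} → ω x ≡ con f ts [ ω ]ₜ → x ∉ varsₜₛ ts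
  occurs-check {ts = ts} eq x∈ =
    <-irrefl refl (≤-<-trans (sizes-occurs ts x∈) (≤-reflexive (cong size (sym eq))))

  -- Left-hand sides suffice, since the unifier `ω` makes both sides equal.
  measure : Subst → Equations → ℕ
  measure ω []            = 0
  measure ω ((s , t) ∷ E) = size (s [ ω ]ₜ) + measure ω E

  decompose : ∀ {n} → Vec Term n → Vec Term n → Equations → Equations
  decompose []       []       E = E
  decompose (s ∷ ss) (t ∷ ts) E = (s , t) ∷ decompose ss ts E

  decompose⁺ : ∀ {n σ E} (ss ts : Vec Term n) → ss [ σ ]ₜₛ ≡ ts [ σ ]ₜₛ → Solves σ E →
               Solves σ (decompose ss ts E)
  decompose⁺ []       []       eq sol = sol
  decompose⁺ (s ∷ ss) (t ∷ ts) eq sol =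
    proj₁ (∷ᵛ-injective eq) ∷ decompose⁺ ss ts (proj₂ (∷ᵛ-injective eq)) sol

  decompose⁻ : ∀ {n σ E} (ss ts : Vec Term n) → Solves σ (decompose ss ts E) →
               ss [ σ ]ₜₛ ≡ ts [ σ ]ₜₛ × Solves σ E
  decompose⁻ []       []       sol        = refl , sol
  decompose⁻ (s ∷ ss) (t ∷ ts) (eq ∷ sol) =
    let eqs , sol′ = decompose⁻ ss ts sol in cong₂ _∷_ eq eqs , sol′

  measure-decompose : ∀ {n} ω E (ss ts : Vec Term n) →
                      measure ω (decompose ss ts E) ≡ sizes (ss [ ω ]ₜₛ) + measure ω E
  measure-decompose ω E []       []       = refl
  measure-decompose ω E (s ∷ ss) (t ∷ ts) =
    trans (cong (size (s [ ω ]ₜ) +_) (measure-decompose ω E ss ts))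
          (sym (+-assoc (size (s [ ω ]ₜ)) _ _))

  _↦_ : Var → Term → Subst
  (x ↦ t) y with x ≟ y
  ... | yes _ = t
  ... | no  _ = var y

  ↦-same : ∀ x t → (x ↦ t) x ≡ t
  ↦-same x t with x ≟ x
  ... | yes _   = refl
  ... | no  x≢x = ⊥-elim (x≢x refl)

  ↦-fresh : ∀ {x t} s → x ∉ varsₜ s → s [ x ↦ t ]ₜ ≡ s
  ↦-fresh {x} {t} s x∉ = trans (agree-term s other) (var-term s)
    where
    other : ∀ {y} → y ∈ varsₜ s → (x ↦ t) y ≡ var y
    other {y} y∈ with x ≟ y
    ... | yes refl = ⊥-elim (x∉ y∈)
    ... | no  _    = refl

  ↦-absorb : ∀ {x t ω} → ω x ≡ t [ ω ]ₜ → ∀ s → s [ x ↦ t ]ₜ [ ω ]ₜ ≡ s [ ω ]ₜ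
  ↦-absorb {x} {t} {ω} eq s = trans (⊙-term (x ↦ t) ω s) (agree-term s λ {y} _ → at y)
    where
    at : ∀ y → (x ↦ t) y [ ω ]ₜ ≡ ω y
    at y with x ≟ y
    ... | yes refl = sym eq
    ... | no  _    = refl

  _[_]ₑ : Equations → Subst → Equations
  E [ σ ]ₑ = map (λ e → proj₁ e [ σ ]ₜ , proj₂ e [ σ ]ₜ) E

  measure-↦ : ∀ {x t ω} → ω x ≡ t [ ω ]ₜ → ∀ E → measure ω (E [ x ↦ t ]ₑ) ≡ measure ω E
  measure-↦ eq []            = refl
  measure-↦ eq ((s , t) ∷ E) = cong₂ _+_ (cong size (↦-absorb eq s)) (measure-↦ eq E)

  Solves-↦ : ∀ {x t ω} → ω x ≡ t [ ω ]ₜ → ∀ {E} → Solves ω E → Solves ω (E [ x ↦ t ]ₑ)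
  Solves-↦ eq []                        = []
  Solves-↦ eq {(s , t) ∷ E} (eq′ ∷ sol) =
    trans (↦-absorb eq s) (trans eq′ (sym (↦-absorb eq t))) ∷ Solves-↦ eq sol

  Solves-⊙ : ∀ {σ δ} E → Solves δ (E [ σ ]ₑ) → Solves (σ ⊙ δ) E
  Solves-⊙ []            []         = []
  Solves-⊙ ((s , t) ∷ E) (eq ∷ sol) =
    trans (sym (⊙-term _ _ s)) (trans eq (⊙-term _ _ t)) ∷ Solves-⊙ E sol

  eliminate : ∀ {x t E} → x ∉ varsₜ t → HasMGU (E [ x ↦ t ]ₑ) → HasMGU ((var x , t) ∷ E)
  eliminate {x} {t} {E} x∉ (θ , sol , mg) =
    (x ↦ t) ⊙ θ
    , trans (cong (_[ θ ]ₜ) (trans (↦-same x t) (sym (↦-fresh t x∉)))) (⊙-term (x ↦ t) θ t)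
      ∷ Solves-⊙ E sol
    , λ where
        σ (eq ∷ sol′) y →
          sym (trans (⊙-term θ σ ((x ↦ t) y))
                (trans (agree-term ((x ↦ t) y) λ {z} _ → sym (mg σ (Solves-↦ eq sol′) z))
                       (↦-absorb {x} {t} {σ} eq (var y))))

  -- A known unifier ω bounds the recursion: eliminating a variable does not change the
  -- instances under ω of the remaining equations.
  solve : ∀ n ω E → Solves ω E → measure ω E < n → HasMGU E
  solve _       ω []            []         _         = var , [] , λ _ _ _ → refl
  solve (suc n) ω ((s , t) ∷ E) (eq ∷ sol) (s≤s lt)  = go s t eq lt
    where
    smaller : ∀ s E′ → measure ω E′ ≡ measure ω E →
              size (s [ ω ]ₜ) + measure ω E ≤ n → measure ω E′ < n
    smaller s E′ eq lt =
      ≤-trans (≤-trans (≤-reflexive (cong suc eq)) (+-monoˡ-≤ (measure ω E) (size>0 (s [ ω ]ₜ)))) lt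

    elim : ∀ s x t → x ∉ varsₜ t → ω x ≡ t [ ω ]ₜ →
           size (s [ ω ]ₜ) + measure ω E ≤ n → HasMGU ((var x , t) ∷ E)
    elim s x t x∉ eq lt =
      eliminate x∉ (solve n ω _ (Solves-↦ eq sol) (smaller s (E [ x ↦ t ]ₑ) (measure-↦ eq E) lt))

    flip : ∀ {s t} → HasMGU ((s , t) ∷ E) → HasMGU ((t , s) ∷ E)
    flip (θ , e ∷ so , mg) = θ , sym e ∷ so , λ where σ (e′ ∷ so′) → mg σ (sym e′ ∷ so′)

    go : ∀ s t → s [ ω ]ₜ ≡ t [ ω ]ₜ → size (s [ ω ]ₜ) + measure ω E ≤ n → HasMGU ((s , t) ∷ E)
    go (var x) (var y) eq lt with x ≟ y
    ... | no x≢y = elim (var x) x (var y) (λ where (here x≡y) → x≢y x≡y) eq lt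
    ... | yes refl with solve n ω E sol (smaller (var x) E refl lt)
    ...   | θ , so , mg = θ , refl ∷ so , λ where σ (_ ∷ so′) → mg σ so′
    go (var x) (con f ts) eq lt = elim (var x) x (con f ts) (occurs-check {ω} {x} {f} {ts} eq) eq lt
    go (con f ts) (var x) eq lt =
      flip (elim (con f ts) x (con f ts) (occurs-check {ω} {x} {f} {ts} (sym eq)) (sym eq) lt)
    go (con f ts) (con g us) eq lt with con-injective eq
    ... | refl , eqs with solve n ω (decompose ts us E) (decompose⁺ ts us eqs sol)
                          (≤-trans (≤-reflexive (cong suc (measure-decompose ω E ts us))) lt)
    ...   | θ , so , mg =
            let e , so′ = decompose⁻ ts us so in
            θ , cong (con f) e ∷ so′ ,
            λ where σ (e′ ∷ so″) → mg σ (decompose⁺ ts us (proj₂-con e′) so″)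
      where
      proj₂-con : ∀ {f} {ts us : Vec Term (funArity f)} → con f ts ≡ con f us → ts ≡ us
      proj₂-con refl = refl

  unify : ∀ {ω E} → Solves ω E → HasMGU E
  unify {ω} {E} sol = solve (suc (measure ω E)) ω E sol ≤-refl

-- Auxiliary facts on lists and numbers.

++-split-length : ∀ {A : Set} (xs ys : List A) {us vs} →
                  length xs ≡ length ys → xs ++ us ≡ ys ++ vs → xs ≡ ys × us ≡ vs
++-split-length []       []       len eq = refl , eq
++-split-length (x ∷ xs) (y ∷ ys) len eq =
  let e , es = ∷-injective eq
      e₁ , e₂ = ++-split-length xs ys (suc-injective len) es
  in cong₂ _∷_ e e₁ , e₂

strict-bound : (xs : List ℕ) → ∃[ n ] (∀ {x} → x ∈ xs → x < n)
strict-bound []       = 0 , λ ()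
strict-bound (x ∷ xs) =
  let n , below = strict-bound xs
  in suc x ⊔ n , λ where
       (here refl) → m≤m⊔n (suc x) n
       (there x∈)  → ≤-trans (below x∈) (m≤n⊔m (suc x) n)

double : ℕ → ℕ
double zero    = zero
double (suc n) = suc (suc (double n))

-- Unification of queries and their sets of instances.

module Instances (L : Language) where
  open Language L
  open LogicPrograms L
  open Substitution functions

  arg-subst : ∀ {n} (ts : Vec Term n) i {σ} →
              Vec.lookup (ts [ σ ]ₜₛ) i ≡ Vec.lookup ts i [ σ ]ₜ
  arg-subst (t ∷ ts) Fin.zero    = refl
  arg-subst (t ∷ ts) (Fin.suc i) = arg-subst ts i

  ⊙-atom : ∀ σ δ a → a [ σ ]ₐ [ δ ]ₐ ≡ a [ σ ⊙ δ ]ₐ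
  ⊙-atom σ δ a = cong (atom (pred a)) (⊙-terms σ δ (args a))

  ⊙-query : ∀ σ δ Q → Q [ σ ]q [ δ ]q ≡ Q [ σ ⊙ δ ]q
  ⊙-query σ δ []      = refl
  ⊙-query σ δ (a ∷ Q) = cong₂ _∷_ (⊙-atom σ δ a) (⊙-query σ δ Q)

  var-query : ∀ Q → Q [ var ]q ≡ Q
  var-query []      = refl
  var-query (a ∷ Q) = cong₂ _∷_ (cong (atom (pred a)) (var-terms (args a))) (var-query Q)

  agree-atom : ∀ {σ τ} a → (∀ {x} → x ∈ varsₐ a → σ x ≡ τ x) → a [ σ ]ₐ ≡ a [ τ ]ₐ
  agree-atom a eq = cong (atom (pred a)) (agree-terms (args a) eq)

  agree-query : ∀ {σ τ} Q → (∀ {x} → x ∈ varsQ Q → σ x ≡ τ x) → Q [ σ ]q ≡ Q [ τ ]q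
  agree-query []      eq = refl
  agree-query (a ∷ Q) eq = cong₂ _∷_ (agree-atom a (eq ∘ ∈-++⁺ˡ)) (agree-query Q (eq ∘ ∈-++⁺ʳ (varsₐ a)))

  ∈-varsQ-subst : ∀ {σ x y} Q → y ∈ varsQ Q → x ∈ varsₜ (σ y) → x ∈ varsQ (Q [ σ ]q)
  ∈-varsQ-subst (a ∷ Q) y∈ x∈ with ∈-++⁻ (varsₐ a) y∈
  ... | inj₁ y∈a = ∈-++⁺ˡ (∈-varss-subst (args a) y∈a x∈)
  ... | inj₂ y∈Q = ∈-++⁺ʳ _ (∈-varsQ-subst Q y∈Q x∈)

  ∈-varsC-subst : ∀ {σ x y} c → y ∈ varsC c → x ∈ varsₜ (σ y) → x ∈ varsC (c [ σ ]c)
  ∈-varsC-subst c y∈ x∈ with ∈-++⁻ (varsₐ (head c)) y∈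
  ... | inj₁ y∈h = ∈-++⁺ˡ (∈-varss-subst (args (head c)) y∈h x∈)
  ... | inj₂ y∈B = ∈-++⁺ʳ _ (∈-varsQ-subst (body c) y∈B x∈)

  ∈-varsQ-subst⁻ : ∀ {σ x} Q → x ∈ varsQ (Q [ σ ]q) → ∃[ y ] x ∈ varsₜ (σ y)
  ∈-varsQ-subst⁻ {σ} (a ∷ Q) x∈ with ∈-++⁻ (varsₐ (a [ σ ]ₐ)) x∈
  ... | inj₁ x∈a = let y , _ , x∈′ = ∈-varss-subst⁻ (args a) x∈a in y , x∈′
  ... | inj₂ x∈Q = ∈-varsQ-subst⁻ Q x∈Q

  ∈-varsC-subst⁻ : ∀ {σ x} c → x ∈ varsC (c [ σ ]c) → ∃[ y ] x ∈ varsₜ (σ y)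
  ∈-varsC-subst⁻ {σ} c x∈ with ∈-++⁻ (varsₐ (head c [ σ ]ₐ)) x∈
  ... | inj₁ x∈h = let y , _ , x∈′ = ∈-varss-subst⁻ (args (head c)) x∈h in y , x∈′
  ... | inj₂ x∈B = ∈-varsQ-subst⁻ (body c) x∈B

  -- The given pair of equal instances forces equal lengths and predicates, after which only
  -- arguments remain to be compared.
  queryEquations : ∀ U U′ {ω₁ ω₂} → U [ ω₁ ]q ≡ U′ [ ω₂ ]q →
    ∃[ E ] (∀ σ → (Solves σ E → U [ σ ]q ≡ U′ [ σ ]q) × (U [ σ ]q ≡ U′ [ σ ]q → Solves σ E))
  queryEquations []              []              eq = [] , λ σ → (λ _ → refl) , (λ _ → [])
  queryEquations (atom p ts ∷ U) (atom q us ∷ U′) eq with cong pred (proj₁ (∷-injective eq))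
  ... | refl =
    let E , equiv = queryEquations U U′ (proj₂ (∷-injective eq)) in
    decompose ts us E , λ σ →
      (λ sol → let e , es = decompose⁻ ts us sol in cong₂ _∷_ (cong (atom p) e) (proj₁ (equiv σ) es))
      , (λ e → decompose⁺ ts us (args-injective (proj₁ (∷-injective e)))
                 (proj₂ (equiv σ) (proj₂ (∷-injective e))))
    where
    args-injective : ∀ {p} {ts us : Vec Term (arity p)} → atom p ts ≡ atom p us → ts ≡ us
    args-injective refl = refl

  unifyQ : ∀ U U′ {ω} → U [ ω ]q ≡ U′ [ ω ]q →
    ∃[ θ ] U [ θ ]q ≡ U′ [ θ ]q × (∀ σ → U [ σ ]q ≡ U′ [ σ ]q → ∀ x → σ x ≡ θ x [ σ ]ₜ)
  unifyQ U U′ {ω} eq =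
    let E , equiv = queryEquations U U′ eq
        θ , sol , mg = unify (proj₂ (equiv ω) eq)
    in θ , proj₁ (equiv θ) sol , λ σ e → mg σ (proj₂ (equiv σ) e)

  merge : Subst → Subst → Subst
  merge σ τ zero          = σ 0
  merge σ τ (suc zero)    = τ 0
  merge σ τ (suc (suc n)) = merge (σ ∘ suc) (τ ∘ suc) n

  merge-even : ∀ σ τ x → merge σ τ (double x) ≡ σ x
  merge-even σ τ zero    = refl
  merge-even σ τ (suc x) = merge-even (σ ∘ suc) (τ ∘ suc) x

  merge-odd : ∀ σ τ x → merge σ τ (suc (double x)) ≡ τ x
  merge-odd σ τ zero    = refl
  merge-odd σ τ (suc x) = merge-odd (σ ∘ suc) (τ ∘ suc) x

  -- The two sides may share variables, which are nevertheless instantiated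
  -- independently; so no renaming apart is needed when this is used.
  separate : ∀ U U′ {σ τ} → U [ σ ]q ≡ U′ [ τ ]q →
    ∃[ σ₀ ] ∃[ τ₀ ] U [ σ₀ ]q ≡ U′ [ τ₀ ]q ×
      (∀ σ τ → U [ σ ]q ≡ U′ [ τ ]q →
         ∃[ δ ] (∀ x → σ x ≡ σ₀ x [ δ ]ₜ) × (∀ x → τ x ≡ τ₀ x [ δ ]ₜ))
  separate U U′ eq =
    -- Even and odd variables rename the two sides apart; `merge` interleaves a pair of
    -- substitutions accordingly.
    let θ , e , mg = unifyQ (U [ even ]q) (U′ [ odd ]q) (joined eq)
    in even ⊙ θ , odd ⊙ θ
       , trans (sym (⊙-query even θ U)) (trans e (⊙-query odd θ U′))
       , λ σ τ e′ → merge σ τ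
           , (λ x → trans (sym (merge-even σ τ x)) (mg (merge σ τ) (joined e′) (double x)))
           , (λ x → trans (sym (merge-odd σ τ x)) (mg (merge σ τ) (joined e′) (suc (double x))))
    where
    even odd : Subst
    even = var ∘ double
    odd  = var ∘ suc ∘ double

    joined : ∀ {σ τ} → U [ σ ]q ≡ U′ [ τ ]q →
             U [ even ]q [ merge σ τ ]q ≡ U′ [ odd ]q [ merge σ τ ]q
    joined {σ} {τ} e =
      trans (⊙-query even _ U)
        (trans (agree-query U (λ {x} _ → merge-even σ τ x))
          (trans e
            (trans (agree-query U′ (λ {x} _ → sym (merge-odd σ τ x)))
              (sym (⊙-query odd _ U′)))))

  -- Steps on sets of queries

  QSet : Set₁
  QSet = Query → Set

  ⟦_⟧ : Query → QSet
  ⟦ Q ⟧ X = ∃[ σ ] X ≡ Q [ σ ]q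

  ⟦⟧-self : ∀ Q → ⟦ Q ⟧ Q
  ⟦⟧-self Q = var , sym (var-query Q)

  -- No unification takes place: an instance of the clause rewrites an instance of the query
  -- literally. The mgu reappears in the claim that all results together are the instances of one
  -- query.
  data Rewrite (c : Clause) : ℕ → Query → Query → Set where
    here  : ∀ τ R → Rewrite c 0 (head c [ τ ]ₐ ∷ R) (body c [ τ ]q ++ R)
    there : ∀ {k X Y} x → Rewrite c k X Y → Rewrite c (suc k) (x ∷ X) (x ∷ Y)

  Post : Clause → ℕ → QSet → QSet
  Post c k S Y = ∃[ X ] S X × Rewrite c k X Y

  Post-mono : ∀ {c k S T} → S ⊆ T → Post c k S ⊆ Post c k T
  Post-mono S⊆T (X , X∈ , rw) = X , S⊆T X∈ , rw

  rewrite-at : ∀ c L′ τ R → Rewrite c (length L′) (L′ ++ head c [ τ ]ₐ ∷ R) (L′ ++ body c [ τ ]q ++ R)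
  rewrite-at c []       τ R = here τ R
  rewrite-at c (x ∷ L′) τ R = there x (rewrite-at c L′ τ R)

  rewrite-inv : ∀ {c k X Y} → Rewrite c k X Y →
    ∃[ L′ ] ∃[ τ ] ∃[ R ] length L′ ≡ k × X ≡ L′ ++ head c [ τ ]ₐ ∷ R × Y ≡ L′ ++ body c [ τ ]q ++ R
  rewrite-inv (here τ R)   = [] , τ , R , refl , refl , refl
  rewrite-inv (there x rw) with rewrite-inv rw
  ... | L′ , τ , R , refl , refl , refl = x ∷ L′ , τ , R , refl , refl , refl

  subst-split : ∀ Q {σ} L′ {x R′} → Q [ σ ]q ≡ L′ ++ x ∷ R′ →
    ∃[ M ] ∃[ a ] ∃[ R ] Q ≡ M ++ a ∷ R × M [ σ ]q ≡ L′ × a [ σ ]ₐ ≡ x × R [ σ ]q ≡ R′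
  subst-split (a ∷ Q) []       refl = [] , a , Q , refl , refl , refl , refl
  subst-split (a ∷ Q) (y ∷ L′) eq with ∷-injective eq
  ... | refl , eq′ with subst-split Q L′ eq′
  ...   | M , b , R , refl , refl , refl , refl = a ∷ M , b , R , refl , refl , refl , refl

  subst-split₃ : ∀ σ M a R → (M ++ a ∷ R) [ σ ]q ≡ M [ σ ]q ++ a [ σ ]ₐ ∷ R [ σ ]q
  subst-split₃ σ M a R = map-++ (_[ σ ]ₐ) M (a ∷ R)

  subst-++₃ : ∀ σ U V W → (U ++ V ++ W) [ σ ]q ≡ U [ σ ]q ++ V [ σ ]q ++ W [ σ ]q
  subst-++₃ σ U V W = trans (map-++ (_[ σ ]ₐ) U (V ++ W)) (cong (U [ σ ]q ++_) (map-++ (_[ σ ]ₐ) V W))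

  infix 4 _-[_,_]→_
  -- Insensitive to renamings and to the choice of mgu, as both queries enter only through their
  -- instances.
  _-[_,_]→_ : Query → Clause → ℕ → Query → Set
  Q -[ c , k ]→ Q₁ = ⟦ Q₁ ⟧ ≐ Post c k ⟦ Q ⟧

  -- Only instances of the query and of the clause body have to factor through `σ₀` and `τ₀`. This
  -- covers both the unifiers computed here and an mgu given by a derivation, which is controlled
  -- only on the variables that occur.
  step-of-unifier : ∀ M a R c {σ₀ τ₀} → a [ σ₀ ]ₐ ≡ head c [ τ₀ ]ₐ →
    (∀ σ τ → a [ σ ]ₐ ≡ head c [ τ ]ₐ →
       ∃[ δ ] (M ++ a ∷ R) [ σ ]q ≡ (M ++ a ∷ R) [ σ₀ ⊙ δ ]q × body c [ τ ]q ≡ body c [ τ₀ ⊙ δ ]q) →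
    M ++ a ∷ R -[ c , length M ]→ M [ σ₀ ]q ++ body c [ τ₀ ]q ++ R [ σ₀ ]q
  step-of-unifier M a R c {σ₀} {τ₀} unif general = sound , complete
    where
    Q₁ : Query
    Q₁ = M [ σ₀ ]q ++ body c [ τ₀ ]q ++ R [ σ₀ ]q

    at : ∀ δ → Q₁ [ δ ]q ≡ M [ σ₀ ⊙ δ ]q ++ body c [ τ₀ ⊙ δ ]q ++ R [ σ₀ ⊙ δ ]q
    at δ = trans (subst-++₃ δ (M [ σ₀ ]q) (body c [ τ₀ ]q) (R [ σ₀ ]q))
      (cong₂ _++_ (⊙-query σ₀ δ M) (cong₂ _++_ (⊙-query τ₀ δ (body c)) (⊙-query σ₀ δ R)))

    sound : ⟦ Q₁ ⟧ ⊆ Post c (length M) ⟦ M ++ a ∷ R ⟧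
    sound (δ , refl) =
      _ , (σ₀ ⊙ δ , refl)
      , subst₂ (Rewrite c (length M))
          (trans (cong (λ h → M [ σ₀ ⊙ δ ]q ++ h ∷ R [ σ₀ ⊙ δ ]q)
                   (trans (sym (⊙-atom τ₀ δ (head c))) (trans (cong (_[ δ ]ₐ) (sym unif)) (⊙-atom σ₀ δ a))))
                 (sym (subst-split₃ (σ₀ ⊙ δ) M a R)))
          (sym (at δ))
          (subst (λ k → Rewrite c k (M [ σ₀ ⊙ δ ]q ++ head c [ τ₀ ⊙ δ ]ₐ ∷ R [ σ₀ ⊙ δ ]q)
                                    (M [ σ₀ ⊙ δ ]q ++ body c [ τ₀ ⊙ δ ]q ++ R [ σ₀ ⊙ δ ]q))
             (length-map (_[ σ₀ ⊙ δ ]ₐ) M)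
             (rewrite-at c (M [ σ₀ ⊙ δ ]q) (τ₀ ⊙ δ) (R [ σ₀ ⊙ δ ]q)))

    complete : Post c (length M) ⟦ M ++ a ∷ R ⟧ ⊆ ⟦ Q₁ ⟧
    complete (X , (σ , refl) , rw) with rewrite-inv rw
    ... | L′ , τ , R′ , len , eqX , refl
      with ++-split-length (M [ σ ]q) L′ (trans (length-map (_[ σ ]ₐ) M) (sym len))
             (trans (sym (subst-split₃ σ M a R)) eqX)
    ... | eqM , eqAR with ∷-injective eqAR
    ... | eqa , eqR with general σ τ eqa
    ... | δ , eqQ , eqB
      with ++-split-length (M [ σ ]q) (M [ σ₀ ⊙ δ ]q)
             (trans (length-map (_[ σ ]ₐ) M) (sym (length-map (_[ σ₀ ⊙ δ ]ₐ) M)))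
             (trans (sym (subst-split₃ σ M a R)) (trans eqQ (subst-split₃ (σ₀ ⊙ δ) M a R)))
    ... | eqM′ , eqAR′ =
      δ , trans (cong₂ _++_ (trans (sym eqM) eqM′)
                   (cong₂ _++_ eqB (trans (sym eqR) (proj₂ (∷-injective eqAR′)))))
                (sym (at δ))

  -- One rewritable instance shows that the selected atom and the head unify; their mgu then
  -- accounts for all instances.
  step-exists : ∀ {c k Q X Y} → ⟦ Q ⟧ X → Rewrite c k X Y → ∃[ Q₁ ] Q -[ c , k ]→ Q₁
  step-exists {c} {k} {Q} (σ , refl) rw with rewrite-inv rw
  ... | L′ , τ , R′ , refl , eqX , _ with subst-split Q L′ eqX
  ... | M , a , R , refl , refl , eqa , refl
    with separate (a ∷ []) (head c ∷ []) (cong (_∷ []) eqa)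
  ... | σ₀ , τ₀ , unif , general =
    M [ σ₀ ]q ++ body c [ τ₀ ]q ++ R [ σ₀ ]q
    , subst (λ n → M ++ a ∷ R -[ c , n ]→ M [ σ₀ ]q ++ body c [ τ₀ ]q ++ R [ σ₀ ]q)
        (sym (length-map (_[ σ ]ₐ) M))
        (step-of-unifier M a R c (proj₁ (∷-injective unif)) λ σ′ τ′ e →
          let δ , eσ , eτ = general σ′ τ′ (cong (_∷ []) e)
          in δ , agree-query (M ++ a ∷ R) (λ {x} _ → eσ x) , agree-query (body c) (λ {x} _ → eτ x))

  After : Query → QSet → QSet
  After A₀ S Y = ∃[ X ] ⟦ A₀ ⟧ X × S (X ++ Y)

  after-split : ∀ A₀ A Z {σ τ Y} → length A ≡ length A₀ → A₀ [ τ ]q ++ Y ≡ (A ++ Z) [ σ ]q →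
                A₀ [ τ ]q ≡ A [ σ ]q × Y ≡ Z [ σ ]q
  after-split A₀ A Z {σ} {τ} len eq = ++-split-length (A₀ [ τ ]q) (A [ σ ]q)
    (trans (length-map (_[ τ ]ₐ) A₀) (trans (sym len) (sym (length-map (_[ σ ]ₐ) A))))
    (trans eq (map-++ (_[ σ ]ₐ) A Z))

  -- Unifying `A` with `A₀` turns the remainder into a single query, so discarding a prefix leads
  -- from queries to queries.
  after-principal : ∀ A₀ A Z {Y} → length A ≡ length A₀ → After A₀ ⟦ A ++ Z ⟧ Y →
                    ∃[ W ] ⟦ W ⟧ ≐ After A₀ ⟦ A ++ Z ⟧
  after-principal A₀ A Z len (_ , (_ , refl) , _ , eq)
    with separate A A₀ (sym (proj₁ (after-split A₀ A Z len eq)))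
  ... | σ₀ , τ₀ , unif , general =
    Z [ σ₀ ]q
    , (λ { (δ , refl) → A₀ [ τ₀ ]q [ δ ]q , (τ₀ ⊙ δ , ⊙-query τ₀ δ A₀) , σ₀ ⊙ δ
         , trans (cong₂ _++_ (trans (cong (_[ δ ]q) (sym unif)) (⊙-query σ₀ δ A)) (⊙-query σ₀ δ Z))
                 (sym (map-++ (_[ σ₀ ⊙ δ ]ₐ) A Z)) })
    , λ { (_ , (τ , refl) , σ , eq) →
          let eqA , eqY = after-split A₀ A Z len eq
              δ , eσ , _ = general σ τ (sym eqA)
          in δ , trans eqY (trans (agree-query Z (λ {x} _ → eσ x)) (sym (⊙-query σ₀ δ Z))) }

  -- L′, R′ and B′ need not be the parts of X and of the clause that s uses: this is what
  -- relates the textual order to the order of the permutations.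
  step-semantics : ExcludedMiddle 0ℓ → ∀ {P X X₁ a c} (s : Step P X X₁) → selected s ≡ a → clause s ≡ c →
    ∀ L′ R′ B′ →
    (∀ {x} → x ∈ varsQ (L′ ++ a ∷ R′) → x ∈ varsQ X) →
    (∀ {x} → x ∈ varsQ B′ → x ∈ varsQ (body c)) →
    L′ ++ a ∷ R′ -[ head c ⟵ B′ , length L′ ]→ (L′ ++ B′ [ var ∘ rename s ]q ++ R′) [ mgu s ]q
  step-semantics em {X = X} {a = a} {c} s refl refl L′ R′ B′ vars⊆ body⊆ =
    subst (L′ ++ a ∷ R′ -[ c′ , length L′ ]→_)
      (sym (trans (subst-++₃ θ L′ (B′ [ ρ ]q) R′)
             (cong (λ B → L′ [ θ ]q ++ B ++ R′ [ θ ]q) (⊙-query ρ θ B′))))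
      (step-of-unifier L′ a R′ c′ {θ} {ρ ⊙ θ}
        (trans unifies (⊙-atom ρ θ (head c)))
        general)
    where
    open IsMGU (is-mgu s)

    c′ : Clause
    c′ = head c ⟵ B′

    θ ρ : Subst
    θ = mgu s
    ρ = var ∘ rename s

    module _ (σ τ : Subst) where
      -- An mgu is compared with single substitutions. Since the variant is renamed apart, `σ` and
      -- `τ` can be joined into one.
      combined : Subst
      combined x with em {P = ∃[ y ] rename s y ≡ x × y ∈ varsC c}
      ... | yes (y , _) = τ y
      ... | no  _       = σ x

      combined-query : ∀ {x} → x ∈ varsQ X → combined x ≡ σ x
      combined-query {x} x∈ with em {P = ∃[ y ] rename s y ≡ x × y ∈ varsC c}
      ... | yes (y , refl , y∈) =
        ⊥-elim (apart s (∈-varsC-subst c y∈ (here refl) , x∈))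
      ... | no  _               = refl

      combined-clause : ∀ {y} → y ∈ varsC c → combined (rename s y) ≡ τ y
      combined-clause {y} y∈ with em {P = ∃[ z ] rename s z ≡ rename s y × z ∈ varsC c}
      ... | yes (z , eq , _) = cong τ (rename-injective s eq)
      ... | no  ¬∃           = ⊥-elim (¬∃ (y , refl , y∈))

    general : ∀ σ τ → a [ σ ]ₐ ≡ head c [ τ ]ₐ →
      ∃[ δ ] (L′ ++ a ∷ R′) [ σ ]q ≡ (L′ ++ a ∷ R′) [ θ ⊙ δ ]q × B′ [ τ ]q ≡ B′ [ (ρ ⊙ θ) ⊙ δ ]q
    general σ τ eq =
      let ω = combined σ τ
          δ , mg = most-general ω
            (trans (agree-atom a (combined-query σ τ ∘ vars⊆ ∘ a∈))
              (trans eq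
                (trans (agree-atom (head c) (λ y∈ → sym (combined-clause σ τ (∈-++⁺ˡ y∈))))
                       (sym (⊙-atom ρ ω (head c))))))
      in δ
         , agree-query (L′ ++ a ∷ R′) (λ {x} x∈ → trans (sym (combined-query σ τ (vars⊆ x∈))) (mg x))
         , agree-query B′ (λ {y} y∈ →
             trans (sym (combined-clause σ τ (∈-++⁺ʳ (varsₐ (head c)) (body⊆ y∈)))) (mg (rename s y)))
      where
      a∈ : ∀ {x} → x ∈ varsₐ a → x ∈ varsQ (L′ ++ a ∷ R′)
      a∈ = skip L′
        where
        skip : ∀ M {x} → x ∈ varsₐ a → x ∈ varsQ (M ++ a ∷ R′)
        skip []      x∈ = ∈-++⁺ˡ x∈
        skip (b ∷ M) x∈ = ∈-++⁺ʳ (varsₐ b) (skip M x∈)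

  real-step : ∀ {P} M a R c {σ τ} → c ∈ clauses P → a [ σ ]ₐ ≡ head c [ τ ]ₐ →
    ∃[ X₁ ] Σ (Step P (M ++ a ∷ R) X₁) λ s →
      left s ≡ M × selected s ≡ a × clause s ≡ c × X₁ ≡ (M ++ body c [ var ∘ rename s ]q ++ R) [ mgu s ]q
  real-step {P} M a R c {σ} {τ} c∈ eq = _ , s , refl , refl , refl , refl
    where
    Q : Query
    Q = M ++ a ∷ R

    n : ℕ
    n = proj₁ (strict-bound (varsQ Q))

    below : ∀ {x} → x ∈ varsQ Q → x < n
    below = proj₂ (strict-bound (varsQ Q))

    -- Adding `n` moves the clause variables beyond all variables of the query.
    ρ : Subst
    ρ y = var (y + n)

    ω : Subst
    ω x with x <? n
    ... | yes _ = σ x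
    ... | no  _ = τ (x ∸ n)

    ω-query : ∀ {x} → x < n → ω x ≡ σ x
    ω-query {x} x<n with x <? n
    ... | yes _   = refl
    ... | no  x≮n = ⊥-elim (x≮n x<n)

    ω-clause : ∀ y → ω (y + n) ≡ τ y
    ω-clause y with y + n <? n
    ... | yes lt = ⊥-elim (m+n≮n y n lt)
    ... | no  _  = cong τ (m+n∸n≡m y n)

    a∈ : ∀ N {x} → x ∈ varsₐ a → x ∈ varsQ (N ++ a ∷ R)
    a∈ []      x∈ = ∈-++⁺ˡ x∈
    a∈ (b ∷ N) x∈ = ∈-++⁺ʳ (varsₐ b) (a∈ N x∈)

    unified : a [ ω ]ₐ ≡ head c [ ρ ]ₐ [ ω ]ₐ
    unified = trans (agree-atom a (ω-query ∘ below ∘ a∈ M))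
      (trans eq (trans (agree-atom (head c) (λ {y} _ → sym (ω-clause y))) (sym (⊙-atom ρ ω (head c)))))

    mg : ∃[ θ ] (a ∷ []) [ θ ]q ≡ (head c [ ρ ]ₐ ∷ []) [ θ ]q
         × (∀ σ → (a ∷ []) [ σ ]q ≡ (head c [ ρ ]ₐ ∷ []) [ σ ]q → ∀ x → σ x ≡ θ x [ σ ]ₜ)
    mg = unifyQ (a ∷ []) (head c [ ρ ]ₐ ∷ []) (cong (_∷ []) unified)

    disjoint : Disjoint (varsC (c [ ρ ]c)) (varsQ Q)
    disjoint (x∈c , x∈Q) with ∈-varsC-subst⁻ c x∈c
    ... | y , here refl = m+n≮n y n (below x∈Q)

    s : Step P Q ((M ++ body c [ ρ ]q ++ R) [ proj₁ mg ]q)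
    s = record
      { left = M ; selected = a ; right = R ; split = refl
      ; clause = c ; clause∈ = c∈
      ; rename = _+ n ; rename-injective = +-cancelʳ-≡ n _ _
      ; apart = disjoint
      ; mgu = proj₁ mg
      ; is-mgu = record
          { unifies      = proj₁ (∷-injective (proj₁ (proj₂ mg)))
          ; most-general = λ σ e → σ , proj₂ (proj₂ mg) σ (cong (_∷ []) e) }
      ; result = refl }

-- Repetition-free and pairwise related lists.

module _ {A : Set} where
  Unique-++⁻ : ∀ (xs : List A) {ys} → Unique (xs ++ ys) → Unique xs × Unique ys × Disjoint xs ys
  Unique-++⁻ []       uniq            = [] , uniq , λ ()
  Unique-++⁻ (x ∷ xs) (x∉ ∷ uniq) =
    let uxs , uys , disj = Unique-++⁻ xs uniq in
    AllP.++⁻ˡ xs x∉ ∷ uxs , uys , λ where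
      (here refl , y∈) → All.lookup (AllP.++⁻ʳ xs x∉) y∈ refl
      (there x∈  , y∈) → disj (x∈ , y∈)

  AllPairs-∈ : ∀ {R : A → A → Set} {xs x y} → AllPairs R xs → x ∈ xs → y ∈ xs →
               x ≡ y ⊎ R x y ⊎ R y x
  AllPairs-∈ (_ ∷ _)   (here refl) (here refl) = inj₁ refl
  AllPairs-∈ (rs ∷ _)  (here refl) (there y∈)  = inj₂ (inj₁ (All.lookup rs y∈))
  AllPairs-∈ (rs ∷ _)  (there x∈)  (here refl) = inj₂ (inj₂ (All.lookup rs x∈))
  AllPairs-∈ (_ ∷ rss) (there x∈)  (there y∈)  = AllPairs-∈ rss x∈ y∈

module _ {A B : Set} (f : A → List B) where
  concatMap-unique⇒≡ : ∀ xs {x y z} → Unique (concatMap f xs) → x ∈ xs → y ∈ xs →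
                       z ∈ f x → z ∈ f y → x ≡ y
  concatMap-unique⇒≡ (w ∷ xs) uniq x∈ y∈ z∈x z∈y with Unique-++⁻ (f w) uniq | x∈ | y∈
  ... | _ , _ , _    | here refl | here refl = refl
  ... | _ , _ , disj | here refl | there y∈′ = ⊥-elim (disj (z∈x , ∈-concatMap⁺ f (lose y∈′ z∈y)))
  ... | _ , _ , disj | there x∈′ | here refl = ⊥-elim (disj (z∈y , ∈-concatMap⁺ f (lose x∈′ z∈x)))
  ... | _ , u , _    | there x∈′ | there y∈′ = concatMap-unique⇒≡ xs u x∈′ y∈′ z∈x z∈y

lookup-ext : ∀ {A : Set} {n} {xs ys : Vec A n} →
             (∀ i → Vec.lookup xs i ≡ Vec.lookup ys i) → xs ≡ ys
lookup-ext {xs = []}     {[]}     eq = refl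
lookup-ext {xs = x ∷ xs} {y ∷ ys} eq = cong₂ _∷_ (eq Fin.zero) (lookup-ext (eq ∘ Fin.suc))

-- Matching of flat terms and the extension property.

module Invariant (em : ExcludedMiddle 0ℓ) (L : Language) where
  open Language L
  open FunctionSymbols functions
  open LogicPrograms L
  open Substitution functions
  open Instances L

  Top : Fun → Term → Set
  Top f t = ∃[ ts ] t ≡ con f ts

  Top-subst : ∀ {f σ} t → Top f t → Top f (t [ σ ]ₜ)
  Top-subst _ (ts , refl) = _ , refl

  Top-unique : ∀ {f g t} → Top f t → Top g t → f ≡ g
  Top-unique (_ , refl) (_ , refl) = refl

  Top⇒¬IsVar : ∀ {f t} → Top f t → ¬ IsVar t
  Top⇒¬IsVar (_ , refl) (_ , ())

  ¬IsVar⇒Top : ∀ t → ¬ IsVar t → ∃[ f ] Top f t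
  ¬IsVar⇒Top (var x)    ¬v = ⊥-elim (¬v (x , refl))
  ¬IsVar⇒Top (con f ts) _  = f , ts , refl

  override : List Var → Subst → Subst → Subst
  override xs σ τ x with x ∈? xs
  ... | yes _ = σ x
  ... | no  _ = τ x

  override-∈ : ∀ xs σ τ {x} → x ∈ xs → override xs σ τ x ≡ σ x
  override-∈ xs σ τ {x} x∈ with x ∈? xs
  ... | yes _  = refl
  ... | no  x∉ = ⊥-elim (x∉ x∈)

  override-∉ : ∀ xs σ τ {x} → x ∉ xs → override xs σ τ x ≡ τ x
  override-∉ xs σ τ {x} x∉ with x ∈? xs
  ... | yes x∈ = ⊥-elim (x∉ x∈)
  ... | no  _  = refl

  -- Linearity allows gluing the matchers of the single terms. Keeping `τ` on all other variables is
  -- what leaves the surrounding atoms unchanged.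
  linear-match : ∀ {I : Set} (s u : I → Term) is (τ : Subst) → Unique (concatMap (varsₜ ∘ s) is) →
    (∀ {i} → i ∈ is → Σ Subst λ σ → s i [ σ ]ₜ ≡ u i) →
    Σ Subst λ σ → (∀ {i} → i ∈ is → s i [ σ ]ₜ ≡ u i) × (∀ {x} → x ∉ concatMap (varsₜ ∘ s) is → σ x ≡ τ x)
  linear-match s u []       τ uniq match = τ , (λ ()) , λ _ → refl
  linear-match s u (i ∷ is) τ uniq match =
    let _ , uniq′ , disj = Unique-++⁻ (varsₜ (s i)) uniq
        σ₁ , eq₁         = match (here refl)
        σ , eq , out     = linear-match s u is τ uniq′ (match ∘ there)
    in override (varsₜ (s i)) σ₁ σ
       , (λ where
            (here refl)     → trans (agree-term (s i) (override-∈ (varsₜ (s i)) σ₁ σ)) eq₁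
            {j} (there j∈)  → trans (agree-term (s j) λ x∈ → override-∉ (varsₜ (s i)) σ₁ σ λ x∈i →
                                disj (x∈i , ∈-concatMap⁺ (varsₜ ∘ s) (lose j∈ x∈))) (eq j∈))
       , λ x∉ → trans (override-∉ (varsₜ (s i)) σ₁ σ (x∉ ∘ ∈-++⁺ˡ)) (out (x∉ ∘ ∈-++⁺ʳ (varsₜ (s i))))

  -- For a flat term the top symbol decides everything, which is why slots record nothing else.
  flat-match : ∀ {t u} → Flat t → (∀ f → Top f t → Top f u) → ∃[ σ ] t [ σ ]ₜ ≡ u
  flat-match {u = u} (flat-var x)         top = (λ _ → u) , refl
  flat-match         (flat-con f xs uniq) top with top f (_ , refl)
  ... | us , refl = let σ , eq = go xs us uniq in σ , cong (con f) eq
    where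
    go : ∀ {n} (xs : Vec Var n) us → VecUnique.Unique xs → ∃[ σ ] Vec.map var xs [ σ ]ₜₛ ≡ us
    go []       []       _           = var , refl
    go (x ∷ xs) (u ∷ us) (x∉ ∷ᵖ uniq) =
      let σ , eq = go xs us uniq in
      override (x ∷ []) (λ _ → u) σ
      , cong₂ _∷_ (override-∈ (x ∷ []) (λ _ → u) σ (here refl)) (trans (skip xs x∉) eq)
      where
      skip : ∀ {n} {σ : Subst} (ys : Vec Var n) → VecAll.All (λ y → x ≢ y) ys →
             Vec.map var ys [ override (x ∷ []) (λ _ → u) σ ]ₜₛ ≡ Vec.map var ys [ σ ]ₜₛ
      skip         []       _          = refl
      skip {σ = σ} (y ∷ ys) (x≢y ∷ᵛ ne) =
        cong₂ _∷_ (override-∉ (x ∷ []) (λ _ → u) σ λ where (here y≡x) → x≢y (sym y≡x)) (skip ys ne)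

  -- Definitionally `inVars` and `outVars` at the two modes.
  modeVars : Mode → Atom → List Var
  modeVars m a = concatMap (varsₜ ∘ arg a) (positions m (pred a))

  ∈-positions : ∀ {m p} i → mode p i ≡ m → i ∈ positions m p
  ∈-positions {m} {p} i eq = ∈-filter⁺ (λ i → mode p i ≟ᵐ m) (∈-allFin i) eq

  ∈-modeVars⁺ : ∀ {m} a i {x} → mode (pred a) i ≡ m → x ∈ varsₜ (arg a i) → x ∈ modeVars m a
  ∈-modeVars⁺ a i eq x∈ = ∈-concatMap⁺ (varsₜ ∘ arg a) (lose (∈-positions i eq) x∈)

  ∈-modeVars⁻ : ∀ {m} a {x} → x ∈ modeVars m a → ∃[ i ] mode (pred a) i ≡ m × x ∈ varsₜ (arg a i)
  ∈-modeVars⁻ {m} a x∈ =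
    let i , i∈ , x∈i = find (∈-concatMap⁻ (varsₜ ∘ arg a) {xs = positions m (pred a)} x∈)
    in i , proj₂ (∈-filter⁻ (λ i → mode (pred a) i ≟ᵐ m) {xs = allFin _} i∈) , x∈i

  modeVars-unique : ∀ {m a i j x} → Unique (modeVars m a) → mode (pred a) i ≡ m → mode (pred a) j ≡ m →
                    x ∈ varsₜ (arg a i) → x ∈ varsₜ (arg a j) → i ≡ j
  modeVars-unique {m} {a} {i} {j} uniq ei ej =
    concatMap-unique⇒≡ (varsₜ ∘ arg a) (positions m (pred a)) uniq (∈-positions i ei) (∈-positions j ej)

  lookup∈vars : ∀ {n} (ts : Vec Term n) i {x} → x ∈ varsₜ (Vec.lookup ts i) → x ∈ varsₜₛ ts
  lookup∈vars (t ∷ ts) Fin.zero    x∈ = ∈-++⁺ˡ x∈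
  lookup∈vars (t ∷ ts) (Fin.suc i) x∈ = ∈-++⁺ʳ (varsₜ t) (lookup∈vars ts i x∈)

  vars∈lookup : ∀ {n} (ts : Vec Term n) {x} → x ∈ varsₜₛ ts → ∃[ i ] x ∈ varsₜ (Vec.lookup ts i)
  vars∈lookup (t ∷ ts) x∈ with ∈-++⁻ (varsₜ t) x∈
  ... | inj₁ x∈t  = Fin.zero , x∈t
  ... | inj₂ x∈ts = let i , x∈i = vars∈lookup ts x∈ts in Fin.suc i , x∈i

  atom-match : ∀ m a (us : Vec Term (arity (pred a))) (τ : Subst) → Unique (modeVars m a) →
    (∀ i → mode (pred a) i ≡ m → Σ Subst λ σ → arg a i [ σ ]ₜ ≡ Vec.lookup us i) →
    Σ Subst λ σ → (∀ i → mode (pred a) i ≡ m → arg (a [ σ ]ₐ) i ≡ Vec.lookup us i)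
         × (∀ {x} → x ∉ modeVars m a → σ x ≡ τ x)
  atom-match m a us τ uniq match =
    let σ , eq , out = linear-match (arg a) (Vec.lookup us) (positions m (pred a)) τ uniq λ {i} i∈ →
                         match i (proj₂ (∈-filter⁻ (λ i → mode (pred a) i ≟ᵐ m) {xs = allFin _} i∈))
    in σ , (λ i e → trans (arg-subst (args a) i) (eq (∈-positions i e))) , out

  -- Slots: the shapes of the atoms of a query

  -- need i f: in output position i only terms with top symbol f can be found.
  record Slot : Set₁ where
    constructor slot
    field
      slotPred : Pred
      need     : Fin (arity slotPred) → Fun → Set
  open Slot public

  Meets : (s : Slot) → Vec Term (arity (slotPred s)) → Set
  Meets s ts = ∀ i f → mode (slotPred s) i ≡ output → need s i f → Top f (Vec.lookup ts i)

  data Fits (s : Slot) : Atom → Set where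
    fits : ∀ ts → Meets s ts → Fits s (atom (slotPred s) ts)

  SameInputs : (p : Pred) (ts us : Vec Term (arity p)) → Set
  SameInputs p ts us = ∀ i → mode p i ≡ input → Vec.lookup ts i ≡ Vec.lookup us i

  -- Semantic counterpart of being nicely moded with flat outputs: the outputs of an
  -- atom can be chosen freely (within the slot) once everything before them is fixed.
  Ext : List Slot → QSet → Set
  Ext []       S = ⊤
  Ext (s ∷ sl) S =
      (∀ {ts us R} → S (atom (slotPred s) ts ∷ R) → Meets s us → SameInputs (slotPred s) ts us →
         ∃[ R′ ] S (atom (slotPred s) us ∷ R′))
    × (∀ x → Ext sl (λ R → S (x ∷ R)))

  Ext-≐ : ∀ sl {S T} → S ≐ T → Ext sl S → Ext sl T
  Ext-≐ []       _       _           = tt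
  Ext-≐ (s ∷ sl) (⊆ , ⊇) (ext , exts) =
    (λ X∈ m same → let R , R∈ = ext (⊇ X∈) m same in R , ⊆ R∈)
    , λ x → Ext-≐ sl (⊆ , ⊇) (exts x)

  -- `Ext` only claims that further members exist, so it passes to unions.
  Ext-∃ : ∀ sl {I : Set} (S : I → QSet) → (∀ i → Ext sl (S i)) → Ext sl (λ X → ∃[ i ] S i X)
  Ext-∃ []       S exts = tt
  Ext-∃ (s ∷ sl) S exts =
    (λ (i , X∈) m same → let R , R∈ = proj₁ (exts i) X∈ m same in R , i , R∈)
    , λ x → Ext-∃ sl (λ i R → S i (x ∷ R)) (λ i → proj₂ (exts i) x)

  -- Well-typedness of one instance, in the order of the query. The quantifier over substitutions of
  -- the syntactic notion becomes one over the members of a set.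
  WT : Query → Set
  WT []      = ⊤
  WT (x ∷ X) = Typed input x × (Typed output x → WT X)

  data At {ℓ} {A : Set ℓ} : ℕ → List A → A → Set ℓ where
    here  : ∀ {x xs} → At 0 (x ∷ xs) x
    there : ∀ {k x y xs} → At k xs x → At (suc k) (y ∷ xs) x

  -- Meant for `a` ordered before `b`: it joins the linearity of the outputs with the ban on outputs
  -- in the inputs of earlier atoms.
  Independent : Atom → Atom → Set
  Independent a b = Disjoint (varsₐ a) (outVars b)

  record SelfNice (b : Atom) : Set where
    field
      out-unique : Unique (outVars b)
      in-out     : Disjoint (inVars b) (outVars b)
      out-flat   : ∀ i → mode (pred b) i ≡ output → Flat (arg b i)

  atomSlot : (∀ b → Fin (arity (pred b)) → Fun → Set) → Atom → Slot
  atomSlot nd b = slot (pred b) (nd b)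

  -- `Φ τ R` describes the surroundings of the body: the requirement of the enclosing set and, as
  -- the induction moves right, that the atoms already passed keep their value. Changing `τ` on the
  -- outputs of one atom respects the latter by independence, the former by `stable`.
  body-ext : (nd : ∀ b → Fin (arity (pred b)) → Fun → Set) →
    (∀ {b i f} → Top f (arg b i) → nd b i f) →
    ∀ sl B (Φ : Subst → QSet) → AllPairs Independent B → All SelfNice B →
    (∀ {b τ τ′ R} → b ∈ B → Φ τ R → (∀ {x} → x ∉ outVars b → τ′ x ≡ τ x) →
       Meets (atomSlot nd b) (args (b [ τ′ ]ₐ)) → ∃[ R′ ] Φ τ′ R′) →
    (∀ τ → Ext sl (Φ τ)) →
    Ext (map (atomSlot nd) B ++ sl) (λ Y → ∃[ τ ] ∃[ R ] Y ≡ B [ τ ]q ++ R × Φ τ R)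
  body-ext nd top sl []      Φ ind nice stable ext =
    Ext-≐ sl ((λ (τ , R∈) → τ , _ , refl , R∈) , λ { (τ , _ , refl , R∈) → τ , R∈ })
      (Ext-∃ sl Φ ext)
  body-ext nd top sl (b ∷ B) Φ (ind ∷ inds) (nice ∷ nices) stable ext = choose , continue
    where
    open SelfNice nice
    T : QSet
    T Y = ∃[ τ ] ∃[ R ] Y ≡ (b ∷ B) [ τ ]q ++ R × Φ τ R

    choose : ∀ {ts us R} → T (atom (pred b) ts ∷ R) → Meets (atomSlot nd b) us →
             SameInputs (pred b) ts us → ∃[ R′ ] T (atom (pred b) us ∷ R′)
    choose {us = us} (τ , R , refl , R∈) m same =
      let τ′ , eq , out = atom-match output b us τ out-unique λ i e →
                            flat-match (out-flat i e) λ f t → m i f e (top t)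
          eqs : args (b [ τ′ ]ₐ) ≡ us
          eqs = lookup-ext λ i → by-mode τ′ eq out i (mode (pred b) i) refl
          R′ , R′∈ = stable (here refl) R∈ out (subst (Meets (atomSlot nd b)) (sym eqs) m)
      in B [ τ′ ]q ++ R′ , τ′ , R′ , cong (λ ts → atom (pred b) ts ∷ B [ τ′ ]q ++ R′) (sym eqs) , R′∈
      where
      by-mode : ∀ τ′ →
        (∀ i → mode (pred b) i ≡ output → arg (b [ τ′ ]ₐ) i ≡ Vec.lookup us i) →
        (∀ {x} → x ∉ outVars b → τ′ x ≡ τ x) →
        ∀ i m → mode (pred b) i ≡ m → arg (b [ τ′ ]ₐ) i ≡ Vec.lookup us i
      by-mode τ′ eq out i output e = eq i e
      by-mode τ′ eq out i input  e =
        trans (arg-subst (args b) i)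
          (trans (agree-term (arg b i) λ x∈ → out λ x∈out → in-out (∈-modeVars⁺ b i e x∈ , x∈out))
            (trans (sym (arg-subst (args b) i)) (same i e)))

    continue : ∀ x → Ext (map (atomSlot nd) B ++ sl) (λ R → T (x ∷ R))
    continue x = Ext-≐ (map (atomSlot nd) B ++ sl)
      ((λ { (τ , R , refl , refl , R∈) → τ , R , refl , R∈ })
      , λ { (τ , R , refl , R∈) → τ , R , refl , refl , R∈ })
      (body-ext nd top sl B (λ τ R → x ≡ b [ τ ]ₐ × Φ τ R) inds nices
        (λ {b′} b′∈ (eq , R∈) out m →
           let R′ , R′∈ = stable (there b′∈) R∈ out m
           in R′ , trans eq (agree-atom b λ y∈ → sym (out λ y∈out → All.lookup ind b′∈ (y∈ , y∈out))) , R′∈)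
        λ τ → Ext-∃ sl (λ _ → Φ τ) λ _ → ext τ)

-- Preservation of slots and types under resolution.

module Persistence (em : ExcludedMiddle 0ℓ) (L : Language) (P : LogicPrograms.Program L) where
  open Language L
  open FunctionSymbols functions
  open LogicPrograms L
  open Substitution functions
  open Instances L
  open Invariant em L

  -- For clauses whose body already stands in the order of its permutation.
  record GoodClause (c : Clause) : Set where
    field
      in-unique   : Unique (inVars (head c))
      in-flat     : ∀ i → mode (pred (head c)) i ≡ input → Flat (arg (head c) i)
      in-bound    : ∀ i → mode (pred (head c)) i ≡ input → ¬ IsVar (arg (head c) i) →
                    Bound P (pred (head c)) i
      out-var     : ∀ i x → mode (pred (head c)) i ≡ output → Bound P (pred (head c)) i →
                    arg (head c) i ≡ var x →
                    FillsBound P input (type (pred (head c)) i) x (head c)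
                    ⊎ (∃[ b ] b ∈ body c × FillsBound P output (type (pred (head c)) i) x b)
      head-body   : ∀ {b} → b ∈ body c → Disjoint (inVars (head c)) (outVars b)
      independent : AllPairs Independent (body c)
      nice        : All SelfNice (body c)
      shaped      : All (Shaped P output) (body c)
      well-typed  : ∀ τ R → WT (head c [ τ ]ₐ ∷ R) → WT (body c [ τ ]q ++ R)

  -- The typed witness `t` is the semantic form of type-consistency: a demanded symbol never
  -- excludes well-typed outputs.
  SlotOK : Slot → Set
  SlotOK s = ∀ i f → mode (slotPred s) i ≡ output → need s i f →
    Bound P (slotPred s) i × ∃[ t ] Top f t × Has (type (slotPred s) i) t

  record Shape (sl : List Slot) (S : QSet) : Set₁ where
    field
      ext     : Ext sl S
      fitting : ∀ {X} → S X → Pointwise Fits sl X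
      ok      : All SlotOK sl

  Shape-tail : ∀ {s sl S} → Shape (s ∷ sl) S → ∀ x → Shape sl (λ R → S (x ∷ R))
  Shape-tail sh x = record
    { ext     = proj₂ ext x
    ; fitting = PW.tail ∘ fitting
    ; ok      = All.tail ok }
    where open Shape sh

  -- The inputs of `x` are instantiated far enough for the head, so resolution need not bind
  -- variables in them.
  InMatch : Atom → Atom → Set
  InMatch h x = ∃[ ts ] x ≡ atom (pred h) ts ×
    (∀ i f → mode (pred h) i ≡ input → Bound P (pred h) i → Top f (arg h i) → Top f (Vec.lookup ts i))

  -- An output variable of the body that is passed on to an output of the head has to
  -- respect the slot of the resolved atom.
  HeadNeeds : Slot → Atom → Var → Fun → Set
  HeadNeeds s h x f = ∃[ ts ] ∃[ i ] h ≡ atom (slotPred s) ts × mode (slotPred s) i ≡ output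
    × Vec.lookup ts i ≡ var x × need s i f

  bodyNeed : Slot → Atom → ∀ b → Fin (arity (pred b)) → Fun → Set
  bodyNeed s h b i f = Top f (arg b i) ⊎ (∃[ x ] arg b i ≡ var x × HeadNeeds s h x f)

  bodySlots : Clause → ℕ → List Slot → List Slot
  bodySlots c _       []       = []
  bodySlots c zero    (s ∷ sl) = map (atomSlot (bodyNeed s (head c))) (body c) ++ sl
  bodySlots c (suc k) (s ∷ sl) = s ∷ bodySlots c k sl

  module Resolve (c : Clause) (good : GoodClause c) where
    open GoodClause good

    h : Atom
    h = head c

    B : Query
    B = body c

    meets : ∀ {s ts} → Fits s (atom (slotPred s) ts) → Meets s ts
    meets (fits _ m) = m

    -- A non-variable output of the head keeps its top symbol under every substitution. This leaves
    -- the variables in bound positions, as the slot demands nothing elsewhere.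
    head-meets : ∀ {nd τ₀ τ} → SlotOK (slot (pred h) nd) →
      Meets (slot (pred h) nd) (args (h [ τ₀ ]ₐ)) →
      (∀ i x f → mode (pred h) i ≡ output → Bound P (pred h) i → nd i f → arg h i ≡ var x →
         Top f (τ₀ x) → Top f (τ x)) →
      Meets (slot (pred h) nd) (args (h [ τ ]ₐ))
    head-meets {nd} {τ₀} {τ} ok₀ m on-var i f e n
      with Vec.lookup (args h) i in eq | arg-subst (args h) i {τ₀} | arg-subst (args h) i {τ} | m i f e n
    ... | var x    | e₀ | e₁ | top =
      subst (Top f) (sym e₁) (on-var i x f e (proj₁ (ok₀ i f e n)) n eq (subst (Top f) e₀ top))
    ... | con g ts | e₀ | e₁ | top
      with Top-unique (_ , e₀) top
    ...   | refl = _ , e₁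

    body-fits : ∀ {s τ} → Fits s (h [ τ ]ₐ) → ∀ {b} → Fits (atomSlot (bodyNeed s h) b) (b [ τ ]ₐ)
    body-fits {slot _ nd} {τ} (fits _ m) {b} = fits _ λ where
      i f e (inj₁ top) → subst (Top f) (sym (arg-subst (args b) i)) (Top-subst (arg b i) top)
      i f e (inj₂ (x , eq , ts , i′ , refl , e′ , eq′ , n)) →
        subst (Top f)
          (trans (arg-subst (args h) i′)
            (trans (cong (_[ τ ]ₜ) (trans eq′ (sym eq))) (sym (arg-subst (args b) i))))
          (m i′ f e′ n)

    fits-post : ∀ k sl {S} → (∀ {X} → S X → Pointwise Fits sl X) →
                ∀ {Y} → Post c k S Y → Pointwise Fits (bodySlots c k sl) Y
    fits-post k sl fitting (X , X∈ , rw) = go k sl (fitting X∈) rw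
      where
      bodies : ∀ {s τ} B → Fits s (h [ τ ]ₐ) → ∀ {sl R} → Pointwise Fits sl R →
        Pointwise Fits (map (atomSlot (bodyNeed s h)) B ++ sl) (B [ τ ]q ++ R)
      bodies []      ft fs = fs
      bodies (b ∷ B) ft fs = body-fits ft ∷ bodies B ft fs

      go : ∀ k sl {X Y} → Pointwise Fits sl X → Rewrite c k X Y → Pointwise Fits (bodySlots c k sl) Y
      go zero    (s ∷ sl) (ft ∷ fs) (here τ R)   = bodies B ft fs
      go (suc k) (s ∷ sl) (ft ∷ fs) (there x rw) = ft ∷ go k sl fs rw

    -- A demand inherited from the head concerns a variable of a bound head output, which also fills
    -- a bound input of the head or a bound body output of the same type. As the variable occurs in
    -- an output of `b`, nice modedness excludes all but that very position of `b`.
    body-ok : ∀ {s} → SlotOK s → ∀ {b} → b ∈ B → SlotOK (atomSlot (bodyNeed s h) b)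
    body-ok ok₀ {b} b∈ i f e (inj₁ top@(us , eq)) with em {P = Bound P (pred b) i}
    ... | no  ¬bd = ⊥-elim (Top⇒¬IsVar top (proj₁ (All.lookup shaped b∈ i e) ¬bd))
    ... | yes bd  =
      let σ , has = proj₂ (proj₂ (All.lookup shaped b∈ i e) bd)
      in bd , arg b i [ σ ]ₜ , Top-subst (arg b i) top , has
    body-ok {s} ok₀ {b} b∈ i f e (inj₂ (x , eq , ts , i′ , h≡ , e′ , eq′ , n)) = go s ok₀ ts i′ h≡ e′ eq′ n
      where
      go : ∀ s → SlotOK s → ∀ ts i′ → h ≡ atom (slotPred s) ts → mode (slotPred s) i′ ≡ output →
           Vec.lookup ts i′ ≡ var x → need s i′ f →
           Bound P (pred b) i × ∃[ t ] Top f t × Has (type (pred b) i) t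
      go (slot _ nd) ok₀ _ i′ refl e′ eq′ n with ok₀ i′ f e′ n
      ... | bd , t , top , has with out-var i′ x e′ bd eq′
      ...   | inj₁ (j , ej , _ , _ , eqj) =
        ⊥-elim (head-body b∈ ( ∈-modeVars⁺ h j ej (subst (λ u → x ∈ varsₜ u) (sym eqj) (here refl))
                             , ∈-modeVars⁺ b i e (subst (λ u → x ∈ varsₜ u) (sym eq) (here refl))))
      ...   | inj₂ (b′ , b′∈ , j , ej , bdj , type≈ , eqj) with AllPairs-∈ independent b∈ b′∈
      ...     | inj₂ (inj₁ ind) =
        ⊥-elim (ind ( lookup∈vars (args b) i (subst (λ u → x ∈ varsₜ u) (sym eq) (here refl))
                    , ∈-modeVars⁺ b′ j ej (subst (λ u → x ∈ varsₜ u) (sym eqj) (here refl))))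
      ...     | inj₂ (inj₂ ind) =
        ⊥-elim (ind ( lookup∈vars (args b′) j (subst (λ u → x ∈ varsₜ u) (sym eqj) (here refl))
                    , ∈-modeVars⁺ b i e (subst (λ u → x ∈ varsₜ u) (sym eq) (here refl))))
      ...     | inj₁ refl
        with modeVars-unique {a = b} (SelfNice.out-unique (All.lookup nice b∈)) e ej
               (subst (λ u → x ∈ varsₜ u) (sym eq) (here refl))
               (subst (λ u → x ∈ varsₜ u) (sym eqj) (here refl))
      ...       | refl = bdj , t , top , Equivalence.from (type≈ t) has

    ok-post : ∀ k sl → All SlotOK sl → All SlotOK (bodySlots c k sl)
    ok-post k       []       _          = []
    ok-post zero    (s ∷ sl) (ok ∷ oks) = AllP.++⁺ (AllP.map⁺ (All.tabulate (body-ok ok))) oks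
    ok-post (suc k) (s ∷ sl) (ok ∷ oks) = ok ∷ ok-post k sl oks

    -- `τ₀` stands for one successful use of the clause, with which the other members of the set are
    -- compared.
    module _ (τ₀ : Subst) where
      MatchAt : ℕ → QSet → Set
      MatchAt k S = ∀ {X x} → S X → At k X x → InMatch (h [ τ₀ ]ₐ) x

      FitsAt : ℕ → List Slot → Set₁
      FitsAt k sl = ∀ {s} → At k sl s → Fits s (h [ τ₀ ]ₐ)

      -- The inputs of the head can be matched without touching the inputs of the
      -- selected atom, whose outputs can then be chosen as the head wants them.
      live : ∀ {sl} k {S X} → Shape sl S → MatchAt k S → FitsAt k sl → k < length X → S X →
             ∃[ Y ] Post c k S Y
      live {[]} k {X = x ∷ X} sh match fit lt X∈ with () ← Shape.fitting sh X∈
      live {s ∷ sl} (suc k) {X = x ∷ X} sh match fit (s≤s lt) X∈ =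
        let Y , R , R∈ , rw = live k (Shape-tail sh x) (λ R∈ at → match R∈ (there at)) (fit ∘ there) lt X∈
        in x ∷ Y , x ∷ R , R∈ , there x rw
      live {slot p nd ∷ sl} zero {X = x ∷ X} sh match fit lt X∈ with fit here | match X∈ here
      ... | fits _ m₀ | ts , refl , top =
        let τ , eq , out = atom-match input h ts τ₀ in-unique λ i e →
              flat-match (in-flat i e) λ f t →
                top i f e (in-bound i e (Top⇒¬IsVar t)) (subst (Top f) (sym (arg-subst (args h) i)) (Top-subst (arg h i) t))
            R , R∈ = proj₁ (Shape.ext sh) X∈ (head-meets (All.head (Shape.ok sh)) m₀ (on-var τ eq out))
                       (λ i e → sym (eq i e))
        in _ , _ , R∈ , here τ R
        where
        -- Such a variable fills a bound head input, where the match provides the symbol, or a body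
        -- output, where `τ` coincides with `τ₀`.
        on-var : ∀ τ → (∀ i → mode (pred h) i ≡ input → arg (h [ τ ]ₐ) i ≡ Vec.lookup ts i) →
          (∀ {x} → x ∉ inVars h → τ x ≡ τ₀ x) →
          ∀ i x f → mode (pred h) i ≡ output → Bound P (pred h) i → nd i f → arg h i ≡ var x →
          Top f (τ₀ x) → Top f (τ x)
        on-var τ eq out i x f e bd n eqx t with out-var i x e bd eqx
        ... | inj₁ (j , ej , bdj , _ , eqj) =
          subst (Top f) (trans (sym (eq j ej)) (trans (arg-subst (args h) j) (cong (_[ τ ]ₜ) eqj)))
            (top j f ej bdj (subst (Top f) (sym (trans (arg-subst (args h) j) (cong (_[ τ₀ ]ₜ) eqj))) t))
        ... | inj₂ (b , b∈ , j , ej , _ , _ , eqj) =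
          subst (Top f) (sym (out λ x∈ → head-body b∈ (x∈ ,
            ∈-modeVars⁺ b j ej (subst (λ u → x ∈ varsₜ u) (sym eqj) (here refl))))) t

      -- A prefix before the selected atom that was possible remains possible: this is the semantic
      -- form of instantiating no earlier atom.
      live-after : ∀ A₀ {sl} k {S Y} → Shape sl S → MatchAt (length A₀ + k) S → FitsAt (length A₀ + k) sl →
                   k < length Y → S (A₀ ++ Y) → ∃[ Y′ ] Post c (length A₀ + k) S (A₀ ++ Y′)
      live-after []       k sh match fit lt X∈ = live k sh match fit lt X∈
      live-after (x ∷ A₀) {[]} k sh match fit lt X∈ with () ← Shape.fitting sh X∈
      live-after (x ∷ A₀) {s ∷ sl} k sh match fit lt X∈ =
        let Y , R , R∈ , rw = live-after A₀ k (Shape-tail sh x) (λ R∈ at → match R∈ (there at)) (fit ∘ there) lt X∈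
        in Y , x ∷ R , R∈ , there x rw

      -- If outputs change before the selected atom, `live` keeps the step possible. If they change
      -- in the new body, the resolved head keeps its inputs, and its new outputs are again a
      -- legitimate choice in `S`.
      ext-post : ∀ k {sl S} → Shape sl S → MatchAt k S → FitsAt k sl → Ext (bodySlots c k sl) (Post c k S)
      ext-post k       {[]}     sh match fit = tt
      ext-post (suc k) {s ∷ sl} {S} sh match fit =
        (λ { {us = us} (_ , X∈ , there {X = X} _ rw) m same →
             let R , R∈ = proj₁ (Shape.ext sh) X∈ m same
                 x′ = atom (slotPred s) us
                 Y , Z , Z∈ , rw′ = live k (Shape-tail sh x′) (λ R∈ at → match R∈ (there at)) (fit ∘ there)
                                      (len X∈ R∈ rw) R∈
             in Y , x′ ∷ Z , Z∈ , there x′ rw′ })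
        , λ x → Ext-≐ (bodySlots c k sl)
            ((λ (R , R∈ , rw) → x ∷ R , R∈ , there x rw) , λ { (_ , R∈ , there _ rw) → _ , R∈ , rw })
            (ext-post k (Shape-tail sh x) (λ R∈ at → match R∈ (there at)) (fit ∘ there))
        where
        rewrite-< : ∀ {k X Y} → Rewrite c k X Y → k < length X
        rewrite-< (here τ R)   = s≤s z≤n
        rewrite-< (there x rw) = s≤s (rewrite-< rw)

        len : ∀ {x y X R Y} → S (x ∷ X) → S (y ∷ R) → Rewrite c k X Y → k < length R
        len X∈ R∈ rw = ≤-trans (rewrite-< rw) (≤-reflexive (suc-injective (trans
          (sym (PW.Pointwise-length (Shape.fitting sh X∈))) (PW.Pointwise-length (Shape.fitting sh R∈)))))
      ext-post zero    {s@(slot p nd) ∷ sl} {S} sh match fit with fit here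
      ... | fits _ m₀ =
        Ext-≐ (map (atomSlot bn) B ++ sl)
          ((λ { (τ , R , refl , R∈) → _ , R∈ , here τ R }) , λ { (_ , R∈ , here τ R) → τ , R , refl , R∈ })
          (body-ext bn inj₁ sl B (λ τ R → S (h [ τ ]ₐ ∷ R)) independent nice
            (λ b∈ R∈ out m → proj₁ (Shape.ext sh) R∈
               (head-meets (All.head (Shape.ok sh)) (meets (PW.head (Shape.fitting sh R∈))) (on-var b∈ out m))
               (λ i e → same b∈ out i e))
            λ τ → proj₂ (Shape.ext sh) (h [ τ ]ₐ))
        where
        bn : ∀ b → Fin (arity (pred b)) → Fun → Set
        bn = bodyNeed s h

        module _ {b : Atom} {τ τ′ : Subst} (b∈ : b ∈ B) (out : ∀ {x} → x ∉ outVars b → τ′ x ≡ τ x) where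
          same : SameInputs (pred h) (args (h [ τ ]ₐ)) (args (h [ τ′ ]ₐ))
          same i e = trans (arg-subst (args h) i)
            (trans (agree-term (arg h i) λ x∈ → sym (out λ x∈out → head-body b∈ (∈-modeVars⁺ h i e x∈ , x∈out)))
                   (sym (arg-subst (args h) i)))

          on-var : Meets (atomSlot bn b) (args (b [ τ′ ]ₐ)) →
            ∀ i x f → mode (pred h) i ≡ output → Bound P (pred h) i → nd i f → arg h i ≡ var x →
            Top f (τ x) → Top f (τ′ x)
          on-var m i x f e bd n eqx t with out-var i x e bd eqx
          ... | inj₁ (j , ej , _ , _ , eqj) =
            subst (Top f) (sym (out λ x∈out → head-body b∈
              (∈-modeVars⁺ h j ej (subst (λ u → x ∈ varsₜ u) (sym eqj) (here refl)) , x∈out))) t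
          ... | inj₂ (b′ , b′∈ , j , ej , _ , _ , eqj) with AllPairs-∈ independent b∈ b′∈
          -- Here the inherited demand pays off: the slot of `b` itself asks for `f`.
          ...   | inj₁ refl =
            subst (Top f) (trans (arg-subst (args b) j) (cong (_[ τ′ ]ₜ) eqj))
              (m j f ej (inj₂ (x , eqj , _ , i , refl , e , eqx , n)))
          ...   | inj₂ (inj₁ ind) =
            subst (Top f) (sym (out λ x∈out → ind (out⊆vars b x∈out ,
              ∈-modeVars⁺ b′ j ej (subst (λ u → x ∈ varsₜ u) (sym eqj) (here refl))))) t
            where
            out⊆vars : ∀ a {x} → x ∈ outVars a → x ∈ varsₐ a
            out⊆vars a x∈ = let i , _ , x∈i = ∈-modeVars⁻ a x∈ in lookup∈vars (args a) i x∈i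
          ...   | inj₂ (inj₂ ind) =
            subst (Top f) (sym (out λ x∈out → ind
              (lookup∈vars (args b′) j (subst (λ u → x ∈ varsₜ u) (sym eqj) (here refl)) , x∈out))) t

      shape-post : ∀ k {sl S} → Shape sl S → MatchAt k S → FitsAt k sl → Shape (bodySlots c k sl) (Post c k S)
      shape-post k {sl} sh match fit = record
        { ext     = ext-post k sh match fit
        ; fitting = fits-post k sl (Shape.fitting sh)
        ; ok      = ok-post k sl (Shape.ok sh) }

    wt-post : ∀ {k X Y} → Rewrite c k X Y → WT X → WT Y
    wt-post (here τ R)   wt        = well-typed τ R wt
    wt-post (there x rw) (in-wt , wt) = in-wt , wt-post rw ∘ wt

-- Generic atoms of a slot.

range : ∀ n → ℕ → Vec ℕ n
range zero    b = []
range (suc n) b = b ∷ range n (suc b)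

module GenericAtoms (em : ExcludedMiddle 0ℓ) (L : Language) (P : LogicPrograms.Program L) where
  open Language L
  open FunctionSymbols functions
  open LogicPrograms L
  open Substitution functions
  open Instances L
  open Invariant em L
  open Persistence em L P

  concatMap-unique : ∀ {I : Set} (g : I → List Var) is → Unique is → (∀ i → Unique (g i)) →
    (∀ {i j x} → x ∈ g i → x ∈ g j → i ≡ j) → Unique (concatMap g is)
  concatMap-unique g []       _             uniq inj = []
  concatMap-unique g (i ∷ is) (i∉ ∷ uniq-is) uniq inj =
    Uniq.++⁺ (uniq i) (concatMap-unique g is uniq-is uniq inj) λ (x∈i , x∈is) →
      let j , j∈ , x∈j = find (∈-concatMap⁻ g {xs = is} x∈is)
      in All.lookup i∉ j∈ (inj x∈i x∈j)

  fresh : Maybe Fun → ℕ → Term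
  fresh nothing  b = var b
  fresh (just f) b = con f (Vec.map var (range (funArity f) b))

  width : Maybe Fun → ℕ
  width nothing  = 1
  width (just f) = funArity f

  range-bounds : ∀ n b {x} → x ∈ varsₜₛ (Vec.map var (range n b)) → b ≤ x × x < b + n
  range-bounds (suc n) b (here refl) = ≤-refl , m<m+n b (s≤s z≤n)
  range-bounds (suc n) b (there x∈)  =
    let lo , hi = range-bounds n (suc b) x∈
    in ≤-trans (n≤1+n b) lo , ≤-trans hi (≤-reflexive (sym (+-suc b n)))

  range-unique : ∀ n b → Unique (varsₜₛ (Vec.map var (range n b)))
  range-unique zero    b = []
  range-unique (suc n) b =
    All.tabulate (λ x∈ b≡x → <⇒≢ (proj₁ (range-bounds n (suc b) x∈)) b≡x) ∷ range-unique n (suc b)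

  range-vecUnique : ∀ n b → VecUnique.Unique (range n b)
  range-vecUnique zero    b = []ᵖ
  range-vecUnique (suc n) b = above n (suc b) ≤-refl ∷ᵖ range-vecUnique n (suc b)
    where
    above : ∀ n c → b < c → VecAll.All (λ y → b ≢ y) (range n c)
    above zero    c b<c = []ᵛ
    above (suc n) c b<c = <⇒≢ b<c ∷ᵛ above n (suc c) (m<n⇒m<1+n b<c)

  fresh-bounds : ∀ k b {x} → x ∈ varsₜ (fresh k b) → b ≤ x × x < b + width k
  fresh-bounds nothing  b (here refl) = ≤-refl , ≤-reflexive (+-comm 1 b)
  fresh-bounds (just f) b x∈          = range-bounds (funArity f) b x∈

  fresh-unique : ∀ k b → Unique (varsₜ (fresh k b))
  fresh-unique nothing  b = [] ∷ []
  fresh-unique (just f) b = range-unique (funArity f) b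

  fresh-flat : ∀ k b → Flat (fresh k b)
  fresh-flat nothing  b = flat-var b
  fresh-flat (just f) b = flat-con f _ (range-vecUnique (funArity f) b)

  fresh-top : ∀ k b {f} → Top f (fresh k b) → k ≡ just f
  fresh-top nothing  b (_ , ())
  fresh-top (just f) b (_ , refl) = refl

  -- The most general atom of the slot with the inputs `ts`. Its outputs look like those of a
  -- robustly typed query, so that input selectability and robustness can be applied to it.
  record Generic (s : Slot) (ts us : Vec Term (arity (slotPred s))) : Set where
    field
      same    : SameInputs (slotPred s) ts us
      meeting : Meets s us
      self    : SelfNice (atom (slotPred s) us)
      free    : ∀ i → mode (slotPred s) i ≡ output → ¬ (∃[ f ] need s i f) → IsVar (Vec.lookup us i)
      forced  : ∀ i f → mode (slotPred s) i ≡ output → Top f (Vec.lookup us i) → need s i f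

  generic : ∀ s ts → Meets s ts → ∃[ us ] Generic s ts us
  generic s ts m = us , record
    { same    = λ i e → sym (trans (lookup∘tabulate u i) (u-input i e))
    ; meeting = λ i f e n → subst (Top f) (sym (trans (lookup∘tabulate u i) (u-output i e))) (kind-top i f e n)
    ; self    = record
        { out-unique = subst Unique (concatMap-cong (positions output p) λ i → sym (cong varsₜ (lookup∘tabulate u i)))
            (concatMap-unique′ (positions output p) (λ i∈ → proj₂ (∈-filter⁻ (λ i → mode p i ≟ᵐ output) {xs = allFin _} i∈))
              (Uniq.filter⁺ (λ i → mode p i ≟ᵐ output) (Uniq.allFin⁺ _)))
        ; in-out     = λ {x} (x∈i , x∈o) →
            let i , ei , x∈i′ = ∈-modeVars⁻ a x∈i
                j , ej , x∈j′ = ∈-modeVars⁻ a x∈o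
                x<N = proj₂ (strict-bound (varsₜₛ ts)) (lookup∈vars ts i
                        (subst (λ t → x ∈ varsₜ t) (trans (lookup∘tabulate u i) (u-input i ei)) x∈i′))
                lo , _ = fresh-bounds (kind j) (base j)
                        (subst (λ t → x ∈ varsₜ t) (trans (lookup∘tabulate u j) (u-output j ej)) x∈j′)
            in <-irrefl refl (≤-trans x<N (≤-trans (m≤m+n N (toℕ j * M)) lo))
        ; out-flat   = λ i e → subst Flat (sym (trans (lookup∘tabulate u i) (u-output i e))) (fresh-flat (kind i) (base i)) }
    ; free    = λ i e ¬n → subst IsVar (sym (trans (lookup∘tabulate u i) (u-output i e))) (kind-free i ¬n)
    ; forced  = λ i f e top → kind-need i f (fresh-top (kind i) (base i)
        (subst (Top f) (trans (lookup∘tabulate u i) (u-output i e)) top)) }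
    where
    p : Pred
    p = slotPred s

    kind : Fin (arity p) → Maybe Fun
    kind i with em {P = ∃[ f ] need s i f}
    ... | yes (f , _) = just f
    ... | no  _       = nothing

    -- `N` exceeds the variables of `ts` and `M` the number of fresh variables in any position, so
    -- the blocks starting at `N + toℕ i * M` are disjoint from the inputs and from each other.
    N M : ℕ
    N = proj₁ (strict-bound (varsₜₛ ts))
    M = proj₁ (strict-bound (map (width ∘ kind) (allFin (arity p))))

    base : Fin (arity p) → ℕ
    base i = N + toℕ i * M

    u : Fin (arity p) → Term
    u i with mode p i
    ... | input  = Vec.lookup ts i
    ... | output = fresh (kind i) (base i)

    us : Vec Term (arity p)
    us = Vec.tabulate u

    a : Atom
    a = atom p us

    u-input : ∀ i → mode p i ≡ input → u i ≡ Vec.lookup ts i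
    u-input i e with mode p i
    ... | input = refl

    u-output : ∀ i → mode p i ≡ output → u i ≡ fresh (kind i) (base i)
    u-output i e with mode p i
    ... | output = refl

    kind-top : ∀ i f → mode p i ≡ output → need s i f → Top f (fresh (kind i) (base i))
    kind-top i f e n with em {P = ∃[ f ] need s i f}
    ... | no  ¬n       = ⊥-elim (¬n (f , n))
    ... | yes (g , n′) with Top-unique (m i f e n) (m i g e n′)
    ...   | refl = _ , refl

    kind-free : ∀ i → ¬ (∃[ f ] need s i f) → IsVar (fresh (kind i) (base i))
    kind-free i ¬n with em {P = ∃[ f ] need s i f}
    ... | no  _ = _ , refl
    ... | yes n = ⊥-elim (¬n n)

    kind-need : ∀ i f → kind i ≡ just f → need s i f
    kind-need i f eq with em {P = ∃[ f ] need s i f}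
    kind-need i f refl | yes (_ , n) = n

    width<M : ∀ i → width (kind i) < M
    width<M i = proj₂ (strict-bound (map (width ∘ kind) (allFin (arity p)))) (∈-map⁺ (width ∘ kind) (∈-allFin i))

    fresh-injective : ∀ {i j x} → x ∈ varsₜ (fresh (kind i) (base i)) → x ∈ varsₜ (fresh (kind j) (base j)) → i ≡ j
    fresh-injective {i} {j} x∈i x∈j =
      FinP.toℕ-injective (≤-antisym (not-above x∈i x∈j) (not-above x∈j x∈i))
      where
      not-above : ∀ {i j x} → x ∈ varsₜ (fresh (kind i) (base i)) → x ∈ varsₜ (fresh (kind j) (base j)) →
                  toℕ i ≤ toℕ j
      not-above {i} {j} x∈i x∈j = ≮⇒≥ λ j<i → <-irrefl refl
        (≤-trans (proj₂ (fresh-bounds (kind j) (base j) x∈j))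
          (≤-trans (+-monoʳ-≤ (base j) (<⇒≤ (width<M j)))
            (≤-trans (≤-reflexive (trans (+-assoc N (toℕ j * M) M) (cong (N +_) (+-comm (toℕ j * M) M))))
              (≤-trans (+-monoʳ-≤ N (*-monoˡ-≤ M j<i)) (proj₁ (fresh-bounds (kind i) (base i) x∈i))))))

    concatMap-cong : ∀ {g g′ : Fin (arity p) → List Var} is → (∀ i → g i ≡ g′ i) → concatMap g is ≡ concatMap g′ is
    concatMap-cong []       eq = refl
    concatMap-cong (i ∷ is) eq = cong₂ _++_ (eq i) (concatMap-cong is eq)

    concatMap-unique′ : ∀ is → (∀ {i} → i ∈ is → mode p i ≡ output) → Unique is → Unique (concatMap (varsₜ ∘ u) is)
    concatMap-unique′ is out uniq =
      subst Unique (same-on is out)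
        (concatMap-unique (λ i → varsₜ (fresh (kind i) (base i))) is uniq (λ i → fresh-unique (kind i) (base i)) fresh-injective)
      where
      same-on : ∀ is → (∀ {i} → i ∈ is → mode p i ≡ output) →
                concatMap (λ i → varsₜ (fresh (kind i) (base i))) is ≡ concatMap (varsₜ ∘ u) is
      same-on []       out = refl
      same-on (i ∷ is) out = cong₂ _++_ (cong varsₜ (sym (u-output i (out (here refl))))) (same-on is (out ∘ there))

  generic-general : ∀ {s ts us vs} → Generic s ts us → SameInputs (slotPred s) ts vs → Meets s vs →
                    ∃[ σ ] atom (slotPred s) us [ σ ]ₐ ≡ atom (slotPred s) vs
  generic-general {s} {ts} {us} {vs} gen same-vs m =
    let σ , eq , out = atom-match output (atom (slotPred s) us) vs var out-unique λ i e →
                         flat-match (out-flat i e) λ f top → m i f e (forced i f e top)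
    in σ , cong (atom (slotPred s)) (lookup-ext λ i → by-mode σ eq out i (mode (slotPred s) i) refl)
    where
    open Generic gen
    open SelfNice self
    by-mode : ∀ σ → (∀ i → mode (slotPred s) i ≡ output → Vec.lookup (us [ σ ]ₜₛ) i ≡ Vec.lookup vs i) →
      (∀ {x} → x ∉ outVars (atom (slotPred s) us) → σ x ≡ var x) →
      ∀ i m → mode (slotPred s) i ≡ m → Vec.lookup (us [ σ ]ₜₛ) i ≡ Vec.lookup vs i
    by-mode σ eq out i output e = eq i e
    by-mode σ eq out i input  e =
      trans (arg-subst us i)
        (trans (agree-term (Vec.lookup us i) λ x∈ → out λ x∈out →
                  in-out (∈-modeVars⁺ (atom (slotPred s) us) i e x∈ , x∈out))
          (trans (var-term _) (trans (sym (same i e)) (same-vs i e))))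

  -- Type-consistency comes from `SlotOK` where a symbol is demanded, and elsewhere from types being
  -- inhabited.
  generic-shaped : ∀ {s ts us} → SlotOK s → Generic s ts us → Shaped P output (atom (slotPred s) us)
  generic-shaped {s} {ts} {us} ok gen i e =
    (λ ¬bd → free i e λ (f , n) → ¬bd (proj₁ (ok i f e n)))
    , λ bd → SelfNice.out-flat self i e , consistent
    where
    open Generic gen
    consistent : TypeConsistent (type (slotPred s) i) (Vec.lookup us i)
    consistent with em {P = ∃[ f ] need s i f}
    ... | no ¬n with free i e ¬n
    ...   | x , eq =
      let t , has = inhabited (type (slotPred s) i)
      in (λ _ → t) , subst (Has (type (slotPred s) i)) (sym (cong (_[ (λ _ → t) ]ₜ) eq)) has
    consistent | yes (f , n) =
      let _ , t , top , has = ok i f e n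
          σ , eq = flat-match (SelfNice.out-flat self i e) λ g top′ →
                     subst (λ g → Top g t) (Top-unique (meeting i f e n) top′) top
      in σ , subst (Has (type (slotPred s) i)) (sym eq) has

-- Infinite sequences of resolution steps in the order of the permutations.

module Sequences (em : ExcludedMiddle 0ℓ) (L : Language) (P : LogicPrograms.Program L)
                 (isel : LogicPrograms.InputSelectability L P)
                 {n : ℕ} (oc : Fin n → LogicPrograms.Clause L)
                 (good : ∀ j → Persistence.GoodClause em L P (oc j))
                 where
  open Language L
  open LogicPrograms L
  open Substitution functions
  open Instances L
  open Invariant em L
  open Persistence em L P
  open GenericAtoms em L P

  At-functional : ∀ {k} {X : Query} {x y} → At k X x → At k X y → x ≡ y
  At-functional here       here       = refl
  At-functional (there at) (there at′) = At-functional at at′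

  At-subst : ∀ {k Q q} σ → At k Q q → At k (Q [ σ ]q) (q [ σ ]ₐ)
  At-subst σ here       = here
  At-subst σ (there at) = there (At-subst σ at)

  At-below : ∀ {k i} {Q : Query} {q} → At k Q q → i < k → ∃[ q′ ] At i Q q′
  At-below {i = zero}  (there at) _        = _ , here
  At-below {i = suc i} (there at) (s≤s lt) = let q , at′ = At-below at lt in q , there at′

  At-split : ∀ {k} {Q : Query} {q} → At k Q q → ∃[ M ] ∃[ R ] Q ≡ M ++ q ∷ R × length M ≡ k
  At-split here = [] , _ , refl , refl
  At-split (there {y = y} at) with At-split at
  ... | M , R , refl , refl = y ∷ M , R , refl , refl

  At-++ˡ : ∀ {k} {X Y : Query} {x} → At k X x → At k (X ++ Y) x
  At-++ˡ here       = here
  At-++ˡ (there at) = there (At-++ˡ at)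

  At-++ʳ : ∀ {k} (X : Query) {Y x} → At k Y x → At (length X + k) (X ++ Y) x
  At-++ʳ []      at = at
  At-++ʳ (_ ∷ X) at = there (At-++ʳ X at)

  At-++ʳ⁻ : ∀ {k} (X : Query) {Y x} → At (length X + k) (X ++ Y) x → At k Y x
  At-++ʳ⁻ []      at         = at
  At-++ʳ⁻ (_ ∷ X) (there at) = At-++ʳ⁻ X at

  Rewrite-At : ∀ {c k X Y} → Rewrite c k X Y → ∃[ τ ] At k X (head c [ τ ]ₐ)
  Rewrite-At (here τ R)   = τ , here
  Rewrite-At (there x rw) = let τ , at = Rewrite-At rw in τ , there at

  Fits-At : ∀ {k sl X s x} → Pointwise Fits sl X → At k sl s → At k X x → Fits s x
  Fits-At (ft ∷ _)  here       here        = ft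
  Fits-At (_ ∷ fts) (there at) (there at′) = Fits-At fts at at′

  ∈⟦⟧-At : ∀ {Q X k x} → ⟦ Q ⟧ X → At k X x → ∃[ q ] ∃[ σ ] At k Q q × x ≡ q [ σ ]ₐ
  ∈⟦⟧-At {q ∷ Q} (σ , refl) here       = q , σ , here , refl
  ∈⟦⟧-At {q ∷ Q} (σ , refl) (there at) =
    let q′ , σ′ , at′ , eq = ∈⟦⟧-At {Q} (σ , refl) at in q′ , σ′ , there at′ , eq

  Blocked-instance : ∀ {a σ} → Blocked P (a [ σ ]ₐ) → Blocked P a
  Blocked-instance {a} (bs , bs∈ , isVar) = bs , bs∈ , λ i e →
    go (arg a i) (subst IsVar (arg-subst (args a) i) (isVar i e))
    where
    go : ∀ t {σ} → IsVar (t [ σ ]ₜ) → IsVar t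
    go (var x)    _        = x , refl
    go (con f ts) (_ , ())

  Selectable-instance : ∀ a σ → Selectable P a → Selectable P (a [ σ ]ₐ)
  Selectable-instance a σ sel = sel ∘ Blocked-instance {a} {σ}

  variable-type : ∀ (T : Type) {x} → Has T (var x) → IsVariableType T
  variable-type T has y = closed T (λ _ → var y) has

  -- Input selectability asks for variables in free outputs, so it is applied to the generic atom;
  -- selectability passes to instances.
  typed⇒selectable : ∀ {s x} → SlotOK s → Fits s x → Typed input x → Selectable P x
  typed⇒selectable {s} ok (fits ts m) typed =
    let us , gen = generic s ts m
        open Generic gen
        σ , eq = generic-general {vs = ts} gen (λ _ _ → refl) m
    in subst (Selectable P) eq (Selectable-instance (atom (slotPred s) us) σ
         (proj₂ (isel (atom (slotPred s) us)
            (λ i e ¬bd → proj₁ (generic-shaped ok gen i e) ¬bd))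
           (λ i e ¬vt (x , isVar) → ¬vt (variable-type (type (slotPred s) i)
              (subst (Has (type (slotPred s) i)) (trans (same i e) isVar) (typed i e))))))

  choose-at : ∀ {k sl S X s ts us} → Shape sl S → At k sl s → S X → At k X (atom (slotPred s) ts) →
    Meets s us → SameInputs (slotPred s) ts us → ∃[ X′ ] S X′ × At k X′ (atom (slotPred s) us)
  choose-at sh here X∈ here m same = let R , R∈ = proj₁ (Shape.ext sh) X∈ m same in _ , R∈ , here
  choose-at {X = x ∷ X} sh (there at) X∈ (there at′) m same =
    let X′ , X′∈ , at″ = choose-at (Shape-tail sh x) at X∈ at′ m same in x ∷ X′ , X′∈ , there at″

  At-slot : ∀ {k sl X x} → Pointwise Fits sl X → At k X x → ∃[ s ] At k sl s
  At-slot (_ ∷ _)   here       = _ , here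
  At-slot (_ ∷ fts) (there at) = let s , at′ = At-slot fts at in s , there at′

  All-At : ∀ {ℓ p} {A : Set ℓ} {Q : A → Set p} {k xs x} → All Q xs → At k xs x → Q x
  All-At (q ∷ _)  here       = q
  All-At (_ ∷ qs) (there at) = All-At qs at

  -- The bound inputs of `q` are non-variable, so all instances share their top symbols with the one
  -- that matches the head. Input selectability yields this through a generic atom with the inputs
  -- of `q`, which by `Ext` is an instance of `q` and thus selectable too.
  selectable⇒match : ∀ {sl Q k q X} c τ₀ → Shape sl ⟦ Q ⟧ → At k Q q → Selectable P q →
    ⟦ Q ⟧ X → At k X (head c [ τ₀ ]ₐ) → ∀ {X x} → ⟦ Q ⟧ X → At k X x → InMatch (head c [ τ₀ ]ₐ) x
  selectable⇒match {sl} {Q} {k} {q} c τ₀ sh at sel X∈ atX {x = y} Y∈ atY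
    with ∈⟦⟧-At X∈ atX | ∈⟦⟧-At Y∈ atY | At-slot (Shape.fitting sh (⟦⟧-self Q)) at
  ... | q₁ , σ₁ , at₁ , eq₁ | q₂ , σ₂ , at₂ , eq₂ | s , at-s
    with At-functional at₁ at | At-functional at₂ at
  ... | refl | refl with Fits-At (Shape.fitting sh (⟦⟧-self Q)) at-s at
  ... | fits ts m = subst₂ InMatch (sym eq₁) (sym eq₂) ((ts [ σ₂ ]ₜₛ) , refl , λ i f e bd top →
    let us , gen = generic s ts m
        open Generic gen
        X′ , X′∈ , at′ = choose-at {us = us} sh at-s (⟦⟧-self Q) at meeting same
        q′ , σ′ , atq′ , eq′ = ∈⟦⟧-At X′∈ at′
        sel-us = subst (Selectable P) (sym (trans eq′ (cong (_[ σ′ ]ₐ) (At-functional atq′ at))))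
                   (Selectable-instance (atom (slotPred s) ts) σ′ sel)
        nonvar = proj₁ (isel (atom (slotPred s) us)
                   (λ i e ¬bd → proj₁ (generic-shaped (All-At (Shape.ok sh) at-s) gen i e) ¬bd)) sel-us i e bd
        g , topg = ¬IsVar⇒Top (Vec.lookup ts i) (subst (λ t → ¬ IsVar t) (sym (same i e)) nonvar)
        f≡g = Top-unique top (subst (Top g) (sym (arg-subst ts i)) (Top-subst (Vec.lookup ts i) topg))
    in subst (Top f) (sym (arg-subst ts i))
         (Top-subst (Vec.lookup ts i) (subst (λ g → Top g (Vec.lookup ts i)) (sym f≡g) topg)))

  record Inv (Q : Query) : Set₁ where
    constructor inv
    field
      {slots} : List Slot
      shape   : Shape slots ⟦ Q ⟧
      wt      : ∀ {X} → ⟦ Q ⟧ X → WT X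

  first-selectable : ∀ {a Q} → Inv (a ∷ Q) → Selectable P a
  first-selectable {a} {Q} (inv {[]} sh wt) with () ← Shape.fitting sh (⟦⟧-self (a ∷ Q))
  first-selectable {a} {Q} (inv {s ∷ sl} sh wt) =
    typed⇒selectable (All.head (Shape.ok sh)) (PW.head (Shape.fitting sh (⟦⟧-self (a ∷ Q))))
      (proj₁ (wt (⟦⟧-self (a ∷ Q))))

  -- `K` states which selections are allowed, by index and predicate.
  module _ (K : ℕ → Pred → Set) where
    record Resolution (Q Q₁ : Query) : Set where
      constructor resolution
      field
        {index}  : ℕ
        {number} : Fin n
        step     : Q -[ oc number , index ]→ Q₁
        {chosen} : Atom
        at       : At index Q chosen
        select   : Selectable P chosen
        kind     : K index (pred chosen)

    record Sequence : Set where
      constructor sequence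
      field
        query : ℕ → Query
        steps : ∀ i → Resolution (query i) (query (suc i))
  open Resolution public

  module _ {K : ℕ → Pred → Set} where
    open Sequence

    tail : Sequence K → Sequence K
    tail s = sequence (query s ∘ suc) (steps s ∘ suc)

    cons : ∀ {Q} (s : Sequence K) → Resolution K Q (query s 0) → Sequence K
    cons {Q} s r = sequence q st
      where
      q : ℕ → Query
      q zero    = Q
      q (suc i) = query s i
      st : ∀ i → Resolution K (q i) (q (suc i))
      st zero    = r
      st (suc i) = steps s i

    module _ {Q Q₁} (I : Inv Q) (r : Resolution K Q Q₁) where
      private
        c : Clause
        c = oc (number r)

        pre : Post c (index r) ⟦ Q ⟧ Q₁
        pre = proj₁ (step r) (⟦⟧-self Q₁)

        τ₀ : Subst
        τ₀ = proj₁ (Rewrite-At (proj₂ (proj₂ pre)))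

      open Resolve c (good (number r))

      match : MatchAt τ₀ (index r) ⟦ Q ⟧
      match = selectable⇒match c τ₀ (Inv.shape I) (at r) (select r) (proj₁ (proj₂ pre))
                (proj₂ (Rewrite-At (proj₂ (proj₂ pre))))

      fit : FitsAt τ₀ (index r) (Inv.slots I)
      fit at-s = Fits-At (Shape.fitting (Inv.shape I) (proj₁ (proj₂ pre))) at-s
                   (proj₂ (Rewrite-At (proj₂ (proj₂ pre))))

      inv-step : Inv Q₁
      inv-step = inv
        (record
          { ext     = Ext-≐ (bodySlots c (index r) (Inv.slots I)) (proj₂ (step r) , proj₁ (step r)) (Shape.ext post)
          ; fitting = λ X∈ → Shape.fitting post (proj₁ (step r) X∈)
          ; ok      = Shape.ok post })
        λ X∈ → let X , X∈′ , rw = proj₁ (step r) X∈ in wt-post rw (Inv.wt I X∈′)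
        where
        post : Shape (bodySlots c (index r) (Inv.slots I)) (Post c (index r) ⟦ Q ⟧)
        post = shape-post τ₀ (index r) (Inv.shape I) match fit

      live-prefix : ∀ A₀ k {Y} → index r ≡ length A₀ + k → k < length Y → ⟦ Q ⟧ (A₀ ++ Y) →
                    ∃[ Y′ ] ⟦ Q₁ ⟧ (A₀ ++ Y′)
      live-prefix A₀ k eq lt X∈ =
        let Y′ , Y′∈ = live-after τ₀ A₀ k (Inv.shape I) (subst (λ k → MatchAt τ₀ k ⟦ Q ⟧) eq match)
                         (subst (λ k → FitsAt τ₀ k (Inv.slots I)) eq fit) lt X∈
        in Y′ , proj₂ (step r) (subst (λ k → Post c k ⟦ Q ⟧ (A₀ ++ Y′)) (sym eq) Y′∈)

      -- The prefix of `Q` still begins an instance of `Q₁`. Thus the step has not instantiated it,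
      -- and selectability can be carried back over the step.
      earlier-kept : ∀ {i q q₁} → i < index r → At i Q q → At i Q₁ q₁ → ∃[ δ ] q ≡ q₁ [ δ ]ₐ
      earlier-kept {i} i< atq atq₁ with At-split (at r)
      ... | M , R , eqQ , len =
        let Y′ , Y′∈ = live-prefix M 0 (trans (sym len) (sym (+-identityʳ _))) (s≤s z≤n) (subst ⟦ Q ⟧ eqQ (⟦⟧-self Q))
            q₂ , δ , at₂ , eq = ∈⟦⟧-At Y′∈ (before M (subst (i <_) (sym len) i<) (subst (λ Q → At i Q _) eqQ atq))
        in δ , trans eq (cong (_[ δ ]ₐ) (At-functional at₂ atq₁))
        where
        before : ∀ {i} (M : Query) {X Y x} → i < length M → At i (M ++ X) x → At i (M ++ Y) x
        before (_ ∷ M) lt       here       = here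
        before (_ ∷ M) (s≤s lt) (there at) = there (before M lt at)

  -- Commuting resolution steps

  Rewrite-++ : ∀ {c d R R′} M → Rewrite c d R R′ → Rewrite c (length M + d) (M ++ R) (M ++ R′)
  Rewrite-++ []      rw = rw
  Rewrite-++ (x ∷ M) rw = there x (Rewrite-++ M rw)

  Rewrite-++⁻ : ∀ {c d R X} M → Rewrite c (length M + d) (M ++ R) X →
                ∃[ R′ ] X ≡ M ++ R′ × Rewrite c d R R′
  Rewrite-++⁻ []      rw = _ , refl , rw
  Rewrite-++⁻ (x ∷ M) (there _ rw) with Rewrite-++⁻ M rw
  ... | R′ , refl , rw′ = R′ , refl , rw′

  -- Rewritings involve no unifier and act on separate places. With `d` atoms in between, rewriting
  -- the left one first moves the right one from `suc (i + d)` to `i + (length (body c′) + d)`.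
  commute : ∀ {c c′} i d {W Y X} → Rewrite c (suc (i + d)) W Y → Rewrite c′ i Y X →
            ∃[ V ] Rewrite c′ i W V × Rewrite c (i + (length (body c′) + d)) V X
  commute {c} {c′} zero d (there {X = R} x rw) (here τ R′) =
    body c′ [ τ ]q ++ R , here τ R
    , subst (λ l → Rewrite c (l + d) (body c′ [ τ ]q ++ R) (body c′ [ τ ]q ++ R′))
        (length-map (_[ τ ]ₐ) (body c′)) (Rewrite-++ (body c′ [ τ ]q) rw)
  commute (suc i) d (there x rw) (there _ rw′) =
    let V , rw₁ , rw₂ = commute i d rw rw′ in x ∷ V , there x rw₁ , there x rw₂

  commute⁻ : ∀ {c c′} i d {W V X} → Rewrite c′ i W V → Rewrite c (i + (length (body c′) + d)) V X →
             ∃[ Y ] Rewrite c (suc (i + d)) W Y × Rewrite c′ i Y X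
  commute⁻ {c} {c′} zero d (here τ R) rw
    with Rewrite-++⁻ {d = d} (body c′ [ τ ]q)
           (subst (λ l → Rewrite c (l + d) (body c′ [ τ ]q ++ R) _) (sym (length-map (_[ τ ]ₐ) (body c′))) rw)
  ... | R′ , refl , rw′ = _ , there _ rw′ , here τ R′
  commute⁻ (suc i) d (there x rw) (there _ rw′) =
    let Y , rw₁ , rw₂ = commute⁻ i d rw rw′ in x ∷ Y , there x rw₁ , there x rw₂

  At-shift : ∀ {c i d W V w} → Rewrite c i W V → At (suc (i + d)) W w → At (i + (length (body c) + d)) V w
  At-shift {c} {d = d} {w = w} (here τ R) (there at) =
    subst (λ l → At (l + d) (body c [ τ ]q ++ R) w) (length-map (_[ τ ]ₐ) (body c)) (At-++ʳ (body c [ τ ]q) at)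
  At-shift (there x rw) (there at) = there (At-shift rw at)

  module _ {K : ℕ → Pred → Set} where
    open Sequence

    -- The steps before the pulled one leave the atoms to their left unchanged, so that its
    -- atom is selectable from the start.
    pull : ∀ m → (∀ {k k′ p} → m ≤ k → K k p → K k′ p) →
      ∀ i (s : Sequence K) → Inv (query s 0) → (∀ {j} → j < i → m ≤ index (steps s j)) → index (steps s i) < m →
      Σ (Sequence K) λ s′ → Σ (Resolution K (query s 0) (query s′ 0)) λ r → index r < m
    pull m shift zero    s I ≥m <m = tail s , steps s 0 , <m
    pull m shift (suc i) s I ≥m <m
      with pull m shift i (tail s) (inv-step I (steps s 0)) (λ j< → ≥m (s≤s j<)) <m
    ... | s″ , b , b< = cons s″ z′ , b′ , b<
      where
      z : Resolution K (query s 0) (query s 1)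
      z = steps s 0

      Q Q₁ Q₂ : Query
      Q  = query s 0
      Q₁ = query s 1
      Q₂ = query s″ 0

      cb cz : Clause
      cb = oc (number b)
      cz = oc (number z)

      b<z : index b < index z
      b<z = ≤-trans b< (≥m (s≤s z≤n))

      d : ℕ
      d = index z ∸ suc (index b)

      z≡ : index z ≡ suc (index b + d)
      z≡ = sym (m+[n∸m]≡n b<z)

      to : ∀ {X} → ⟦ Q₂ ⟧ X → ∃[ V ] Post cb (index b) ⟦ Q ⟧ V × Rewrite cz (index b + (length (body cb) + d)) V X
      to X∈ =
        let Y , Y∈ , rwb = proj₁ (step b) X∈
            W , W∈ , rwz = proj₁ (step z) Y∈
            V , rw₁ , rw₂ = commute (index b) d (subst (λ k → Rewrite cz k W Y) z≡ rwz) rwb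
        in V , (W , W∈ , rw₁) , rw₂

      from : ∀ {V X} → Post cb (index b) ⟦ Q ⟧ V → Rewrite cz (index b + (length (body cb) + d)) V X → ⟦ Q₂ ⟧ X
      from (W , W∈ , rw₁) rw₂ =
        let Y , rwz , rwb = commute⁻ (index b) d rw₁ rw₂
        in proj₂ (step b) (Y , proj₂ (step z) (W , W∈ , subst (λ k → Rewrite cz k W Y) (sym z≡) rwz) , rwb)

      -- A single instance on which the exchanged steps run proves that `b` can be performed first.
      b-first : ∃[ Q′ ] Q -[ cb , index b ]→ Q′
      b-first = let V , (W , W∈ , rw) , _ = to (⟦⟧-self Q₂) in step-exists W∈ rw

      Q′ : Query
      Q′ = proj₁ b-first

      b′ : Resolution K Q Q′
      b′ = resolution (proj₂ b-first) (proj₂ b-at)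
        (subst (Selectable P) (sym (proj₂ b-kept)) (Selectable-instance (chosen b) (proj₁ b-kept) (select b)))
        (subst (λ a → K (index b) (pred a)) (sym (proj₂ b-kept)) (kind b))
        where
        b-at : ∃[ q ] At (index b) Q q
        b-at = At-below (at z) b<z

        b-kept : ∃[ δ ] proj₁ b-at ≡ chosen b [ δ ]ₐ
        b-kept = earlier-kept I z b<z (proj₂ b-at) (at b)

      z′ : Resolution K Q′ Q₂
      z′ with proj₁ (proj₂ b-first) (⟦⟧-self Q′)
      ... | W , (σ , refl) , rw = resolution
        ( (λ X∈ → let V , V∈ , rw = to X∈ in V , proj₂ (proj₂ b-first) V∈ , rw)
        , λ (V , V∈ , rw) → from (proj₁ (proj₂ b-first) V∈) rw )
        (At-shift rw (subst (λ k → At k (Q [ σ ]q) (chosen z [ σ ]ₐ)) z≡ (At-subst σ (at z))))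
        (Selectable-instance (chosen z) σ (select z))
        (shift (≥m (s≤s z≤n)) (kind z))

  -- Discarding a prefix that is never selected

  take-split : ∀ m (X : Query) → m ≤ length X → ∃[ M ] ∃[ R ] X ≡ M ++ R × length M ≡ m
  take-split zero    X       _        = [] , X , refl , refl
  take-split (suc m) (x ∷ X) (s≤s le) with take-split m X le
  ... | M , R , refl , refl = x ∷ M , R , refl , refl

  typed-outputs : ∀ {s} ts → SlotOK s → Meets s ts →
    ∃[ us ] Meets s us × SameInputs (slotPred s) ts us × Typed output (atom (slotPred s) us)
  typed-outputs {s} ts ok m = Vec.tabulate u
    , (λ i f e n → subst (Top f) (sym (lookup∘tabulate u i)) (proj₁ (proj₂ (choice i)) e f n))
    , (λ i e → trans (sym (proj₁ (proj₂ (proj₂ (choice i))) e)) (sym (lookup∘tabulate u i)))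
    , (λ i e → subst (Has (type p i)) (sym (lookup∘tabulate u i)) (proj₂ (proj₂ (proj₂ (choice i))) e))
    where
    p : Pred
    p = slotPred s

    choice : ∀ i → ∃[ t ] (mode p i ≡ output → ∀ f → need s i f → Top f t)
                        × (mode p i ≡ input → t ≡ Vec.lookup ts i)
                        × (mode p i ≡ output → Has (type p i) t)
    choice i with mode p i in e
    ... | input  = Vec.lookup ts i , (λ ()) , (λ _ → refl) , λ ()
    ... | output with em {P = ∃[ f ] need s i f}
    ...   | no ¬n = let t , has = inhabited (type p i) in t , (λ _ f n → ⊥-elim (¬n (f , n))) , (λ ()) , λ _ → has
    ...   | yes (f , n) =
      let _ , t , top , has = ok i f e n
      in t , (λ _ g n′ → subst (λ g → Top g t) (Top-unique (m i f e n) (m i g e n′)) top) , (λ ()) , λ _ → has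

    u : Fin (arity p) → Term
    u i = proj₁ (choice i)

  -- From left to right, because new outputs of one atom may change all atoms after it.
  typed-prefix : ∀ m {sl S X} → Shape sl S → S X → m ≤ length X →
    ∃[ A₀ ] ∃[ Y ] S (A₀ ++ Y) × length A₀ ≡ m × All (Typed output) A₀
  typed-prefix zero    sh X∈ le = [] , _ , X∈ , refl , []
  typed-prefix (suc m) {[]}     {X = x ∷ X} sh X∈ le with () ← Shape.fitting sh X∈
  typed-prefix (suc m) {s ∷ sl} {X = x ∷ X} sh X∈ (s≤s le) with Shape.fitting sh X∈
  ... | fits ts m₀ ∷ _ with typed-outputs ts (All.head (Shape.ok sh)) m₀
  ...   | us , m₁ , same , typed with proj₁ (Shape.ext sh) X∈ m₁ same
  ...     | R , R∈ =
    let y = atom (slotPred s) us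
        len = suc-injective (trans (sym (PW.Pointwise-length (Shape.fitting sh X∈))) (PW.Pointwise-length (Shape.fitting sh R∈)))
        A₀ , Y , Y∈ , len-A , typeds = typed-prefix m (Shape-tail sh y) R∈ (≤-trans le (≤-reflexive len))
    in y ∷ A₀ , Y , Y∈ , cong suc len-A , typed ∷ typeds

  Ext-after : ∀ X sl {S} → Ext sl S → Ext (drop (length X) sl) (λ Y → S (X ++ Y))
  Ext-after []      sl       ext       = ext
  Ext-after (x ∷ X) []       ext       = tt
  Ext-after (x ∷ X) (s ∷ sl) (_ , ext) = Ext-after X sl (ext x)

  fitting-after : ∀ X sl {Y} → Pointwise Fits sl (X ++ Y) → Pointwise Fits (drop (length X) sl) Y
  fitting-after []      sl       fts       = fts
  fitting-after (x ∷ X) (s ∷ sl) (_ ∷ fts) = fitting-after X sl fts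

  WT-after : ∀ X {Y} → All (Typed output) X → WT (X ++ Y) → WT Y
  WT-after []      []               wt       = wt
  WT-after (x ∷ X) (typed ∷ typeds) (_ , wt) = WT-after X typeds (wt typed)

  Typed-subst : ∀ {m a} σ → Typed m a → Typed m (a [ σ ]ₐ)
  Typed-subst {a = a} σ typed i e =
    subst (Has (type (pred a) i)) (sym (arg-subst (args a) i)) (closed (type (pred a) i) σ (typed i e))

  -- The typed outputs of `A₀` discharge the assumptions under which the remainder is well typed.
  Inv-after : ∀ {Q W} A₀ → Inv Q → All (Typed output) A₀ → ⟦ W ⟧ ≐ After A₀ ⟦ Q ⟧ → Inv W
  Inv-after {Q} A₀ (inv {sl} sh wt) typed (W⊆ , ⊆W) = inv {slots = drop (length A₀) sl}
    (record
      { ext     = Ext-≐ (drop (length A₀) sl)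
          ( (λ { (τ , Y∈) → ⊆W (A₀ [ τ ]q , (τ , refl) , Y∈) })
          , λ Y∈ → case-W (W⊆ Y∈) )
          (Ext-∃ (drop (length A₀) sl) (λ τ Y → ⟦ Q ⟧ (A₀ [ τ ]q ++ Y)) λ τ →
             subst (λ l → Ext (drop l sl) (λ Y → ⟦ Q ⟧ (A₀ [ τ ]q ++ Y))) (length-map (_[ τ ]ₐ) A₀)
               (Ext-after (A₀ [ τ ]q) sl (Shape.ext sh)))
      ; fitting = λ {Y} Y∈ → let τ , Y∈′ = case-W (W⊆ Y∈) in
          subst (λ l → Pointwise Fits (drop l sl) Y) (length-map (_[ τ ]ₐ) A₀)
            (fitting-after (A₀ [ τ ]q) sl (Shape.fitting sh Y∈′))
      ; ok      = AllP.drop⁺ (length A₀) (Shape.ok sh) })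
    λ Y∈ → let τ , Y∈′ = case-W (W⊆ Y∈) in
      WT-after (A₀ [ τ ]q) (AllP.map⁺ (All.map (λ {a} → Typed-subst {a = a} τ) typed)) (wt Y∈′)
    where
    case-W : ∀ {Y} → After A₀ ⟦ Q ⟧ Y → ∃[ τ ] ⟦ Q ⟧ (A₀ [ τ ]q ++ Y)
    case-W (_ , (τ , refl) , Y∈) = τ , Y∈

  module _ {K : ℕ → Pred → Set} where
    open Sequence

    members-length : ∀ {Q X} → ⟦ Q ⟧ X → length X ≡ length Q
    members-length {Q} (σ , refl) = length-map (_[ σ ]ₐ) Q

    At-< : ∀ {k} {X : Query} {x} → At k X x → k < length X
    At-< here       = s≤s z≤n
    At-< (there at) = s≤s (At-< at)

    after-step : (∀ {k k′ p} → K k p → K k′ p) → ∀ A₀ {Q Q₁ W W₁} (r : Resolution K Q Q₁) →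
      length A₀ ≤ index r → ⟦ W ⟧ ≐ After A₀ ⟦ Q ⟧ → ⟦ W₁ ⟧ ≐ After A₀ ⟦ Q₁ ⟧ → Resolution K W W₁
    after-step shift A₀ {Q} {Q₁} {W} {W₁} r ≥m (W⊆ , ⊆W) (W₁⊆ , ⊆W₁) = go (W⊆ (⟦⟧-self W))
      where
      c : Clause
      c = oc (number r)

      k′ : ℕ
      k′ = index r ∸ length A₀

      shifted : ∀ τ → length (A₀ [ τ ]q) + k′ ≡ index r
      shifted τ = trans (cong (_+ k′) (length-map (_[ τ ]ₐ) A₀)) (m+[n∸m]≡n ≥m)

      sound : ⟦ W₁ ⟧ ⊆ Post c k′ ⟦ W ⟧
      sound Y′∈ with W₁⊆ Y′∈
      ... | _ , (τ , refl) , X∈ with proj₁ (step r) X∈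
      ...   | X , X∈′ , rw with take-split (length (A₀ [ τ ]q)) X
                  (subst₂ _≤_ (sym (length-map (_[ τ ]ₐ) A₀)) (sym (members-length {Q} X∈′))
                    (≤-trans ≥m (<⇒≤ (At-< (at r)))))
      ...     | M , Y , refl , lenM
        with Rewrite-++⁻ M (subst (λ k → Rewrite c k (M ++ Y) _)
               (trans (sym (shifted τ)) (cong (_+ k′) (sym lenM))) rw)
      ...       | Y″ , eq , rw′ with ++-split-length (A₀ [ τ ]q) M (sym lenM) eq
      ...         | refl , refl = Y , ⊆W (M , (τ , refl) , X∈′) , rw′

      complete : Post c k′ ⟦ W ⟧ ⊆ ⟦ W₁ ⟧
      complete (Y , Y∈ , rw) with W⊆ Y∈
      ... | _ , (τ , refl) , X∈ = ⊆W₁ (A₀ [ τ ]q , (τ , refl) ,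
        proj₂ (step r) (_ , X∈ , subst (λ k → Rewrite c k (A₀ [ τ ]q ++ Y) _) (shifted τ) (Rewrite-++ (A₀ [ τ ]q) rw)))

      go : After A₀ ⟦ Q ⟧ W → Resolution K W W₁
      go (_ , (τ , refl) , σ , eq) = resolution (sound , complete)
        (At-++ʳ⁻ (A₀ [ τ ]q) (subst₂ (λ k X → At k X (chosen r [ σ ]ₐ)) (sym (shifted τ)) (sym eq) (At-subst σ (at r))))
        (Selectable-instance (chosen r) σ (select r))
        (shift (kind r))

    -- As all steps happen behind the prefix, one typed instance `A₀` of it, fixed at the start,
    -- stays possible throughout. Each query is restricted to it and then loses it.
    discard : ∀ m → (∀ {k k′ p} → K k p → K k′ p) →
      (s : Sequence K) → Inv (query s 0) → m ≤ length (query s 0) → (∀ i → m ≤ index (steps s i)) →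
      Σ (Sequence K) λ s′ → Inv (query s′ 0) × m + length (query s′ 0) ≡ length (query s 0)
    discard m shift s I m≤ ≥m with typed-prefix m (Inv.shape I) (⟦⟧-self (query s 0)) m≤
    ... | A₀ , Y₀ , Y₀∈ , refl , typed = build W
      where
      invs : ∀ i → Inv (query s i)
      invs zero    = I
      invs (suc i) = inv-step (invs i) (steps s i)

      k≡ : ∀ i → index (steps s i) ≡ length A₀ + (index (steps s i) ∸ length A₀)
      k≡ i = sym (m+[n∸m]≡n (≥m i))

      k< : ∀ i {Y} → ⟦ query s i ⟧ (A₀ ++ Y) → index (steps s i) ∸ length A₀ < length Y
      k< i {Y} Y∈ = +-cancelˡ-< (length A₀) _ (length Y)
        (subst₂ _<_ (k≡ i) (trans (sym (members-length {query s i} Y∈)) (length-++ A₀)) (At-< (at (steps s i))))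

      prefix-kept : ∀ i → ∃[ Y ] ⟦ query s i ⟧ (A₀ ++ Y)
      prefix-kept zero    = Y₀ , Y₀∈
      prefix-kept (suc i) = let Y , Y∈ = prefix-kept i in
        live-prefix (invs i) (steps s i) A₀ _ (k≡ i) (k< i Y∈) Y∈

      W : ∀ i → ∃[ W ] ⟦ W ⟧ ≐ After A₀ ⟦ query s i ⟧
      W i with prefix-kept i
      ... | Y , Y∈ with take-split (length A₀) (query s i)
                       (subst (length A₀ ≤_) (trans (sym (length-++ A₀)) (members-length {query s i} Y∈)) (m≤m+n _ _))
      ...   | M , R , eq , len =
        subst (λ Q → ∃[ W ] ⟦ W ⟧ ≐ After A₀ ⟦ Q ⟧) (sym eq)
          (after-principal A₀ M R len (A₀ , ⟦⟧-self A₀ , subst (λ Q → ⟦ Q ⟧ (A₀ ++ Y)) eq Y∈))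

      len : ∀ {Y} → After A₀ ⟦ query s 0 ⟧ Y → length A₀ + length Y ≡ length (query s 0)
      len {Y} (_ , (τ , refl) , Y∈) =
        trans (cong (_+ length Y) (sym (length-map (_[ τ ]ₐ) A₀)))
          (trans (sym (length-++ (A₀ [ τ ]q))) (members-length {query s 0} Y∈))

      build : (∀ i → ∃[ W ] ⟦ W ⟧ ≐ After A₀ ⟦ query s i ⟧) →
              Σ (Sequence K) λ s′ → Inv (query s′ 0) × length A₀ + length (query s′ 0) ≡ length (query s 0)
      build W = sequence (proj₁ ∘ W) (λ i → after-step shift A₀ (steps s i) (≥m i) (proj₂ (W i)) (proj₂ (W (suc i))))
              , Inv-after A₀ I typed (proj₂ (W 0)) , len (proj₁ (proj₂ (W 0)) (⟦⟧-self _))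

-- Accessibility, least witnesses and permuted lists.

module _ (em : ExcludedMiddle 0ℓ) {A : Set} {_⟶_ : A → A → Set} where
  -- An inaccessible element has an inaccessible successor. Excluded middle delivers it as a
  -- witness, and iteration gives the forbidden sequence.
  no-sequence⇒Acc : ∀ {x} → ¬ (Σ (ℕ → A) λ f → f 0 ≡ x × (∀ i → f i ⟶ f (suc i))) →
                    Acc (λ y x → x ⟶ y) x
  no-sequence⇒Acc {x} none with em {P = Acc (λ y x → x ⟶ y) x}
  ... | yes accessible = accessible
  ... | no  ¬acc       = ⊥-elim (none (proj₁ ∘ f , refl , λ i → proj₂ (next (f i))))
    where
    Bad : Set
    Bad = Σ A λ x → ¬ Acc (λ y x → x ⟶ y) x

    next : (b : Bad) → Σ Bad λ b′ → proj₁ b ⟶ proj₁ b′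
    next (x , ¬acc) with em {P = Σ Bad λ b′ → x ⟶ proj₁ b′}
    ... | yes found = found
    ... | no  none′ = ⊥-elim (¬acc (acc λ {y} x⟶y → good y x⟶y))
      where
      good : ∀ y → x ⟶ y → Acc (λ y x → x ⟶ y) y
      good y x⟶y with em {P = Acc (λ y x → x ⟶ y) y}
      ... | yes accessible = accessible
      ... | no  ¬acc′      = ⊥-elim (none′ ((y , ¬acc′) , x⟶y))

    f : ℕ → Bad
    f zero    = x , ¬acc
    f (suc i) = proj₁ (next (f i))

least : ∀ {P : ℕ → Set} → (∀ i → Dec (P i)) → ∀ {n} → P n → ∃[ i ] P i × (∀ {j} → j < i → ¬ P j)
least {P} dec {n} p = go n n p ≤-refl
  where
  go : ∀ b n → P n → n ≤ b → ∃[ i ] P i × (∀ {j} → j < i → ¬ P j)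
  go zero    n p z≤n = 0 , p , λ ()
  go (suc b) n p n≤ with anyUpTo? dec n
  ... | yes (m , m<n , q) = go b m q (≤-pred (≤-trans m<n n≤))
  ... | no  none          = n , p , λ {j} j<n q → none (j , j<n , q)

-- Argued on the indices, which are distinct even where elements of `xs` coincide.
permute-↭ : ∀ {A : Set} (xs : List A) (π : Permutation′ (length xs)) →
            tabulate (λ k → lookup xs (π ⟨$⟩ˡ k)) ↭ xs
permute-↭ xs π = subst₂ _↭_ (map-tabulate (π ⟨$⟩ˡ_) (lookup xs))
  (trans (map-tabulate (λ k → k) (lookup xs)) (tabulate-lookup xs))
  (Perm.map⁺ (lookup xs) (∼bag⇒↭ (unique∧set⇒bag
    (Uniq.tabulate⁺ λ {i} {j} eq → trans (sym (inverseʳ π)) (trans (cong (π ⟨$⟩ʳ_) eq) (inverseʳ π)))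
    (Uniq.allFin⁺ _)
    λ {i} → mk⇔ (λ _ → ∈-allFin i)
                (λ _ → subst (_∈ tabulate (π ⟨$⟩ˡ_)) (inverseˡ π) (∈-tabulate⁺ (π ⟨$⟩ʳ i))))))

concatMap-lookup-disjoint : ∀ {A B : Set} (f : A → List B) xs → Unique (concatMap f xs) →
  ∀ i j → i ≢ j → Disjoint (f (lookup xs i)) (f (lookup xs j))
concatMap-lookup-disjoint f (x ∷ xs) uniq Fin.zero    Fin.zero    i≢j = ⊥-elim (i≢j refl)
concatMap-lookup-disjoint f (x ∷ xs) uniq Fin.zero    (Fin.suc j) i≢j (z∈x , z∈) =
  proj₂ (proj₂ (Unique-++⁻ (f x) uniq)) (z∈x , ∈-concatMap⁺ f (lose (∈-lookup {xs = xs} j) z∈))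
concatMap-lookup-disjoint f (x ∷ xs) uniq (Fin.suc i) Fin.zero    i≢j (z∈ , z∈x) =
  proj₂ (proj₂ (Unique-++⁻ (f x) uniq)) (z∈x , ∈-concatMap⁺ f (lose (∈-lookup {xs = xs} i) z∈))
concatMap-lookup-disjoint f (x ∷ xs) uniq (Fin.suc i) (Fin.suc j) i≢j =
  concatMap-lookup-disjoint f xs (proj₁ (proj₂ (Unique-++⁻ (f x) uniq))) i j (i≢j ∘ cong Fin.suc)

concatMap-lookup-unique : ∀ {A B : Set} (f : A → List B) xs → Unique (concatMap f xs) →
  ∀ i → Unique (f (lookup xs i))
concatMap-lookup-unique f (x ∷ xs) uniq Fin.zero    = proj₁ (Unique-++⁻ (f x) uniq)
concatMap-lookup-unique f (x ∷ xs) uniq (Fin.suc i) =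
  concatMap-lookup-unique f xs (proj₁ (proj₂ (Unique-++⁻ (f x) uniq))) i

-- Robustly typed clauses and queries in the order of their permutations.

module Ordered (em : ExcludedMiddle 0ℓ) (L : Language) (P : LogicPrograms.Program L) where
  open Language L
  open FunctionSymbols functions
  open LogicPrograms L
  open Substitution functions
  open Instances L
  open Invariant em L
  open Persistence em L P

  vars-in-out : ∀ a {x} → x ∈ varsₐ a → x ∈ inVars a ⊎ x ∈ outVars a
  vars-in-out a x∈ with vars∈lookup (args a) x∈
  ... | i , x∈i with mode (pred a) i in e
  ...   | input  = inj₁ (∈-modeVars⁺ a i e x∈i)
  ...   | output = inj₂ (∈-modeVars⁺ a i e x∈i)

  module _ (Q : Query) (π : Permutation′ (length Q)) where
    permute-∈ : ∀ {b} → b ∈ permute Q π → ∃[ j ] b ≡ lookup Q j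
    permute-∈ b∈ = let k , eq = ∈-tabulate⁻ b∈ in π ⟨$⟩ˡ k , eq

    permute-∋ : ∀ j → lookup Q j ∈ permute Q π
    permute-∋ j = subst (λ i → lookup Q i ∈ permute Q π) (inverseˡ π) (∈-tabulate⁺ (π ⟨$⟩ʳ j))

    module _ (nm : NicelyModedQuery Q π) (shaped : ∀ j → Shaped P output (lookup Q j)) where
      permute-independent : AllPairs Independent (permute Q π)
      permute-independent = AllPairsP.tabulate⁺-< λ {k} {k′} k<k′ {x} (x∈ , x∈out) →
        let i = π ⟨$⟩ˡ k
            j = π ⟨$⟩ˡ k′
            i<j = subst₂ Fin._<_ (sym (inverseʳ π {k})) (sym (inverseʳ π {k′})) k<k′
        in case i j i<j (vars-in-out (lookup Q i) x∈) x∈out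
        where
        case : ∀ i j {x} → (π ⟨$⟩ʳ i) Fin.< (π ⟨$⟩ʳ j) →
               x ∈ inVars (lookup Q i) ⊎ x ∈ outVars (lookup Q i) → x ∈ outVars (lookup Q j) → ⊥
        case i j i<j (inj₁ x∈) x∈out = proj₂ nm i j (<⇒≤ i<j) (x∈ , x∈out)
        case i j i<j (inj₂ x∈) x∈out =
          concatMap-lookup-disjoint outVars Q (proj₁ nm) i j (λ { refl → <-irrefl refl i<j }) (x∈ , x∈out)

      permute-nice : All SelfNice (permute Q π)
      permute-nice = AllP.tabulate⁺ λ k → nice (π ⟨$⟩ˡ k)
        where
        nice : ∀ j → SelfNice (lookup Q j)
        nice j = record
          { out-unique = concatMap-lookup-unique outVars Q (proj₁ nm) j
          ; in-out     = proj₂ nm j j ≤-refl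
          ; out-flat   = flat }
          where
          flat : ∀ i → mode (pred (lookup Q j)) i ≡ output → Flat (arg (lookup Q j) i)
          flat i e with em {P = Bound P (pred (lookup Q j)) i}
          ... | yes bd = proj₁ (proj₂ (shaped j i e) bd)
          ... | no ¬bd = let x , eq = proj₁ (shaped j i e) ¬bd in subst Flat (sym eq) (flat-var x)

      permute-shaped : All (Shaped P output) (permute Q π)
      permute-shaped = AllP.tabulate⁺ λ k → shaped (π ⟨$⟩ˡ k)

  WT-tabulate : ∀ {n} (f : Fin n → Atom) τ R →
    (∀ k → (∀ k′ → k′ Fin.< k → Typed output (f k′ [ τ ]ₐ)) → Typed input (f k [ τ ]ₐ)) →
    ((∀ k → Typed output (f k [ τ ]ₐ)) → WT R) →
    WT (tabulate f [ τ ]q ++ R)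
  WT-tabulate {zero}  f τ R ins rest = rest λ ()
  WT-tabulate {suc n} f τ R ins rest =
    ins Fin.zero (λ _ ())
    , λ out → WT-tabulate (f ∘ Fin.suc) τ R
        (λ k before → ins (Fin.suc k) λ where
           Fin.zero     _        → out
           (Fin.suc k′) (s≤s lt) → before k′ lt)
        (λ outs → rest λ where
           Fin.zero    → out
           (Fin.suc k) → outs k)

  WT-permute : ∀ B (π : Permutation′ (length B)) τ R →
    (∀ i → (∀ j → (π ⟨$⟩ʳ j) Fin.< (π ⟨$⟩ʳ i) → Typed output (lookup B j [ τ ]ₐ)) →
           Typed input (lookup B i [ τ ]ₐ)) →
    ((∀ j → Typed output (lookup B j [ τ ]ₐ)) → WT R) →
    WT (permute B π [ τ ]q ++ R)
  WT-permute B π τ R ins rest = WT-tabulate (λ k → lookup B (π ⟨$⟩ˡ k)) τ R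
    (λ k before → ins (π ⟨$⟩ˡ k) λ j lt →
       subst (λ j → Typed output (lookup B j [ τ ]ₐ)) (inverseˡ π)
         (before (π ⟨$⟩ʳ j) (subst ((π ⟨$⟩ʳ j) Fin.<_) (inverseʳ π) lt)))
    (λ outs → rest λ j →
       subst (λ j → Typed output (lookup B j [ τ ]ₐ)) (inverseˡ π) (outs (π ⟨$⟩ʳ j)))

  orderedClause : (c : Clause) → Permutation′ (length (body c)) → Clause
  orderedClause c π = head c ⟵ permute (body c) π

  good-clause : ∀ c π → c ∈ clauses P → RobustlyTypedClause P c π → InputLinearClause c →
                GoodClause (orderedClause c π)
  good-clause c@(h ⟵ B) π c∈ ((nm , head-out) , (ins , outs) , head-shaped , body-shaped , out-vars) linear = record
    { in-unique   = linear
    ; in-flat     = in-flat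
    ; in-bound    = λ i e ¬v → inj₁ (e , c , c∈ , args h , refl , ¬v)
    ; out-var     = out-var
    ; head-body   = λ b∈ → let j , eq = permute-∈ B π b∈ in subst (λ b → Disjoint (inVars h) (outVars b)) (sym eq) (head-out j)
    ; independent = permute-independent B π nm body-shaped
    ; nice        = permute-nice B π nm body-shaped
    ; shaped      = permute-shaped B π nm body-shaped
    ; well-typed  = λ τ R (in-h , out-h) → WT-permute B π τ R
        (λ i before → ins i τ in-h before) (λ all → out-h (outs τ in-h all)) }
    where
    in-flat : ∀ i → mode (pred h) i ≡ input → Flat (arg h i)
    in-flat i e with em {P = Bound P (pred h) i}
    ... | yes bd = proj₁ (proj₂ (head-shaped i e) bd)
    ... | no ¬bd = let x , eq = proj₁ (head-shaped i e) ¬bd in subst Flat (sym eq) (flat-var x)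

    out-var : ∀ i x → mode (pred h) i ≡ output → Bound P (pred h) i → arg h i ≡ var x →
      FillsBound P input (type (pred h) i) x h
      ⊎ (∃[ b ] b ∈ permute B π × FillsBound P output (type (pred h) i) x b)
    out-var i x e bd eq with out-vars i x e bd eq
    ... | inj₁ fb       = inj₁ fb
    ... | inj₂ (j , fb) = inj₂ (lookup B j , permute-∋ B π j , fb)

  module _ (isel : InputSelectability P) {n} (oc : Fin n → Clause) (good : ∀ j → GoodClause (oc j)) where
    open Sequences em L P isel oc good

    initial-inv : ∀ Q π → RobustlyTypedQuery P Q π → Inv (permute Q π)
    initial-inv Q π (nm , ins , shaped) = inv
      (record
        { ext     = Ext-≐ (map (atomSlot tops) Q′ ++ [])
            ( (λ { (τ , _ , refl , refl) → τ , ++-identityʳ _ })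
            , λ { (τ , refl) → τ , [] , sym (++-identityʳ _) , refl } )
            -- A query has no surroundings, so `Φ` only says that nothing follows.
            (body-ext tops (λ top → top) [] Q′ (λ _ R → R ≡ [])
              (permute-independent Q π nm shaped) (permute-nice Q π nm shaped)
              (λ _ R≡ _ _ → [] , refl) (λ _ → tt))
        ; fitting = λ { (τ , refl) → subst (λ sl → Pointwise Fits sl (Q′ [ τ ]q)) (sym (++-identityʳ _)) (all-fit τ Q′) }
        ; ok      = AllP.++⁺ (AllP.map⁺ (All.map (λ {b} → slot-ok b) (permute-shaped Q π nm shaped))) [] })
      λ { (τ , refl) → subst WT (++-identityʳ _) (WT-permute Q π τ [] (λ i before → ins i τ before) (λ _ → tt)) }
      where
      Q′ : Query
      Q′ = permute Q π

      tops : ∀ b → Fin (arity (pred b)) → Fun → Set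
      tops b i f = Top f (arg b i)

      all-fit : ∀ τ X → Pointwise Fits (map (atomSlot tops) X) (X [ τ ]q)
      all-fit τ []      = []
      all-fit τ (x ∷ X) =
        fits _ (λ i f e top → subst (Top f) (sym (arg-subst (args x) i)) (Top-subst (arg x i) top)) ∷ all-fit τ X

      slot-ok : ∀ b → Shaped P output b → SlotOK (atomSlot tops b)
      slot-ok b sh i f e top with em {P = Bound P (pred b) i}
      ... | no ¬bd = ⊥-elim (Top⇒¬IsVar top (proj₁ (sh i e) ¬bd))
      ... | yes bd = let σ , has = proj₂ (proj₂ (sh i e) bd)
                     in bd , arg b i [ σ ]ₜ , Top-subst (arg b i) top , has

-- Finiteness of sequences selecting only first or robust atoms.

module Termination (em : ExcludedMiddle 0ℓ) (L : Language) (P : LogicPrograms.Program L)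
                   (πs : LogicPrograms.BodyPermutations L P) (wf : LogicPrograms.WellFedProgram L P πs) where
  open Language L
  open LogicPrograms L
  open Substitution functions
  open Instances L
  open Invariant em L
  open Persistence em L P
  open GenericAtoms em L P
  open Ordered em L P

  isel : InputSelectability P
  isel = proj₂ (proj₂ (proj₂ wf))

  textual : Fin (length (clauses P)) → Clause
  textual = lookup (clauses P)

  oc : Fin (length (clauses P)) → Clause
  oc j = orderedClause (textual j) (πs j)

  good : ∀ j → GoodClause (oc j)
  good j = good-clause (textual j) (πs j) (∈-lookup j) (proj₁ (proj₁ (proj₂ wf) j))
             (All.lookup (proj₁ (proj₂ (proj₂ wf))) (∈-lookup j))

  open Sequences em L P isel oc good
  open Sequence

  HereditarilyRobust : Pred → Set
  HereditarilyRobust p = ∀ q → DependsOn P p q → Robust P q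

  RobustOnly FirstOrRobust : ℕ → Pred → Set
  RobustOnly    k p = HereditarilyRobust p
  FirstOrRobust k p = k ≡ 0 ⊎ HereditarilyRobust p

  DelayStep : Query → Query → Set
  DelayStep X X₁ = Σ (Step P X X₁) λ s → Selectable P (selected s)

  vars-↭ : ∀ {Q R} → Q ↭ R → ∀ {x} → x ∈ varsQ Q → x ∈ varsQ R
  vars-↭ {Q} Q↭R x∈ = ∈-concatMap⁺ varsₐ (Perm.Any-resp-↭ Q↭R (∈-concatMap⁻ varsₐ {xs = Q} x∈))

  Post-≐ : ∀ {c k S T} → S ≐ T → Post c k S ≐ Post c k T
  Post-≐ (S⊆T , T⊆S) = Post-mono S⊆T , Post-mono T⊆S

  ⟦⟧-⊆ : ∀ {Q R} → ⟦ R ⟧ Q → ⟦ Q ⟧ ⊆ ⟦ R ⟧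
  ⟦⟧-⊆ {R = R} (σ , refl) (δ , refl) = σ ⊙ δ , ⊙-query σ δ R

  -- Three views of one query: `A` matters only through its instances, `A^` is a concrete query with
  -- the same instances, and `X`, a permutation of `A^`, is what `P` derives with its bodies in
  -- textual order.
  delay-step : ∀ {X A A₁} (r : Resolution RobustOnly A A₁) → ∀ A^ → X ↭ A^ → ⟦ A^ ⟧ ≐ ⟦ A ⟧ →
    ∃[ X₁ ] ∃[ A₁^ ] DelayStep X X₁ × X₁ ↭ A₁^ × ⟦ A₁^ ⟧ ≐ ⟦ A₁ ⟧
  delay-step {X} {A} {A₁} r A^ X↭A^ A^≐A with proj₂ (Post-≐ A^≐A) (proj₁ (step r) (⟦⟧-self A₁))
  ... | X₀ , X₀∈ , rw with Rewrite-At rw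
  ... | τ , atX₀ with ∈⟦⟧-At X₀∈ atX₀
  ... | b , σ , atb , unif with At-split atb | ∈⟦⟧-At (proj₁ A^≐A (⟦⟧-self A^)) atb
  ... | L′ , R′ , refl , lenL | b₀ , δ , atb₀ , b≡ with ∈-∃++ (Perm.∈-resp-↭ (↭-sym X↭A^) (∈-insert L′))
  ... | M , R , refl with real-step M b R (textual (number r)) {σ} {τ} (∈-lookup (number r)) (sym unif)
  ... | X₁ , s , left≡ , sel≡ , clause≡ , X₁≡ =
    X₁ , A₁^
    , (s , subst (Selectable P) (sym (trans sel≡ (trans b≡ (cong (_[ δ ]ₐ) (At-functional atb₀ (at r))))))
             (Selectable-instance (chosen r) δ (select r)))
    , subst (_↭ A₁^) (sym X₁≡) (Perm.map⁺ (_[ mgu s ]ₐ) reorder)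
    , ≐-trans (subst (λ k → _ -[ oc (number r) , k ]→ A₁^) lenL semantics)
        (≐-trans (Post-≐ A^≐A) (≐-sym (step r)))
    where
    B : Query
    B = body (textual (number r))

    B′ : Query
    B′ = permute B (πs (number r))

    ρ : Subst
    ρ = var ∘ rename s

    A₁^ : Query
    A₁^ = (L′ ++ B′ [ ρ ]q ++ R′) [ mgu s ]q

    semantics : L′ ++ b ∷ R′ -[ oc (number r) , length L′ ]→ A₁^
    semantics = step-semantics em s sel≡ clause≡ L′ R′ B′ (vars-↭ (↭-sym X↭A^)) (vars-↭ (permute-↭ B (πs (number r))))

    reorder : M ++ B [ ρ ]q ++ R ↭ L′ ++ B′ [ ρ ]q ++ R′
    reorder = ↭-trans (Perm.shifts M (B [ ρ ]q))
      (↭-trans (Perm.++⁺ (Perm.map⁺ (_[ ρ ]ₐ) (↭-sym (permute-↭ B (πs (number r))))) (Perm.drop-mid M L′ X↭A^))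
        (↭-sym (Perm.shifts L′ (B′ [ ρ ]q))))

  Rewrite-prefix : ∀ {c k W} X {Y} → Rewrite c k (X ++ Y) W → k < length X →
                   ∃[ V ] W ≡ V ++ Y × Rewrite c k X V
  Rewrite-prefix {c} (_ ∷ X) {Y} (here τ _) lt = _ , sym (++-assoc (body c [ τ ]q) X Y) , here τ X
  Rewrite-prefix (x ∷ X) (there _ rw) (s≤s lt) with Rewrite-prefix X rw lt
  ... | V , refl , rw′ = x ∷ V , refl , there x rw′

  Rewrite-suffix : ∀ {c k X V} Y → Rewrite c k X V → Rewrite c k (X ++ Y) (V ++ Y)
  Rewrite-suffix {c} Y (here τ R) = subst (Rewrite c 0 _) (sym (++-assoc (body c [ τ ]q) R Y)) (here τ (R ++ Y))
  Rewrite-suffix Y (there x rw) = there x (Rewrite-suffix Y rw)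

  Rewrite-length : ∀ {c k X V X′ V′} → Rewrite c k X V → Rewrite c k X′ V′ → length X ≡ length X′ → length V ≡ length V′
  Rewrite-length {c} (here τ R) (here τ′ R′) eq =
    trans (length-++ (body c [ τ ]q))
      (trans (cong₂ _+_ (trans (length-map (_[ τ ]ₐ) (body c)) (sym (length-map (_[ τ′ ]ₐ) (body c)))) (suc-injective eq))
        (sym (length-++ (body c [ τ′ ]q))))
  Rewrite-length (there _ rw) (there _ rw′) eq = cong suc (Rewrite-length rw rw′ (suc-injective eq))

  -- A step inside `A` does not look at `Z` and changes it by instantiation only; so it is a step of
  -- `A` alone, as robustness of a single atom requires.
  prefix-step : ∀ {Q₁} A Z (r : Resolution RobustOnly (A ++ Z) Q₁) → index r < length A →
    ∃[ A₁ ] ∃[ Z₁ ] Q₁ ≡ A₁ ++ Z₁ × length Z₁ ≡ length Z × Resolution RobustOnly A A₁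
  prefix-step {Q₁} A Z r lt with proj₁ (step r) (⟦⟧-self Q₁)
  ... | _ , (σ , refl) , rw with Rewrite-prefix (A [ σ ]q)
          (subst (λ X → Rewrite (oc (number r)) (index r) X Q₁) (map-++ (_[ σ ]ₐ) A Z) rw)
          (≤-trans lt (≤-reflexive (sym (length-map (_[ σ ]ₐ) A))))
  ... | A₁ , refl , rwA = A₁ , Z [ σ ]q , refl , length-map (_[ σ ]ₐ) Z
    , resolution (sound , complete) (At-prefix A (at r) lt) (select r) (kind r)
    where
    c : Clause
    c = oc (number r)

    same-length : ∀ {σ′ V} → Rewrite c (index r) (A [ σ′ ]q) V → ∀ δ → length V ≡ length (A₁ [ δ ]q)
    same-length {σ′} rw′ δ = trans (Rewrite-length rw′ rwA (trans (length-map (_[ σ′ ]ₐ) A) (sym (length-map (_[ σ ]ₐ) A))))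
                                   (sym (length-map (_[ δ ]ₐ) A₁))

    At-prefix : ∀ {k a} A {Z} → At k (A ++ Z) a → k < length A → At k A a
    At-prefix (_ ∷ A) here       _        = here
    At-prefix (_ ∷ A) (there at) (s≤s lt) = there (At-prefix A at lt)

    sound : ⟦ A₁ ⟧ ⊆ Post c (index r) ⟦ A ⟧
    sound (δ , refl) with proj₁ (step r) (δ , sym (map-++ (_[ δ ]ₐ) A₁ (Z [ σ ]q)))
    ... | _ , (σ′ , refl) , rw′ with Rewrite-prefix (A [ σ′ ]q)
          (subst (λ X → Rewrite c (index r) X (A₁ [ δ ]q ++ Z [ σ ]q [ δ ]q)) (map-++ (_[ σ′ ]ₐ) A Z) rw′)
          (≤-trans lt (≤-reflexive (sym (length-map (_[ σ′ ]ₐ) A))))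
    ... | V , eq , rwV =
      A [ σ′ ]q , (σ′ , refl)
      , subst (Rewrite c (index r) (A [ σ′ ]q))
          (sym (proj₁ (++-split-length (A₁ [ δ ]q) V (sym (same-length rwV δ)) eq))) rwV

    complete : Post c (index r) ⟦ A ⟧ ⊆ ⟦ A₁ ⟧
    complete {V} (_ , (σ′ , refl) , rwV) with proj₂ (step r)
      (_ , (σ′ , refl) , subst (λ X → Rewrite c (index r) X (V ++ Z [ σ′ ]q)) (sym (map-++ (_[ σ′ ]ₐ) A Z))
        (Rewrite-suffix (Z [ σ′ ]q) rwV))
    ... | δ , eq = δ , proj₁ (++-split-length V (A₁ [ δ ]q) (same-length rwV δ)
                              (trans eq (map-++ (_[ δ ]ₐ) A₁ (Z [ σ ]q))))

  pull-first : ∀ {K} m → (∀ {k k′ p} → m ≤ k → K k p → K k′ p) → (s : Sequence K) → Inv (query s 0) →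
    (∀ i → m ≤ index (steps s i))
    ⊎ (Σ (Sequence K) λ s′ → Σ (Resolution K (query s 0) (query s′ 0)) λ r → index r < m)
  pull-first m shift s I with em {P = ∃[ i ] index (steps s i) < m}
  ... | no none = inj₁ λ i → ≮⇒≥ λ lt → none (i , lt)
  ... | yes (i , lt) with least (λ i → index (steps s i) <? m) {i} lt
  ...   | i₀ , lt₀ , before = inj₂ (pull m shift i₀ s I (≮⇒≥ ∘ before) lt₀)

  block-step : ∀ {X A^ A Z Q Q₁} → X ↭ A^ → ⟦ A^ ⟧ ≐ ⟦ A ⟧ → Q ≡ A ++ Z →
    (r : Resolution RobustOnly Q Q₁) → index r < length A →
    ∃[ X₁ ] ∃[ A₁^ ] ∃[ A₁ ] ∃[ Z₁ ]
      DelayStep X X₁ × X₁ ↭ A₁^ × ⟦ A₁^ ⟧ ≐ ⟦ A₁ ⟧ × Q₁ ≡ A₁ ++ Z₁ × length Z₁ ≡ length Z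
  block-step {A^ = A^} {A} {Z} X↭A^ A^≐A refl r lt with prefix-step A Z r lt
  ... | A₁ , Z₁ , eq₁ , lenZ , rA with delay-step rA A^ X↭A^ A^≐A
  ...   | X₁ , A₁^ , st , X₁↭ , A₁^≐ = X₁ , A₁^ , A₁ , Z₁ , st , X₁↭ , A₁^≐ , eq₁ , lenZ

  robust-atom-Acc : ∀ p us → Robust P p → RobustlyTypedQuery P (atom p us ∷ []) id →
                    Acc (λ X₁ X → DelayStep X X₁) (atom p us ∷ [])
  robust-atom-Acc p us (_ , _ , _ , finite) rt = no-sequence⇒Acc em {_⟶_ = DelayStep} λ (f , start , st) →
    finite us rt (record { query = f ; start = start ; step = proj₁ ∘ st } , proj₂ ∘ st)

  generic-robustly-typed : ∀ {s ts us} → SlotOK s → Generic s ts us → Typed input (atom (slotPred s) ts) →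
                           RobustlyTypedQuery P (atom (slotPred s) us ∷ []) id
  generic-robustly-typed {s} {ts} {us} ok gen typed-ts =
    ( subst Unique (sym (++-identityʳ _)) (SelfNice.out-unique self)
    , λ { Fin.zero Fin.zero _ → SelfNice.in-out self })
    , (λ { Fin.zero σ _ → Typed-subst {a = atom (slotPred s) us} σ typed })
    , λ { Fin.zero → generic-shaped ok gen }
    where
    open Generic gen
    typed : Typed input (atom (slotPred s) us)
    typed i e = subst (Has (type (slotPred s) i)) (same i e) (typed-ts i e)

  -- The first atom has typed inputs, so the generic atom with these inputs is robustly typed. It
  -- has the same instances as `a`: it is an instance of `a` by `Ext`, and conversely by genericity.
  representative : ∀ {a Z} → Inv (a ∷ Z) →
    ∃[ us ] RobustlyTypedQuery P (atom (pred a) us ∷ []) id × ⟦ atom (pred a) us ∷ [] ⟧ ≐ ⟦ a ∷ [] ⟧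
  representative {a} {Z} (inv {[]} sh wt) with () ← Shape.fitting sh (⟦⟧-self (a ∷ Z))
  representative {a} {Z} (inv {s ∷ _} sh wt) =
    fitted (PW.head (Shape.fitting sh (⟦⟧-self (a ∷ Z)))) sh (proj₁ (wt (⟦⟧-self (a ∷ Z))))
    where
    fitted : ∀ {s sl a} → Fits s a → Shape (s ∷ sl) ⟦ a ∷ Z ⟧ → Typed input a →
      ∃[ us ] RobustlyTypedQuery P (atom (pred a) us ∷ []) id × ⟦ atom (pred a) us ∷ [] ⟧ ≐ ⟦ a ∷ [] ⟧
    fitted {s} (fits ts m) sh typed with generic s ts m
    ... | us , gen
      with proj₁ (Shape.ext sh) (⟦⟧-self (atom (slotPred s) ts ∷ Z)) (Generic.meeting gen) (Generic.same gen)
         | generic-general {vs = ts} gen (λ _ _ → refl) m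
    ...   | _ , σ , us≡ | δ , ts≡ =
      us , generic-robustly-typed (All.head (Shape.ok sh)) gen typed
      , ⟦⟧-⊆ (σ , cong (_∷ []) (proj₁ (∷-injective us≡)))
      , ⟦⟧-⊆ (δ , cong (_∷ []) (sym ts≡))

  module _ {N} (shorter : ∀ (s : Sequence RobustOnly) → Inv (query s 0) → length (query s 0) ≤ N → ⊥) where
    drop-prefix : ∀ {A Z} (s : Sequence RobustOnly) → Inv (query s 0) → query s 0 ≡ A ++ Z → length Z ≤ N →
                  ¬ (∀ i → length A ≤ index (steps s i))
    drop-prefix {A} {Z} s I eq Z≤ ≥A
      with discard (length A) (λ h → h) s I
             (subst (length A ≤_) (sym (trans (cong length eq) (length-++ A))) (m≤m+n _ _)) ≥A
    ... | s′ , I′ , len = shorter s′ I′ (subst (_≤ N) (sym (+-cancelˡ-≡ (length A) _ _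
                            (trans len (trans (cong length eq) (length-++ A))))) Z≤)

    -- `A` holds the descendants of the first atom and `Z` the rest, whose length is not changed by
    -- steps inside `A`. `X` is what the robust atom has derived on its own.
    robust-block : ∀ {X} → Acc (λ X₁ X → DelayStep X X₁) X → ∀ {A^ A Z} → X ↭ A^ → ⟦ A^ ⟧ ≐ ⟦ A ⟧ →
      (s : Sequence RobustOnly) → Inv (query s 0) → query s 0 ≡ A ++ Z → length Z ≤ N → ⊥
    robust-block (acc rs) {A^} {A} {Z} X↭A^ A^≐A s I eq Z≤ with pull-first (length A) (λ _ h → h) s I
    ... | inj₁ none          = drop-prefix {A} {Z} s I eq Z≤ none
    ... | inj₂ (s′ , r , r<) with block-step X↭A^ A^≐A eq r r<
    ...   | X₁ , A₁^ , A₁ , Z₁ , st , X₁↭ , A₁^≐ , eq₁ , lenZ =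
      robust-block (rs st) X₁↭ A₁^≐ s′ (inv-step I r) eq₁ (≤-trans (≤-reflexive lenZ) Z≤)

    robust-first : ∀ {a Z} (s : Sequence RobustOnly) → Inv (query s 0) → query s 0 ≡ a ∷ Z →
                   length Z ≤ N → HereditarilyRobust (pred a) → ⊥
    robust-first {a} {Z} s I eq Z≤ hr with representative (subst Inv eq I)
    ... | us , rt , us≐a =
      robust-block (robust-atom-Acc (pred a) us (hr (pred a) ε) rt) ↭-refl us≐a s I eq Z≤

    -- If index 0 were ever selected, pulling that step to the front would make it select `a`
    -- itself. So `a` can be discarded at once.
    other-first : ∀ {a Z} (s : Sequence RobustOnly) → Inv (query s 0) → query s 0 ≡ a ∷ Z →
                  length Z ≤ N → ¬ HereditarilyRobust (pred a) → ⊥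
    other-first {a} {Z} s I eq Z≤ ¬hr with pull-first 1 (λ _ h → h) s I
    ... | inj₁ none          = drop-prefix {a ∷ []} {Z} s I eq Z≤ none
    ... | inj₂ (s′ , r , r<) = ¬hr (chosen-first eq r (n<1⇒n≡0 r<))
      where
      chosen-first : ∀ {a Z Q Q₁} → Q ≡ a ∷ Z → (r : Resolution RobustOnly Q Q₁) → index r ≡ 0 →
                     HereditarilyRobust (pred a)
      chosen-first refl r eq with At-functional (subst (λ k → At k _ (chosen r)) eq (at r)) here
      ... | refl = kind r

  no-empty : ∀ {K Q Q₁} → Q ≡ [] → ¬ Resolution K Q Q₁
  no-empty refl r with () ← at r

  robust-finite : ∀ N (s : Sequence RobustOnly) → Inv (query s 0) → length (query s 0) ≤ N → ⊥
  robust-finite N s I le with query s 0 in eq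
  robust-finite N       s I le       | []    = no-empty eq (steps s 0)
  robust-finite (suc N) s I (s≤s le) | a ∷ Z with em {P = HereditarilyRobust (pred a)}
  ... | yes hr = robust-first (robust-finite N) s (subst Inv (sym eq) I) eq le hr
  ... | no ¬hr = other-first (robust-finite N) s (subst Inv (sym eq) I) eq le ¬hr

  P′ : Program
  P′ = permuteProgram P πs

  LDStep : Query → Query → Set
  LDStep Q Q₁ = Σ (Step P′ Q Q₁) λ s → left s ≡ []

  -- The clauses of `P′` are those of `oc`, so the textual order is already the right one.
  ld-step : ∀ {K Q Q₁} (r : Resolution K Q Q₁) → index r ≡ 0 → ∀ Q^ → ⟦ Q^ ⟧ ≐ ⟦ Q ⟧ →
            ∃[ Q₁^ ] LDStep Q^ Q₁^ × ⟦ Q₁^ ⟧ ≐ ⟦ Q₁ ⟧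
  ld-step {Q₁ = Q₁} r k≡0 Q^ Q^≐Q
    with proj₂ (Post-≐ Q^≐Q) (subst (λ k → Post (oc (number r)) k _ Q₁) k≡0 (proj₁ (step r) (⟦⟧-self Q₁)))
  ... | X₀ , X₀∈ , rw with Rewrite-At rw
  ... | τ , atX₀ with ∈⟦⟧-At X₀∈ atX₀
  ... | b , σ , here {xs = Z} , unif
    with real-step {P = P′} [] b Z (oc (number r)) {σ} {τ} (∈-tabulate⁺ (number r)) (sym unif)
  ... | X₁ , s , left≡ , sel≡ , clause≡ , X₁≡ =
    X₁ , (s , left≡)
    , subst (λ X₁ → ⟦ X₁ ⟧ ≐ _) (sym X₁≡)
        (≐-trans (step-semantics em s sel≡ clause≡ [] Z (body (oc (number r))) (λ x∈ → x∈) (λ x∈ → x∈))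
          (≐-trans (Post-≐ Q^≐Q) (≐-sym (subst (λ k → _ -[ oc (number r) , k ]→ Q₁) k≡0 (step r)))))

  first-or-robust-finite : ∀ {Q} → Acc (λ Q₁ Q → LDStep Q Q₁) Q →
    (s : Sequence FirstOrRobust) → Inv (query s 0) → ⟦ Q ⟧ ≐ ⟦ query s 0 ⟧ → ⊥
  first-or-robust-finite {Q} (acc rs) s I Q≐ with pull-first 1 shift s I
    where
    -- Behind the first atom only robustness justifies a selection, and it does not depend on the
    -- index.
    shift : ∀ {k k′ p} → 1 ≤ k → FirstOrRobust k p → FirstOrRobust k′ p
    shift ()  (inj₁ refl)
    shift 1≤k (inj₂ hr) = inj₂ hr
  ... | inj₁ none = robust-finite _ (sequence (query s) λ i → robust (steps s i) (none i)) I ≤-refl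
    where
    robust : ∀ {Q Q₁} (r : Resolution FirstOrRobust Q Q₁) → 1 ≤ index r → Resolution RobustOnly Q Q₁
    robust (resolution st at sel (inj₁ refl)) ()
    robust (resolution st at sel (inj₂ hr))   _ = resolution st at sel hr
  ... | inj₂ (s′ , r , r<) with ld-step r (n<1⇒n≡0 r<) Q Q≐
  ...   | Q₁ , st , Q₁≐ = first-or-robust-finite (rs st) s′ (inv-step I r) Q₁≐

-- Left-based derivations and textual positions.

AllPairs-++⁻ : ∀ {A : Set} {R : A → A → Set} xs {ys} → AllPairs R (xs ++ ys) →
               AllPairs R xs × AllPairs R ys × All (λ x → All (R x) ys) xs
AllPairs-++⁻ []       rs         = [] , rs , []
AllPairs-++⁻ (x ∷ xs) (r ∷ rs) =
  let rxs , rys , cross = AllPairs-++⁻ xs rs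
  in AllP.++⁻ˡ xs r ∷ rxs , rys , AllP.++⁻ʳ xs r ∷ cross

module LeftBased (em : ExcludedMiddle 0ℓ) (L : Language) (P : LogicPrograms.Program L)
                 (πs : LogicPrograms.BodyPermutations L P) (wf : LogicPrograms.WellFedProgram L P πs) where
  open Language L
  open LogicPrograms L
  open Substitution functions
  open Instances L
  open Invariant em L
  open Ordered em L P
  open Termination em L P πs wf
  open Sequences em L P isel oc good

  Entry : Set
  Entry = ℕ × Atom

  -- The form in which well-fedness survives resolution: what comes earlier in the order stands
  -- further left, unless the later atom is hereditarily robust.
  Precedes : Entry → Entry → Set
  Precedes (i , _) (j , b) = i ≢ j × (HereditarilyRobust (pred b) ⊎ i < j)

  -- The atoms of a query in the order of its permutation, with their textual positions.
  record State (Q : Query) : Set₁ where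
    field
      entries  : List Entry
    ordered : Query
    ordered = map proj₂ entries
    field
      invariant : Inv ordered
      sound     : ∀ {i a} → (i , a) ∈ entries → At i Q a
      covering  : ∀ {i a} → At i Q a → (i , a) ∈ entries
      sorted    : AllPairs Precedes entries
  open State

  At-lookup : ∀ (Q : Query) j → At (toℕ j) Q (lookup Q j)
  At-lookup (_ ∷ Q) Fin.zero    = here
  At-lookup (_ ∷ Q) (Fin.suc j) = there (At-lookup Q j)

  At-index : ∀ {i} {Q : Query} {a} → At i Q a → ∃[ j ] toℕ j ≡ i × lookup Q j ≡ a
  At-index here       = Fin.zero , refl , refl
  At-index (there at) = let j , e , e′ = At-index at in Fin.suc j , cong suc e , e′

  At-∈ : ∀ {i} {Q : Query} {a} → At i Q a → a ∈ Q
  At-∈ here       = here refl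
  At-∈ (there at) = there (At-∈ at)

  At-subst⁻ : ∀ {i} Q {σ b} → At i (Q [ σ ]q) b → ∃[ a ] At i Q a × b ≡ a [ σ ]ₐ
  At-subst⁻ (a ∷ Q) here       = a , here , refl
  At-subst⁻ (_ ∷ Q) (there at) = let a , at′ , eq = At-subst⁻ Q at in a , there at′ , eq

  At-++⁻ : ∀ {i} (X : Query) {Y a} → At i (X ++ Y) a →
           (i < length X × At i X a) ⊎ (∃[ d ] i ≡ length X + d × At d Y a)
  At-++⁻ []      at         = inj₂ (_ , refl , at)
  At-++⁻ (_ ∷ X) here       = inj₁ (s≤s z≤n , here)
  At-++⁻ (_ ∷ X) (there at) with At-++⁻ X at
  ... | inj₁ (lt , at′)       = inj₁ (s≤s lt , there at′)
  ... | inj₂ (d , refl , at′) = inj₂ (d , refl , at′)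

  module _ (B : Query) (π : Permutation′ (length B)) (safe : SafeOrRobust P B π) (offset : ℕ) (θ : Subst) where
    bodyEntries : List Entry
    bodyEntries = tabulate λ k → offset + toℕ (π ⟨$⟩ˡ k) , lookup B (π ⟨$⟩ˡ k) [ θ ]ₐ

    bodyEntries-ordered : map proj₂ bodyEntries ≡ permute B π [ θ ]q
    bodyEntries-ordered = trans (map-tabulate _ proj₂) (sym (map-tabulate _ (_[ θ ]ₐ)))

    bodyEntries-sound : ∀ {i a} → (i , a) ∈ bodyEntries → ∃[ j ] i ≡ offset + toℕ j × a ≡ lookup B j [ θ ]ₐ
    bodyEntries-sound e∈ with ∈-tabulate⁻ e∈
    ... | k , refl = π ⟨$⟩ˡ k , refl , refl

    bodyEntries-covering : ∀ j → (offset + toℕ j , lookup B j [ θ ]ₐ) ∈ bodyEntries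
    bodyEntries-covering j =
      subst (λ i → (offset + toℕ i , lookup B i [ θ ]ₐ) ∈ bodyEntries) (inverseˡ π) (∈-tabulate⁺ (π ⟨$⟩ʳ j))

    bodyEntries-sorted : AllPairs Precedes bodyEntries
    bodyEntries-sorted = AllPairsP.tabulate⁺-< λ {k} {k′} k<k′ →
      precedes (π ⟨$⟩ˡ k) (π ⟨$⟩ˡ k′) (subst₂ Fin._<_ (sym (inverseʳ π {k})) (sym (inverseʳ π {k′})) k<k′)
      where
      precedes : ∀ i j → (π ⟨$⟩ʳ i) Fin.< (π ⟨$⟩ʳ j) →
                 Precedes (offset + toℕ i , lookup B i [ θ ]ₐ) (offset + toℕ j , lookup B j [ θ ]ₐ)
      precedes i j lt =
        (λ eq → <-irrefl (cong (toℕ ∘ (π ⟨$⟩ʳ_)) (FinP.toℕ-injective (+-cancelˡ-≡ offset _ _ eq))) lt)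
        , by (safe j)
        where
        by : Safe π j ⊎ HereditarilyRobust (pred (lookup B j)) →
             HereditarilyRobust (pred (lookup B j)) ⊎ offset + toℕ i < offset + toℕ j
        by (inj₁ sf) = inj₂ (+-monoʳ-< offset (sf i lt))
        by (inj₂ hr) = inj₁ hr

  initial : ∀ Q π → RobustlyTypedQuery P Q π → SafeOrRobust P Q π → State Q
  initial Q π rt safe = record
    { entries   = bodyEntries Q π safe 0 var
    ; invariant = subst Inv (sym (initial-ordered Q π safe)) (initial-inv isel oc good Q π rt)
    ; sound     = λ e∈ → let j , i≡ , a≡ = bodyEntries-sound Q π safe 0 var e∈ in
        subst₂ (λ i a → At i Q a) (sym i≡) (sym (trans a≡ (var-atom _))) (At-lookup Q j)
    ; covering  = λ at → let j , i≡ , a≡ = At-index at in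
        subst₂ (λ i a → (i , a) ∈ bodyEntries Q π safe 0 var) i≡ (trans (var-atom _) a≡) (bodyEntries-covering Q π safe 0 var j)
    ; sorted    = bodyEntries-sorted Q π safe 0 var }
    where
    var-atom : ∀ a → a [ var ]ₐ ≡ a
    var-atom a = cong (atom (pred a)) (var-terms (args a))

    initial-ordered : ∀ Q π safe → map proj₂ (bodyEntries Q π safe 0 var) ≡ permute Q π
    initial-ordered Q π safe = trans (bodyEntries-ordered Q π safe 0 var) (var-query _)

  module Advance {Q Q₁} (S : State Q) (s : Step P Q Q₁) where
    pos : ℕ
    pos = position s

    c : Clause
    c = clause s

    B : Query
    B = body c

    m : ℕ
    m = length B

    j : Fin (length (clauses P))
    j = Any.index (clause∈ s)

    textual≡ : textual j ≡ c
    textual≡ = sym (lookup-index (clause∈ s))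

    -- Permutations are indexed by the place of a clause in `clauses P`, so the one for `c` has to
    -- be transported.
    π : Permutation′ (length B)
    π = subst (λ c → Permutation′ (length (body c))) textual≡ (πs j)

    safe : SafeOrRobust P B π
    safe = transport textual≡ (proj₂ (proj₁ (proj₂ wf) j))
      where
      transport : ∀ {c c′ π} (eq : c ≡ c′) → SafeOrRobust P (body c) π →
                  SafeOrRobust P (body c′) (subst (λ c → Permutation′ (length (body c))) eq π)
      transport refl sf = sf

    oc≡ : oc j ≡ orderedClause c π
    oc≡ = transport textual≡
      where
      transport : ∀ {c c′ π} (eq : c ≡ c′) →
                  orderedClause c π ≡ orderedClause c′ (subst (λ c → Permutation′ (length (body c))) eq π)
      transport refl = refl

    ρ θ : Subst
    ρ = var ∘ rename s
    θ = mgu s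

    split≡ : Q ≡ left s ++ selected s ∷ right s
    split≡ = split s

    Q₁≡ : Q₁ ≡ (left s ++ B [ ρ ]q ++ right s) [ θ ]q
    Q₁≡ = result s

    at-selected : At pos Q (selected s)
    at-selected = subst₂ (λ k Q → At k Q (selected s)) (+-identityʳ pos) (sym split≡) (At-++ʳ (left s) here)

    -- `DirectDescendant` read backwards, together with the instantiation of the atom.
    data Origin (l : ℕ) (b : Atom) : Set where
      from-left  : ∀ {a} → l < pos → At l Q a → b ≡ a [ θ ]ₐ → Origin l b
      from-body  : ∀ i → l ≡ pos + toℕ i → b ≡ lookup B i [ ρ ⊙ θ ]ₐ → Origin l b
      from-right : ∀ {a} d → l ≡ pos + (m + d) → At (suc (pos + d)) Q a → b ≡ a [ θ ]ₐ → Origin l b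

    origin : ∀ {l b} → At l Q₁ b → Origin l b
    origin at with At-subst⁻ (left s ++ B [ ρ ]q ++ right s) (subst (λ Q → At _ Q _) Q₁≡ at)
    ... | a , at₁ , refl with At-++⁻ (left s) at₁
    ...   | inj₁ (lt , at₂) = from-left lt (subst (λ Q → At _ Q a) (sym split≡) (At-++ˡ at₂)) refl
    ...   | inj₂ (d , refl , at₂) with At-++⁻ (B [ ρ ]q) at₂
    ...     | inj₁ (_ , at₃) with At-subst⁻ B at₃
    ...       | b , at₄ , refl with At-index at₄
    ...         | i , refl , refl = from-body i refl (⊙-atom ρ θ (lookup B i))
    origin at | a , at₁ , refl | inj₂ (_ , refl , at₂) | inj₂ (d , refl , at₃) =
      from-right d (cong (λ n → pos + (n + d)) (length-map (_[ ρ ]ₐ) B))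
        (subst₂ (λ k Q → At k Q a) (+-suc pos d) (sym split≡) (At-++ʳ (left s) (there at₃))) refl

    -- The new textual position of an atom that was not selected: to its left, one atom may have
    -- been replaced by `m`.
    shift : ℕ → ℕ
    shift i with i <? pos
    ... | yes _ = i
    ... | no  _ = (i ∸ 1) + m

    shift-< : ∀ {i} → i < pos → shift i ≡ i
    shift-< {i} lt with i <? pos
    ... | yes _  = refl
    ... | no  ≮ = ⊥-elim (≮ lt)

    shift-> : ∀ d → shift (suc (pos + d)) ≡ pos + (m + d)
    shift-> d with suc (pos + d) <? pos
    ... | yes lt = ⊥-elim (m+n≮m pos d (<⇒≤ lt))
    ... | no  _  = trans (+-assoc pos d m) (cong (pos +_) (+-comm d m))

    data Side (i : ℕ) : Set where
      before : i < pos → Side i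
      after  : ∀ d → i ≡ suc (pos + d) → Side i

    side : ∀ {i} → i ≢ pos → Side i
    side {i} i≢ with i <? pos
    ... | yes lt = before lt
    ... | no  ≮ = after (i ∸ suc pos) (sym (m+[n∸m]≡n (≤∧≢⇒< (≮⇒≥ ≮) (i≢ ∘ sym))))

    shift-mono : ∀ {i k} → i ≢ pos → k ≢ pos → i < k → shift i < shift k
    shift-mono i≢ k≢ i<k with side i≢ | side k≢
    ... | before lt    | before lt′    = subst₂ _<_ (sym (shift-< lt)) (sym (shift-< lt′)) i<k
    ... | before lt    | after d refl  =
      subst₂ _<_ (sym (shift-< lt)) (sym (shift-> d)) (≤-trans lt (m≤m+n pos (m + d)))
    ... | after d refl | before lt     = ⊥-elim (m+n≮m pos d (<-trans (<-trans (n<1+n _) i<k) lt))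
    ... | after d refl | after d′ refl =
      subst₂ _<_ (sym (shift-> d)) (sym (shift-> d′))
        (+-monoʳ-< pos (+-monoʳ-< m (+-cancelˡ-< pos d d′ (≤-pred i<k))))

    shift-injective : ∀ {i k} → i ≢ pos → k ≢ pos → i ≢ k → shift i ≢ shift k
    shift-injective {i} {k} i≢ k≢ i≢k eq with <-cmp i k
    ... | tri< lt _ _ = <-irrefl eq (shift-mono i≢ k≢ lt)
    ... | tri≈ _ e _  = i≢k e
    ... | tri> _ _ gt = <-irrefl (sym eq) (shift-mono k≢ i≢ gt)

    move : Entry → Entry
    move (i , a) = shift i , a [ θ ]ₐ

    here-entry : ∃[ O₁ ] ∃[ O₂ ] entries S ≡ O₁ ++ (pos , selected s) ∷ O₂
    here-entry = ∈-∃++ (covering S at-selected)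

    O₁ O₂ : List Entry
    O₁ = proj₁ here-entry
    O₂ = proj₁ (proj₂ here-entry)

    entries≡ : entries S ≡ O₁ ++ (pos , selected s) ∷ O₂
    entries≡ = proj₂ (proj₂ here-entry)

    Bs : List Entry
    Bs = bodyEntries B π safe pos (ρ ⊙ θ)

    new : List Entry
    new = map move O₁ ++ Bs ++ map move O₂

    parts : AllPairs Precedes O₁ × AllPairs Precedes ((pos , selected s) ∷ O₂)
            × All (λ x → All (Precedes x) ((pos , selected s) ∷ O₂)) O₁
    parts = AllPairs-++⁻ O₁ (subst (AllPairs Precedes) entries≡ (sorted S))

    O₁≢ : ∀ {e} → e ∈ O₁ → proj₁ e ≢ pos
    O₁≢ e∈ = proj₁ (All.head (All.lookup (proj₂ (proj₂ parts)) e∈))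

    O₂≢ : ∀ {e} → e ∈ O₂ → proj₁ e ≢ pos
    O₂≢ e∈ with proj₁ (proj₂ parts)
    ... | rs ∷ _ = proj₁ (All.lookup rs e∈) ∘ sym

    move-precedes : ∀ {x y} → proj₁ x ≢ pos → proj₁ y ≢ pos → Precedes x y → Precedes (move x) (move y)
    move-precedes x≢ y≢ (ne , inj₁ hr) = shift-injective x≢ y≢ ne , inj₁ hr
    move-precedes x≢ y≢ (ne , inj₂ lt) = shift-injective x≢ y≢ ne , inj₂ (shift-mono x≢ y≢ lt)

    head-pred : pred (selected s) ≡ pred (head c)
    head-pred = cong pred (IsMGU.unifies (is-mgu s))

    body-robust : HereditarilyRobust (pred (selected s)) → ∀ i → HereditarilyRobust (pred (lookup B i))
    body-robust hr i q dep =
      hr q ((c , clause∈ s , sym head-pred , lookup B i , ∈-lookup i , refl) ◅ dep)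

    -- The body inherits the place of the selected atom in both orders and, through `DependsOn`, its
    -- hereditary robustness.
    before-body : ∀ {x} → Precedes x (pos , selected s) → ∀ i → Precedes (move x) (pos + toℕ i , lookup B i [ ρ ⊙ θ ]ₐ)
    before-body {x} (ne , h) i = shift≢ (side ne) , by h
      where
      shift≢ : Side (proj₁ x) → shift (proj₁ x) ≢ pos + toℕ i
      shift≢ (before lt) eq = m+n≮m pos (toℕ i) (subst (_< pos) (trans (sym (shift-< lt)) eq) lt)
      shift≢ (after d e) eq = <-irrefl (sym (+-cancelˡ-≡ pos _ _ (trans (sym (trans (cong shift e) (shift-> d))) eq)))
                                (≤-trans (FinP.toℕ<n i) (m≤m+n m d))
      by : HereditarilyRobust (pred (selected s)) ⊎ proj₁ x < pos →
           HereditarilyRobust (pred (lookup B i)) ⊎ shift (proj₁ x) < pos + toℕ i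
      by (inj₁ hr) = inj₁ (body-robust hr i)
      by (inj₂ lt) = inj₂ (subst (_< pos + toℕ i) (sym (shift-< lt)) (≤-trans lt (m≤m+n pos (toℕ i))))

    after-body : ∀ {y} → Precedes (pos , selected s) y → ∀ i → Precedes (pos + toℕ i , lookup B i [ ρ ⊙ θ ]ₐ) (move y)
    after-body {y} (ne , h) i = shift≢ (side (ne ∘ sym)) , by h
      where
      shift≢ : Side (proj₁ y) → pos + toℕ i ≢ shift (proj₁ y)
      shift≢ (before lt) eq = m+n≮m pos (toℕ i) (subst (_< pos) (trans (sym (shift-< lt)) (sym eq)) lt)
      shift≢ (after d e) eq = <-irrefl (sym (+-cancelˡ-≡ pos _ _ (trans (sym (trans (cong shift e) (shift-> d))) (sym eq))))
                                (≤-trans (FinP.toℕ<n i) (m≤m+n m d))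
      by : HereditarilyRobust (pred (proj₂ y)) ⊎ pos < proj₁ y →
           HereditarilyRobust (pred (proj₂ y)) ⊎ pos + toℕ i < shift (proj₁ y)
      by (inj₁ hr) = inj₁ hr
      by (inj₂ lt) with side (ne ∘ sym)
      ... | before lt′ = ⊥-elim (<-asym lt lt′)
      ... | after d e  = inj₂ (subst (pos + toℕ i <_) (sym (trans (cong shift e) (shift-> d)))
                                (+-monoʳ-< pos (≤-trans (FinP.toℕ<n i) (m≤m+n m d))))

    new-sorted : AllPairs Precedes new
    new-sorted with parts
    ... | sorted₁ , rs ∷ sorted₂ , cross =
      AllPairsP.++⁺ (map-moved O₁ O₁≢ sorted₁)
        (AllPairsP.++⁺ (bodyEntries-sorted B π safe pos (ρ ⊙ θ)) (map-moved O₂ O₂≢ sorted₂)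
          (All.tabulate λ {e} e∈ → All.tabulate λ {f} f∈ → body-moved e∈ f∈))
        (All.tabulate λ {e} e∈ → All.tabulate λ {f} f∈ → moved-rest e∈ (∈-++⁻ Bs f∈))
      where
      map-moved : ∀ O → (∀ {e} → e ∈ O → proj₁ e ≢ pos) → AllPairs Precedes O → AllPairs Precedes (map move O)
      map-moved []      ne []       = []
      map-moved (x ∷ O) ne (r ∷ rs) =
        AllP.map⁺ (All.tabulate λ {y} y∈ → move-precedes {x} {y} (ne (here refl)) (ne (there y∈)) (All.lookup r y∈))
        ∷ map-moved O (ne ∘ there) rs

      body-moved : ∀ {e f} → e ∈ Bs → f ∈ map move O₂ → Precedes e f
      body-moved e∈ f∈ with bodyEntries-sound B π safe pos (ρ ⊙ θ) e∈ | ∈-map⁻ move f∈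
      ... | i , refl , refl | y , y∈ , refl = after-body {y} (All.lookup rs y∈) i

      moved-rest : ∀ {e f} → e ∈ map move O₁ → f ∈ Bs ⊎ f ∈ map move O₂ → Precedes e f
      moved-rest e∈ (inj₁ f∈) with ∈-map⁻ move e∈ | bodyEntries-sound B π safe pos (ρ ⊙ θ) f∈
      ... | x , x∈ , refl | i , refl , refl = before-body {x} (All.head (All.lookup cross x∈)) i
      moved-rest e∈ (inj₂ f∈) with ∈-map⁻ move e∈ | ∈-map⁻ move f∈
      ... | x , x∈ , refl | y , y∈ , refl =
        move-precedes {x} {y} (O₁≢ x∈) (O₂≢ y∈) (All.lookup (All.tail (All.lookup cross x∈)) y∈)

    old-sound : ∀ {e} → e ∈ O₁ ⊎ e ∈ O₂ → At (proj₁ e) Q (proj₂ e)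
    old-sound {e} (inj₁ e∈) = sound S (subst (e ∈_) (sym entries≡) (∈-++⁺ˡ e∈))
    old-sound {e} (inj₂ e∈) = sound S (subst (e ∈_) (sym entries≡) (∈-++⁺ʳ O₁ (there e∈)))

    moved-sound : ∀ {i a} → i ≢ pos → At i Q a → At (shift i) Q₁ (a [ θ ]ₐ)
    moved-sound {i} {a} ne at with side ne | At-++⁻ (left s) (subst (λ Q → At i Q a) split≡ at)
    ... | before lt | inj₁ (_ , at′) =
      subst₂ (λ k Q → At k Q (a [ θ ]ₐ)) (sym (shift-< lt)) (sym Q₁≡) (At-subst θ (At-++ˡ at′))
    ... | before lt | inj₂ (d , refl , _) = ⊥-elim (m+n≮m pos d lt)
    ... | after d refl | inj₁ (lt , _) = ⊥-elim (m+n≮m pos d (<⇒≤ lt))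
    ... | after d refl | inj₂ (d′ , e , at′)
      with +-cancelˡ-≡ pos _ _ (trans (+-suc pos d) e) | at′
    ...   | refl | there at″ =
      subst₂ (λ k Q → At k Q (a [ θ ]ₐ))
        (trans (cong (λ n → pos + (n + d)) (length-map (_[ ρ ]ₐ) B)) (sym (shift-> d))) (sym Q₁≡)
        (At-subst θ (At-++ʳ (left s) (At-++ʳ (B [ ρ ]q) at″)))

    body-sound : ∀ i → At (pos + toℕ i) Q₁ (lookup B i [ ρ ⊙ θ ]ₐ)
    body-sound i = subst₂ (At (pos + toℕ i)) (sym Q₁≡) (⊙-atom ρ θ (lookup B i))
      (At-subst θ (At-++ʳ (left s) (At-++ˡ (At-subst ρ (At-lookup B i)))))

    new-sound : ∀ {i a} → (i , a) ∈ new → At i Q₁ a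
    new-sound e∈ with ∈-++⁻ (map move O₁) e∈
    ... | inj₁ e∈₁ with ∈-map⁻ move e∈₁
    ...   | x , x∈ , refl = moved-sound (O₁≢ x∈) (old-sound {x} (inj₁ x∈))
    new-sound e∈ | inj₂ e∈₂ with ∈-++⁻ Bs e∈₂
    ... | inj₂ e∈₃ with ∈-map⁻ move e∈₃
    ...   | x , x∈ , refl = moved-sound (O₂≢ x∈) (old-sound {x} (inj₂ x∈))
    new-sound e∈ | inj₂ e∈₂ | inj₁ e∈₃ with bodyEntries-sound B π safe pos (ρ ⊙ θ) e∈₃
    ... | i , refl , refl = body-sound i

    moved-covering : ∀ {i a} → i ≢ pos → At i Q a → move (i , a) ∈ new
    moved-covering {i} {a} ne at with ∈-++⁻ O₁ (subst ((i , a) ∈_) entries≡ (covering S at))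
    ... | inj₁ e∈          = ∈-++⁺ˡ (∈-map⁺ move e∈)
    ... | inj₂ (here refl) = ⊥-elim (ne refl)
    ... | inj₂ (there e∈)  = ∈-++⁺ʳ (map move O₁) (∈-++⁺ʳ Bs (∈-map⁺ move e∈))

    new-covering : ∀ {l b} → At l Q₁ b → (l , b) ∈ new
    new-covering at with origin at
    ... | from-left {a} lt at′ refl =
      subst (λ l → (l , a [ θ ]ₐ) ∈ new) (shift-< lt) (moved-covering (<⇒≢ lt) at′)
    ... | from-body i refl refl =
      ∈-++⁺ʳ (map move O₁) (∈-++⁺ˡ (bodyEntries-covering B π safe pos (ρ ⊙ θ) i))
    ... | from-right {a} d refl at′ refl =
      subst (λ l → (l , a [ θ ]ₐ) ∈ new) (shift-> d) (moved-covering (λ e → m+n≮m pos d (≤-reflexive e)) at′)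

    L′ R′ : Query
    L′ = map proj₂ O₁
    R′ = map proj₂ O₂

    ordered≡ : ordered S ≡ L′ ++ selected s ∷ R′
    ordered≡ = trans (cong (map proj₂) entries≡) (map-++ proj₂ O₁ _)

    new-ordered : map proj₂ new ≡ (L′ ++ permute B π [ ρ ]q ++ R′) [ θ ]q
    new-ordered =
      trans (map-++ proj₂ (map move O₁) _)
        (trans (cong₂ _++_ (moved O₁)
                 (trans (map-++ proj₂ Bs _)
                   (cong₂ _++_ (trans (bodyEntries-ordered B π safe pos (ρ ⊙ θ)) (sym (⊙-query ρ θ (permute B π)))) (moved O₂))))
          (sym (subst-++₃ θ L′ (permute B π [ ρ ]q) R′)))
      where
      moved : ∀ O → map proj₂ (map move O) ≡ map proj₂ O [ θ ]q
      moved []      = refl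
      moved (_ ∷ O) = cong (_ ∷_) (moved O)

    ordered-vars : ∀ {x} → x ∈ varsQ (ordered S) → x ∈ varsQ Q
    ordered-vars x∈ with find (∈-concatMap⁻ varsₐ {xs = ordered S} x∈)
    ... | a , a∈ , x∈a with ∈-map⁻ proj₂ a∈
    ...   | (i , _) , e∈ , refl = ∈-concatMap⁺ varsₐ (lose (At-∈ (sound S e∈)) x∈a)

    -- The same step seen in the order of the permutations: the atom has index `length O₁`, and the
    -- body enters permuted.
    resolve : ∀ {K : ℕ → Pred → Set} → Selectable P (selected s) → K (length O₁) (pred (selected s)) →
              Resolution K (ordered S) (map proj₂ new)
    resolve {K} sel kd = subst₂ (Resolution K) (sym ordered≡) (sym new-ordered)
      (resolution {number = j}
        (subst (λ c → L′ ++ selected s ∷ R′ -[ c , length L′ ]→ (L′ ++ permute B π [ ρ ]q ++ R′) [ θ ]q) (sym oc≡)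
          (step-semantics em s refl refl L′ R′ (permute B π)
            (λ x∈ → ordered-vars (subst (λ Q → _ ∈ varsQ Q) (sym ordered≡) x∈)) (vars-↭ (permute-↭ B π))))
        (subst (λ k → At k (L′ ++ selected s ∷ R′) (selected s)) (+-identityʳ _) (At-++ʳ L′ here))
        sel
        (subst (λ k → K k (pred (selected s))) (sym (length-map proj₂ O₁)) kd))

    advance : Selectable P (selected s) → State Q₁
    advance sel = record
      { entries   = new
      ; invariant = inv-step (invariant S) (resolve {λ _ _ → ⊤} sel tt)
      ; sound     = new-sound
      ; covering  = new-covering
      ; sorted    = new-sorted }

    RobustAt : ℕ → Query → Set
    RobustAt l Q = ∀ {a} → At l Q a → HereditarilyRobust (pred a)

    robust-descendant : ∀ {l l′} → DirectDescendant s l l′ → RobustAt l Q → RobustAt l′ Q₁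
    robust-descendant (in-left lt) hr at with origin at
    ... | from-left _ at′ refl  = hr at′
    ... | from-body i refl _    = ⊥-elim (m+n≮m pos _ lt)
    ... | from-right d refl _ _ = ⊥-elim (m+n≮m pos _ lt)
    robust-descendant (in-body lt) hr at with origin at
    ... | from-left lt′ _ _   = ⊥-elim (m+n≮m pos _ lt′)
    ... | from-body i _ refl  = body-robust (hr at-selected) i
    ... | from-right d eq _ _ = ⊥-elim (m+n≮m m d (subst (_< m) (+-cancelˡ-≡ pos _ _ eq) lt))
    robust-descendant (in-right {k} le _) hr at with origin at
    ... | from-left lt′ _ _ = ⊥-elim (<-irrefl refl (≤-trans lt′ (≤-trans le (m≤m+n k m))))
    ... | from-body i eq _  =
      ⊥-elim (<-irrefl (sym eq) (≤-trans (+-monoʳ-< pos (FinP.toℕ<n i)) (+-monoˡ-≤ m le)))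
    ... | from-right {a} d eq at′ refl =
      hr (subst (λ l → At l Q a) (cong suc (sym (+-cancelʳ-≡ m k (pos + d)
        (trans eq (trans (cong (pos +_) (+-comm m d)) (sym (+-assoc pos d m))))))) at′)

  first-before : ∀ {Q} (S : State Q) {e O} → entries S ≡ e ∷ O → ∀ {k d} → At k Q d →
    ¬ HereditarilyRobust (pred d) → Selectable P (proj₂ e) × At (proj₁ e) Q (proj₂ e) × proj₁ e ≤ k
  first-before S {e} {O} eq {k} {d} at ¬hr =
    first-selectable (subst (λ O → Inv (map proj₂ O)) eq (invariant S))
    , sound S (subst (e ∈_) (sym eq) (here refl))
    , le (subst (AllPairs Precedes) eq (sorted S)) (subst ((k , d) ∈_) eq (covering S at))
    where
    le : AllPairs Precedes (e ∷ O) → (k , d) ∈ e ∷ O → proj₁ e ≤ k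
    le _        (here refl) = ≤-refl
    le (rs ∷ _) (there d∈) with All.lookup rs d∈
    ... | _ , inj₁ hr = ⊥-elim (¬hr hr)
    ... | _ , inj₂ lt = <⇒≤ lt

  module _ {Q} (S₀ : State Q) (ξ : InfiniteDerivation P Q) (left-based : IsLeftBased ξ) where
    states : ∀ n → State (query ξ n)
    states zero    = subst State (sym (start ξ)) S₀
    states (suc n) = Advance.advance (states n) (step ξ n) (proj₁ left-based n)

    descendant-robust : ∀ {m k n l} → Descendant ξ m k n l →
      (∀ {a} → At k (query ξ m) a → HereditarilyRobust (pred a)) →
      ∀ {a} → At l (query ξ n) a → HereditarilyRobust (pred a)
    descendant-robust here                       hr = hr
    descendant-robust (there {n = n} desc direct) hr =
      Advance.robust-descendant (states n) (step ξ n) direct (descendant-robust desc hr)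

    in-prefix : ∀ {i} {X Y : Query} {a} → At i (X ++ Y) a → i < length X → a ∈ X
    in-prefix {X = X} at lt with At-++⁻ X at
    ... | inj₁ (_ , at′)      = At-∈ at′
    ... | inj₂ (d , refl , _) = ⊥-elim (m+n≮m _ d lt)

    no-entries : ∀ {Q} (S : State Q) {k d} → At k Q d → ¬ entries S ≡ []
    no-entries S at eq with () ← subst (_ ∈_) eq (covering S at)

    -- The ancestor that stood in a blocked prefix cannot be hereditarily robust either. So the
    -- first atom in the order of that query lies in the same prefix, yet is selectable.
    not-waiting : ∀ {n l a} → At l (query ξ n) a → ¬ HereditarilyRobust (pred a) → ¬ Waiting ξ n l
    not-waiting {n} {l} {a} at ¬hr (m , R₁ , R₂ , k , eq , blocked , k< , desc)
      with em {P = ∃[ d ] At k (query ξ m) d × ¬ HereditarilyRobust (pred d)}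
    ... | no none = ¬hr (descendant-robust desc robust at)
      where
      robust : ∀ {d} → At k (query ξ m) d → HereditarilyRobust (pred d)
      robust {d} atd with em {P = HereditarilyRobust (pred d)}
      ... | yes hr  = hr
      ... | no ¬hr′ = ⊥-elim (none (d , atd , ¬hr′))
    ... | yes (d , atd , ¬hrd) with entries (states m) in eqO
    ...   | []    = no-entries (states m) atd eqO
    ...   | e ∷ O =
      let sel , ate , le = first-before (states m) eqO atd ¬hrd
      in All.lookup blocked (in-prefix (subst (λ Q → At (proj₁ e) Q (proj₂ e)) eq ate) (≤-<-trans le k<)) sel

    first-or-robust : ∀ n → FirstOrRobust (length (Advance.O₁ (states n) (step ξ n))) (pred (selected (step ξ n)))
    first-or-robust n with em {P = HereditarilyRobust (pred (selected (step ξ n)))}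
    ... | yes hr = inj₂ hr
    ... | no ¬hr = go (Advance.O₁ (states n) s) (Advance.entries≡ (states n) s) (proj₂ (proj₂ (Advance.parts (states n) s)))
      where
      s : Step P (query ξ n) (query ξ (suc n))
      s = step ξ n

      go : ∀ O₁ → entries (states n) ≡ O₁ ++ (position s , selected s) ∷ Advance.O₂ (states n) s →
           All (λ x → All (Precedes x) ((position s , selected s) ∷ Advance.O₂ (states n) s)) O₁ →
           FirstOrRobust (length O₁) (pred (selected s))
      go []       _  _             = inj₁ refl
      go (e ∷ O₁) eq ((r ∷ _) ∷ _) with proj₂ r | proj₂ left-based n
      ... | inj₁ hr | _            = inj₂ hr
      ... | inj₂ _  | inj₁ waiting = ⊥-elim (not-waiting (Advance.at-selected (states n) s) ¬hr waiting)
      ... | inj₂ lt | inj₂ blocked =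
        let sel , ate , _ = first-before (states n) eq (Advance.at-selected (states n) s) ¬hr
        in ⊥-elim (All.lookup blocked (in-prefix (subst (λ Q → At (proj₁ e) Q (proj₂ e)) (split s) ate) lt) sel)

    toSequence : Sequence FirstOrRobust
    toSequence = sequence (λ n → ordered (states n))
      (λ n → Advance.resolve (states n) (step ξ n) (proj₁ left-based n) (first-or-robust n))

  left-based-finite : ∀ Q π → WellFedQuery P Q π → LDDerivationsFinite P′ (permute Q π) → LeftBasedDerivationsFinite P Q
  left-based-finite Q π (rt , safe) ld-finite (ξ , left-based) =
    first-or-robust-finite
      (no-sequence⇒Acc em {_⟶_ = LDStep} λ (f , start , st) →
         ld-finite (record { query = f ; start = start ; step = proj₁ ∘ st } , proj₂ ∘ st))
      (toSequence S₀ ξ left-based)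
      (invariant (states S₀ ξ left-based 0))
      (subst (λ R → ⟦ permute Q π ⟧ ≐ ⟦ R ⟧) (sym first-query) ((λ x → x) , (λ x → x)))
    where
    S₀ : State Q
    S₀ = initial Q π rt safe

    ordered-subst : ∀ {Q Q′} (eq : Q ≡ Q′) (S : State Q) → ordered (subst State eq S) ≡ ordered S
    ordered-subst refl S = refl

    first-query : ordered (states S₀ ξ left-based 0) ≡ permute Q π
    first-query = trans (ordered-subst (sym (start ξ)) S₀)
      (trans (bodyEntries-ordered Q π safe 0 var) (var-query _))

theorem5p18 : ExcludedMiddle 0ℓ →
    (L : Language) → let open LogicPrograms L in
    (P : Program) (πs : BodyPermutations P)
    (Q : Query) (π : Permutation′ (length Q)) →
    WellFedProgram P πs →
    WellFedQuery P Q π →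
    LDDerivationsFinite (permuteProgram P πs) (permute Q π) →
    LeftBasedDerivationsFinite P Q
theorem5p18 em L P πs Q π wfP = LeftBased.left-based-finite em L P πs wfP Q π
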